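{- Let $r\ge 2$ be an integer, put $m=3\cdot 2^r$, and let $s\ge 1$ be an integer. Then the sequence \[ \bigl(\operatorname{odd}(t_m(n))\bmod 2^s\bigr)_{n\ge 0} \] is $2$-automatic.
   Context: Let $T(x)=\prod_{j\ge 0}(1-x^{2^j})\in\mathbb Z[[x]]$ be the Thue--Morse generating function, and for each integer $m\ge 1$ define the integers $t_m(n)$ by $T(x)^m=\sum_{n\ge 0}t_m(n)x^n$. For a nonzero integer $a$, $\nu_2(a)$ is the largest integer $v$ such that $2^v$ divides $a$. The signed odd part is $\operatorname{odd}(a)=a/2^{\nu_2(a)}$ for $a\neq 0$ and $\operatorname{odd}(0)=0$. A sequence $(a_n)_{n\ge 0}$ with values in a finite set is $2$-automatic if there is a finite automaton which, reading the binary expansion of $n$ from the most significant digit, outputs $a_n$; equivalently, its $2$-kernel $\{(a_{2^e n+c})_{n\ge 0}: e\ge 0,\ 0\le c<2^e\}$ is finite. -}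

module Defs where

open import Data.Bool using (if_then_else_)
open import Data.Digit using (Bit; Expansion; toDigits)
open import Data.Fin using (Fin; zero; suc; toℕ; fromℕ<)
open import Data.Integer using (ℤ; +_; 0ℤ; 1ℤ; -1ℤ; _+_; _*_; ∣_∣; NonZero; ≢-nonZero)
open import Data.Integer.Divisibility using (_∣_)
open import Data.Integer.DivMod using (_/ℕ_; n%ℕd<d)
open import Data.Integer.Properties using (_≟_; +-*-semiring; *-identityˡ; +-identityʳ)
open import Data.List using (foldl; reverse)
open import Data.Nat as ℕ using (ℕ; zero; suc; _∸_; _≤_; _<_; s≤s; z<s)
import Data.Nat.Divisibility as ℕ
import Data.Nat.Properties as ℕ
open import Data.Product using (Σ-syntax; proj₁)
open import Relation.Binary.PropositionalEquality
open import Relation.Nullary using (yes; no; does; contradiction)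
open import Relation.Nullary.Decidable using (dec-false)
open import Relation.Unary using (Pred; Decidable)
open import Algebra.Properties.Semiring.Sum +-*-semiring using (sum; sum⁺-syntax; sum-cong-≗; sum-replicate-zero)

PowerSeries : Set
PowerSeries = ℕ → ℤ

one : PowerSeries
one zero    = 1ℤ
one (suc _) = 0ℤ

infixl 7 _⊛_
_⊛_ : PowerSeries → PowerSeries → PowerSeries
(f ⊛ g) n = ∑[ i ≤ n ] (f (toℕ i) * g (n ∸ toℕ i))

infixr 8 _^ˢ_
_^ˢ_ : PowerSeries → ℕ → PowerSeries
f ^ˢ zero    = one
f ^ˢ (suc m) = f ⊛ (f ^ˢ m)

-- Intended for d ≥ 1: at d = 0 this is 1, not 1 - x^0.
1-x^_ : ℕ → PowerSeries
(1-x^ d) zero    = 1ℤ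
(1-x^ d) (suc n) = if does (suc n ℕ.≟ d) then -1ℤ else 0ℤ

∏< : ℕ → (ℕ → PowerSeries) → PowerSeries
∏< zero    f = one
∏< (suc J) f = f J ⊛ ∏< J f

factor : ℕ → PowerSeries
factor j = 1-x^ (2 ℕ.^ j)

-- The infinite product ∏_{j ≥ 0} (1 - x^(2^j)) is the coefficientwise limit of
-- its partial products.  A factor with j ≥ n is 1 + O(x^(n+1)), because
-- 2^j > n, so the coefficient of x^n no longer changes from J = n on; T-limit
-- below proves this.
T : PowerSeries
T n = ∏< n factor n

t : ℕ → ℕ → ℤ
t m n = (T ^ˢ m) n

n<2^n : ∀ n → n < 2 ℕ.^ n
n<2^n zero    = z<s
n<2^n (suc n) = ℕ.≤-trans (s≤s (n<2^n n)) (ℕ.+-mono-≤ (ℕ.m^n>0 2 n) (ℕ.m≤m+n (2 ℕ.^ n) 0))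

1-x^-small : ∀ d k → suc k < d → (1-x^ d) (suc k) ≡ 0ℤ
1-x^-small d k k<d =
  cong (if_then -1ℤ else 0ℤ) (dec-false (suc k ℕ.≟ d) (ℕ.<⇒≢ k<d))

1-x^-⊛ : ∀ d f n → n < d → ((1-x^ d) ⊛ f) n ≡ f n
1-x^-⊛ d f n n<d = begin
  1ℤ * f n + sum tail₁              ≡⟨ cong₂ _+_ (*-identityˡ (f n)) (sum-cong-≗ tail₁≡0) ⟩
  f n + sum {n} (λ _ → 0ℤ)          ≡⟨ cong (λ z → f n + z) (sum-replicate-zero n) ⟩
  f n + 0ℤ                          ≡⟨ +-identityʳ (f n) ⟩
  f n                               ∎
  where
  open ≡-Reasoning
  open import Data.Fin.Properties using (toℕ<n)
  tail₁ : Fin n → ℤ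
  tail₁ i = (1-x^ d) (suc (toℕ i)) * f (n ∸ suc (toℕ i))
  tail₁≡0 : ∀ i → tail₁ i ≡ 0ℤ
  tail₁≡0 i = cong (_* f (n ∸ suc (toℕ i)))
                   (1-x^-small d (toℕ i) (ℕ.≤-<-trans (toℕ<n i) n<d))

T-limit : ∀ n k → ∏< (k ℕ.+ n) factor n ≡ T n
T-limit n zero    = refl
T-limit n (suc k) = trans
  (1-x^-⊛ (2 ℕ.^ (k ℕ.+ n)) (∏< (k ℕ.+ n) factor) n
    (ℕ.<-≤-trans (n<2^n n) (ℕ.^-monoʳ-≤ 2 (ℕ.m≤n+m n k))))
  (T-limit n k)

-- The greatest v ≤ b satisfying P, or 0 if there is none.
greatest≤ : ∀ {p} {P : Pred ℕ p} → Decidable P → ℕ → ℕ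
greatest≤ P? zero    = zero
greatest≤ P? (suc b) = if does (P? (suc b)) then suc b else greatest≤ P? b

-- The bound ∣ a ∣ loses nothing: 2^v ∣ a and a ≠ 0 give v < 2^v ≤ ∣ a ∣.
ν₂ : (a : ℤ) .{{_ : NonZero a}} → ℕ
ν₂ a = greatest≤ (λ v → 2 ℕ.^ v ℕ.∣? ∣ a ∣) ∣ a ∣

greatest≤-sat : ∀ {p} {P : Pred ℕ p} (P? : Decidable P) b → P 0 → P (greatest≤ P? b)
greatest≤-sat P? zero    p₀ = p₀
greatest≤-sat P? (suc b) p₀ with P? (suc b)
... | yes p = p
... | no  _ = greatest≤-sat P? b p₀

greatest≤-max : ∀ {p} {P : Pred ℕ p} (P? : Decidable P) b {v} → v ≤ b → P v → v ≤ greatest≤ P? b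
greatest≤-max P? zero    v≤b pv = v≤b
greatest≤-max {P = P} P? (suc b) {v} v≤b pv with P? (suc b)
... | yes _ = v≤b
... | no ¬p = greatest≤-max P? b (ℕ.s≤s⁻¹ (ℕ.≤∧≢⇒< v≤b λ v≡ → ¬p (subst P v≡ pv))) pv

ν₂-divides : (a : ℤ) .{{_ : NonZero a}} → + (2 ℕ.^ ν₂ a) ∣ a
ν₂-divides a = greatest≤-sat (λ v → 2 ℕ.^ v ℕ.∣? ∣ a ∣) ∣ a ∣ (ℕ.1∣ ∣ a ∣)

ν₂-largest : (a : ℤ) .{{_ : NonZero a}} → ∀ v → + (2 ℕ.^ v) ∣ a → v ≤ ν₂ a
ν₂-largest a v d = greatest≤-max (λ v → 2 ℕ.^ v ℕ.∣? ∣ a ∣) ∣ a ∣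
  (ℕ.≤-trans (ℕ.<⇒≤ (n<2^n v)) (ℕ.∣⇒≤ d)) d

-- Integer division _/ℕ_ is exact here, by ν₂-divides.
odd : ℤ → ℤ
odd a with a ≟ 0ℤ
... | yes _   = 0ℤ
... | no  a≢0 = a /ℕ 2 ℕ.^ ν₂ a
  where instance
    _ = ≢-nonZero a≢0
    _ = ℕ.m^n≢0 2 (ν₂ a)

_mod2^_ : ℤ → (s : ℕ) → Fin (2 ℕ.^ s)
a mod2^ s = fromℕ< (n%ℕd<d a (2 ℕ.^ s) {{ℕ.m^n≢0 2 s}})

record DFAO (A : Set) : Set where
  field
    size    : ℕ
    initial : Fin size
    step    : Fin size → Bit → Fin size
    output  : Fin size → A

  run : Expansion 2 → A
  run ds = output (foldl step initial ds)

-- toDigits lists the least significant digit first, with no superfluous zeros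
-- at the other end.
binaryMSB : ℕ → Expansion 2
binaryMSB n = reverse (proj₁ (toDigits 2 n))

2-Automatic : {A : Set} → (ℕ → A) → Set
2-Automatic {A} a = Σ[ M ∈ DFAO A ] (∀ n → DFAO.run M (binaryMSB n) ≡ a n)

{-# OPTIONS --safe #-}

-- Write m = 3 · 2^r = 4 (p + 1), H = 3 (p + 1), f n = t m n, and let
-- g n = C (n + m - 1) (m - 1) be the coefficients of (1 - x)^-m.  From
-- T(x) = (1 - x)(1 - x²) T(x⁴) one gets f (4 n + c) = Σ P (4 k + c) f (n - k)
-- with P the coefficients of (1 - x)^m (1 - x²)^m.  Expanding
-- (1 - x)² (1 - x²)² = (1 - x)⁶ + 4 x (1 - x)⁴ shows that P j is an odd
-- 2-adic multiple of C (4 H) j, and comparing factorials shows that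
-- P (4 k + c) g (n - k) / g (4 n + c) is a 2-adic unit times
-- C n k · C (n + o + b - k) (b - k), where (o , b) is (p , H) if c = 0 and
-- (p + 1 , H - 1) otherwise.  Hence û n = f n / g n satisfies a recurrence in
-- base 4 with 2-adically integral weights which are periodic in n modulo 2^s.
-- Since Σ (-1)^k C n k C (n + o + b - k) (b - k) = C (o + b) b is odd, û n is a
-- 2-adic unit, so odd (f n) ≡ odd (g n) û n.  Both factors can be computed by
-- finite automata modulo 2^s: û from its recurrence, and odd (g n), up to a
-- constant, as the product of odd (n + 1), …, odd (n + m - 1).  A base-2
-- recurrence of the same form has weights that are only half-integral, which
-- is why two digits are treated at a time.
module Submission where

open import Defs
open import Algebra.Bundles using (CommutativeRing; CommutativeSemiring)
open import Data.Bool.Base using (if_then_else_)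
open import Data.Digit using (Bit; toDigits; fromDigits)
open import Data.Fin.Base using (Fin; zero; suc; toℕ; combine; remQuot)
open import Data.Fin.Properties using (toℕ<n; toℕ≤pred[n]; toℕ-fromℕ<; fromℕ<-cong; remQuot-combine)
open import Data.Integer.Base as ℤ using (ℤ; +_; 0ℤ; 1ℤ; -1ℤ; ≢-nonZero)
open import Data.Integer.Divisibility.Signed
open import Data.Integer.DivMod using (_/ℕ_; _%ℕ_; n%ℕd<d; a≡a%ℕn+[a/ℕn]*n)
import Data.Integer.Properties as ℤ
open import Data.List.Base using ([]; _∷_; foldr)
open import Data.List.Properties using (reverse-foldl)
open import Data.Nat.Base as ℕ using (ℕ; zero; suc; _∸_; s≤s; z≤n; _!; NonZero)
open import Data.Nat.Combinatorics using (_C_; nCk+nC[k+1]≡[n+1]C[k+1]; k>n⇒nCk≡0; nCn≡1; nCk≡nC[n∸k]; nCk≡n!/k![n-k]!; k![n∸k]!∣n!)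
import Data.Nat.Divisibility as ℕ
open import Data.Nat.DivMod using (DivMod; result; _divMod_; _/_; m/n*n≡m; m≡m%n+[m/n]*n)
open import Data.Nat.Induction using (<-rec)
import Data.Nat.Properties as ℕ
import Data.Nat.Tactic.RingSolver as ℕRing
open import Data.Product.Base using (_,_; ∃; _×_; proj₁; proj₂; uncurry)
open import Data.Sum.Base using (_⊎_; inj₁; inj₂)
open import Data.Vec.Base using (Vec; []; _∷_; tabulate)
open import Data.Vec.Properties using (tabulate-cong)
open import Function.Base using (_∘_; flip)
open import Level using (0ℓ)
open import Relation.Binary.PropositionalEquality
open import Relation.Nullary using (¬_; Dec; yes; no; contradiction)
open import Relation.Nullary.Decidable using (dec-true; dec-false)
open import Algebra.Properties.Semiring.Sum ℤ.+-*-semiring using (sum; sum-cong-≗; sum-replicate-zero)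

-- The factor 3 in m is used twice. Put q = 2^(r-1), so that m = 2 · 3q. The k-th term of the
-- expanded mask is measured against C (4 H) j by comparing C (9q) k with C (3q) k, numerator by
-- numerator. As 9q - i and 3q - i differ by 6q, the first can have more factors of 2 only if 4q
-- divides it. For i < 3q this happens once, at i = q, where 8q faces 2q; the factor 4 lost there is
-- recovered from 4^k, since then k > q ≥ 2. The oddness of C (o + b) b is a matter of digit sums.
-- With x = 2^(r-2), each of p + 1 = 3x, H = 9x and their sum 12x has two binary digits 1, so C
-- (12x) (9x) has exactly two factors of 2. The coefficients C (12x - 1) (9x) and C (12x - 1) (9x -
-- 1) are 1/4 and 3/4 of it, hence odd. That û n is a unit is essential: a residue of f n / g n
-- determines odd (f n) modulo 2^s only when the power of 2 in this quotient is known.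

module TwoAdic where
  open import Data.Integer.Base using (_+_; _*_; -_; _-_)
  open import Data.Integer.Tactic.RingSolver using (solve-∀)

  -- 2-adic arithmetic inside ℤ: congruences, inverses, localized divisibility

  infix 4 _≡_[mod_]
  record _≡_[mod_] (a b M : ℤ) : Set where
    constructor by
    field difference : M ∣ a - b
  open _≡_[mod_]

  mod-refl : ∀ {M} a → a ≡ a [mod M ]
  mod-refl a = by (divides 0ℤ (ℤ.+-inverseʳ a))

  mod-reflexive : ∀ {M a b} → a ≡ b → a ≡ b [mod M ]
  mod-reflexive {a = a} refl = mod-refl a

  mod-sym : ∀ {M a b} → a ≡ b [mod M ] → b ≡ a [mod M ]
  mod-sym {M} {a} {b} (by p) = by (subst (M ∣_) (lem a b) (∣m⇒∣-m p))
    where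
    lem : ∀ a b → - (a - b) ≡ b - a
    lem = solve-∀

  mod-trans : ∀ {M a b c} → a ≡ b [mod M ] → b ≡ c [mod M ] → a ≡ c [mod M ]
  mod-trans {M} {a} {b} {c} (by p) (by q) = by (subst (M ∣_) (lem a b c) (∣m∣n⇒∣m+n p q))
    where
    lem : ∀ a b c → (a - b) + (b - c) ≡ a - c
    lem = solve-∀

  mod-+ : ∀ {M a b c d} → a ≡ b [mod M ] → c ≡ d [mod M ] → a + c ≡ b + d [mod M ]
  mod-+ {M} {a} {b} {c} {d} (by p) (by q) = by (subst (M ∣_) (lem a b c d) (∣m∣n⇒∣m+n p q))
    where
    lem : ∀ a b c d → (a - b) + (c - d) ≡ (a + c) - (b + d)
    lem = solve-∀

  mod-* : ∀ {M a b c d} → a ≡ b [mod M ] → c ≡ d [mod M ] → a * c ≡ b * d [mod M ]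
  mod-* {M} {a} {b} {c} {d} (by p) (by q) = by (subst (M ∣_) (lem a b c d) (∣m∣n⇒∣m+n (∣m⇒∣m*n c p) (∣n⇒∣m*n b q)))
    where
    lem : ∀ a b c d → (a - b) * c + b * (c - d) ≡ a * c - b * d
    lem = solve-∀

  mod-neg : ∀ {M a b} → a ≡ b [mod M ] → - a ≡ - b [mod M ]
  mod-neg {M} {a} {b} (by p) = by (subst (M ∣_) (lem a b) (∣m⇒∣-m p))
    where
    lem : ∀ a b → - (a - b) ≡ (- a) - (- b)
    lem = solve-∀

  mod-sum : ∀ {M} n {f g : Fin n → ℤ} → (∀ i → f i ≡ g i [mod M ]) → sum f ≡ sum g [mod M ]
  mod-sum zero    p = mod-refl 0ℤ
  mod-sum (suc n) p = mod-+ (p zero) (mod-sum n (p ∘ suc))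

  mod-∣ : ∀ {M N a b} → N ∣ M → a ≡ b [mod M ] → a ≡ b [mod N ]
  mod-∣ N∣M (by p) = by (∣-trans N∣M p)

  Odd : ℤ → Set
  Odd x = ∃ λ k → x ≡ 1ℤ + k * + 2

  odd-1 : Odd 1ℤ
  odd-1 = 0ℤ , refl

  odd⇒≡1 : ∀ {x} → Odd x → x ≡ 1ℤ [mod + 2 ]
  odd⇒≡1 (k , refl) = by (divides k (lem k))
    where
    lem : ∀ k → (1ℤ + k * + 2) - 1ℤ ≡ k * + 2
    lem = solve-∀

  ≡1⇒odd : ∀ {x} → x ≡ 1ℤ [mod + 2 ] → Odd x
  ≡1⇒odd {x} (by (divides q eq)) = q , trans (lem x) (cong (λ z → 1ℤ + z) eq)
    where
    lem : ∀ x → x ≡ 1ℤ + (x - 1ℤ)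
    lem = solve-∀

  odd-* : ∀ {x y} → Odd x → Odd y → Odd (x * y)
  odd-* p q = ≡1⇒odd (mod-* (odd⇒≡1 p) (odd⇒≡1 q))

  odd-mod : ∀ {x y} → x ≡ y [mod + 2 ] → Odd y → Odd x
  odd-mod p o = ≡1⇒odd (mod-trans p (odd⇒≡1 o))

  even∨odd : ∀ x → Odd x ⊎ + 2 ∣ x
  even∨odd x with x %ℕ 2 | n%ℕd<d x 2 | a≡a%ℕn+[a/ℕn]*n x 2
  ... | 0 | _ | eq = inj₂ (divides (x /ℕ 2) (trans eq (ℤ.+-identityˡ _)))
  ... | 1 | _ | eq = inj₁ (x /ℕ 2 , eq)
  ... | suc (suc _) | s≤s (s≤s ()) | _

  odd⇒¬even : ∀ {x} → Odd x → ¬ + 2 ∣ x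
  odd⇒¬even {x} (k , eq) p with ℕ.∣1⇒≡1 (∣⇒∣ᵤ {+ 2} {1ℤ} (subst (+ 2 ∣_) (trans (cong (_- k * + 2) eq) (lem k)) (∣m∣n⇒∣m-n p (∣n⇒∣m*n k ∣-refl))))
    where
    lem : ∀ k → (1ℤ + k * + 2) - k * + 2 ≡ 1ℤ
    lem = solve-∀
  ... | ()

  odd-*⁻ʳ : ∀ {x} y → Odd (x * y) → Odd y
  odd-*⁻ʳ {x} y o with even∨odd y
  ... | inj₁ oy = oy
  ... | inj₂ ey = contradiction (∣n⇒∣m*n x ey) (odd⇒¬even o)

  2^ : ℕ → ℤ
  2^ s = + (2 ℕ.^ s)

  2^-+ : ∀ a b → 2^ (a ℕ.+ b) ≡ 2^ a * 2^ b
  2^-+ a b = trans (cong +_ (ℕ.^-distribˡ-+-* 2 a b)) (ℤ.pos-* (2 ℕ.^ a) (2 ℕ.^ b))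

  2^-suc : ∀ s → 2^ (suc s) ≡ + 2 * 2^ s
  2^-suc s = ℤ.pos-* 2 (2 ℕ.^ s)

  2^-mono : ∀ {a b} → a ℕ.≤ b → 2^ a ∣ 2^ b
  2^-mono {a} {b} a≤b = divides (2^ (b ∸ a)) (trans (cong 2^ (sym (ℕ.m∸n+n≡m a≤b))) (2^-+ (b ∸ a) a))

  2^≢0 : ∀ s → 2^ s ≢ 0ℤ
  2^≢0 s eq = ℕ.<⇒≢ (ℕ.m^n>0 2 s) (sym (ℤ.+-injective eq))

  -- Newton's iteration for 1 / d: each step doubles the 2-adic precision.
  inv : ℕ → ℤ → ℤ
  inv zero    d = 1ℤ
  inv (suc s) d = inv s d * (+ 2 - d * inv s d)

  -- The error is squared at each step: `1 - d y′ = (1 - d y)²`. Only one of the gained bits is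
  -- claimed, so that the modulus is linear in the depth. At depth 0 the modulus is 2, and the claim
  -- is the oddness of `d`.
  inv-correct⁺ : ∀ s {d} → Odd d → d * inv s d ≡ 1ℤ [mod 2^ (suc s) ]
  inv-correct⁺ zero    {d} o = subst (_≡ 1ℤ [mod + 2 ]) (sym (ℤ.*-identityʳ d)) (odd⇒≡1 o)
  inv-correct⁺ (suc s) {d} o with inv-correct⁺ s o
  ... | by (divides q eq) = by (divides (- (q * q * 2^ s)) (begin
    d * (y * (+ 2 - d * y)) - 1ℤ            ≡⟨ lem d y ⟩
    - ((d * y - 1ℤ) * (d * y - 1ℤ))         ≡⟨ cong (λ z → - (z * z)) eq ⟩
    - (q * 2^ (suc s) * (q * 2^ (suc s)))   ≡⟨ cong (λ z → - (q * z * (q * 2^ (suc s)))) (2^-suc s) ⟩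
    - (q * (+ 2 * 2^ s) * (q * 2^ (suc s))) ≡⟨ lem′ q (2^ s) (2^ (suc s)) ⟩
    - (q * q * 2^ s) * (+ 2 * 2^ (suc s))   ≡⟨ cong (- (q * q * 2^ s) *_) (2^-suc (suc s)) ⟨
    - (q * q * 2^ s) * 2^ (suc (suc s))     ∎))
    where
    open ≡-Reasoning
    y = inv s d
    lem : ∀ d y → d * (y * (+ 2 - d * y)) - 1ℤ ≡ - ((d * y - 1ℤ) * (d * y - 1ℤ))
    lem = solve-∀
    lem′ : ∀ q a b → - (q * (+ 2 * a) * (q * b)) ≡ - (q * q * a) * (+ 2 * b)
    lem′ = solve-∀

  inv-correct : ∀ s {d} → Odd d → d * inv s d ≡ 1ℤ [mod 2^ s ]
  inv-correct s o = mod-∣ (2^-mono (ℕ.n≤1+n s)) (inv-correct⁺ s o)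

  inv-odd : ∀ s {d} → Odd d → Odd (inv s d)
  inv-odd s {d} o = odd-*⁻ʳ {d} (inv s d) (≡1⇒odd (mod-∣ (2^-mono {1} {suc s} (s≤s z≤n)) (inv-correct⁺ s o)))

  -- `inv s` is a polynomial in `d`. The periodicity of the weights, which contain such inverses,
  -- rests on this.
  inv-cong : ∀ {M} s {d e} → d ≡ e [mod M ] → inv s d ≡ inv s e [mod M ]
  inv-cong zero    p = mod-refl 1ℤ
  inv-cong (suc s) p = mod-* (inv-cong s p) (mod-+ (mod-refl (+ 2)) (mod-neg (mod-* p (inv-cong s p))))

  -- With `i = inv s d` one has `x = i (d x) - (d i - 1) x`, and `2^ s` divides both terms.
  2^∣odd*⇒2^∣ : ∀ s {d x} → Odd d → 2^ s ∣ d * x → 2^ s ∣ x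
  2^∣odd*⇒2^∣ s {d} {x} o p = subst (2^ s ∣_) (lem d (inv s d) x)
    (∣m∣n⇒∣m-n (∣n⇒∣m*n (inv s d) p) (∣m⇒∣m*n x (difference (inv-correct s o))))
    where
    lem : ∀ d i x → i * (d * x) - (d * i - 1ℤ) * x ≡ x
    lem = solve-∀

  -- Divisibility in the localization of ℤ at 2.
  infix 4 _∣₂_
  record _∣₂_ (a b : ℤ) : Set where
    constructor local
    field
      {unit} : ℤ
      isOdd  : Odd unit
      global : a ∣ unit * b

  ∣⇒∣₂ : ∀ {a b} → a ∣ b → a ∣₂ b
  ∣⇒∣₂ {a} {b} p = local odd-1 (subst (a ∣_) (sym (ℤ.*-identityˡ b)) p)

  ∣₂-refl : ∀ a → a ∣₂ a
  ∣₂-refl a = ∣⇒∣₂ ∣-refl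

  ∣₂-trans : ∀ {a b c} → a ∣₂ b → b ∣₂ c → a ∣₂ c
  ∣₂-trans {a} {b} {c} (local {d} od p) (local {e} oe (divides q eq)) = local (odd-* od oe)
    (subst (a ∣_) (trans (lem q d b) (trans (cong (d *_) (sym eq)) (sym (ℤ.*-assoc d e c)))) (∣n⇒∣m*n q p))
    where
    lem : ∀ q d b → q * (d * b) ≡ d * (q * b)
    lem = solve-∀

  ∣₂-+ : ∀ {a b c} → a ∣₂ b → a ∣₂ c → a ∣₂ b + c
  ∣₂-+ {a} {b} {c} (local {d} od p) (local {e} oe q) = local (odd-* od oe)
    (subst (a ∣_) (lem d e b c) (∣m∣n⇒∣m+n (∣n⇒∣m*n e p) (∣n⇒∣m*n d q)))
    where
    lem : ∀ d e b c → e * (d * b) + d * (e * c) ≡ (d * e) * (b + c)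
    lem = solve-∀

  ∣₂-* : ∀ {a b c e} → a ∣₂ b → c ∣₂ e → a * c ∣₂ b * e
  ∣₂-* {a} {b} {c} {e} (local {d} od (divides p eq)) (local {d′} od′ (divides q eq′)) = local (odd-* od od′)
    (divides (p * q) (trans (lem d d′ b e) (trans (cong₂ _*_ eq eq′) (lem p a q c))))
    where
    lem : ∀ a b c d → (a * b) * (c * d) ≡ (a * c) * (b * d)
    lem = solve-∀

  ∣₂-cancelˡ : ∀ {k a b} → k ≢ 0ℤ → k * a ∣₂ k * b → a ∣₂ b
  ∣₂-cancelˡ {k} {a} {b} k≢0 (local {d} od p) = local od
    (*-cancelˡ-∣ k {{≢-nonZero k≢0}} (subst (k * a ∣_) (lem d k b) p))
    where
    lem : ∀ d k b → d * (k * b) ≡ k * (d * b)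
    lem = solve-∀

  ∣₂-*ʳ : ∀ c {a b} → a ∣₂ b → a ∣₂ b * c
  ∣₂-*ʳ c p = ∣₂-trans p (∣⇒∣₂ (∣m⇒∣m*n c ∣-refl))

  2^∣₂⇒∣ : ∀ s {x} → 2^ s ∣₂ x → 2^ s ∣ x
  2^∣₂⇒∣ s (local o p) = 2^∣odd*⇒2^∣ s o p

  -- w represents the 2-adic integer a / b modulo 2^s.
  record Ratio (s : ℕ) (a b w : ℤ) : Set where
    constructor mkRatio
    field remainder : 2^ s * b ∣₂ a - w * b
  open Ratio

  ratio-unique : ∀ {s a b v w} → b ≢ 0ℤ → Ratio s a b v → Ratio s a b w → v ≡ w [mod 2^ s ]
  ratio-unique {s} {a} {b} {v} {w} b≢0 (mkRatio p) (mkRatio q) = by (2^∣₂⇒∣ s (∣₂-cancelˡ b≢0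
    (subst₂ _∣₂_ (ℤ.*-comm (2^ s) b) (lem a b v w) (∣₂-+ q (∣₂-*ʳ -1ℤ p)))))
    where
    lem : ∀ a b v w → (a - w * b) + (a - v * b) * -1ℤ ≡ b * (v - w)
    lem = solve-∀

  ratio-0 : ∀ {s b} → Ratio s 0ℤ b 0ℤ
  ratio-0 = mkRatio (∣⇒∣₂ (divides 0ℤ refl))

  ratio-+ : ∀ {s a a′ b v w} → Ratio s a b v → Ratio s a′ b w → Ratio s (a + a′) b (v + w)
  ratio-+ {s} {a} {a′} {b} {v} {w} (mkRatio p) (mkRatio q) = mkRatio (subst (2^ s * b ∣₂_) (lem a a′ b v w) (∣₂-+ p q))
    where
    lem : ∀ a a′ b v w → (a - v * b) + (a′ - w * b) ≡ (a + a′) - (v + w) * b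
    lem = solve-∀

  -- `Ratio` carries the integrality of a / b along with its residue, because the remainder is
  -- required to be a multiple of `b` too.
  ratio-∣₂ : ∀ {s a b w} → Ratio s a b w → b ∣₂ a
  ratio-∣₂ {s} {a} {b} {w} (mkRatio p) = subst (b ∣₂_) (lem a b w)
    (∣₂-+ (∣₂-trans (∣⇒∣₂ (∣n⇒∣m*n (2^ s) ∣-refl)) p) (∣⇒∣₂ (∣n⇒∣m*n w ∣-refl)))
    where
    lem : ∀ a b w → (a - w * b) + w * b ≡ a
    lem = solve-∀

  ratio-trans : ∀ {s a b c v w} → Ratio s a b v → Ratio s b c w → Ratio s a c (v * w)
  ratio-trans {s} {a} {b} {c} {v} {w} (mkRatio p) q = mkRatio (subst (2^ s * c ∣₂_) (lem a b c v w)
    (∣₂-+ (∣₂-trans (∣₂-* (∣₂-refl (2^ s)) (ratio-∣₂ q)) p) (∣₂-*ʳ v (remainder q))))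
    where
    lem : ∀ a b c v w → (a - v * b) + (b - w * c) * v ≡ a - v * w * c
    lem = solve-∀

  ratio-*ˡ : ∀ {s a b w} c → Ratio s a b w → Ratio s (c * a) (c * b) w
  ratio-*ˡ {s} {a} {b} {w} c (mkRatio p) = mkRatio (subst₂ _∣₂_ (lem c (2^ s) b) (lem′ a b c w) (∣₂-* (∣₂-refl c) p))
    where
    lem : ∀ c x b → c * (x * b) ≡ x * (c * b)
    lem = solve-∀
    lem′ : ∀ a b c w → c * (a - w * b) ≡ c * a - w * (c * b)
    lem′ = solve-∀

  ratio-*ʳ : ∀ {s a b w} c → Ratio s a b w → Ratio s (a * c) (b * c) w
  ratio-*ʳ {s} {a} {b} {w} c r = subst₂ (λ a b → Ratio s a b w) (ℤ.*-comm c a) (ℤ.*-comm c b) (ratio-*ˡ c r)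

  ratio-exact : ∀ {s a b w} → a ≡ w * b → Ratio s a b w
  ratio-exact {s} {a} {b} {w} refl = mkRatio (∣⇒∣₂ (divides 0ℤ (ℤ.+-inverseʳ (w * b))))

  -- The quotient a / b is the fraction w / o, and `inv s o` stands in for 1 / o.
  ratio-odd : ∀ {s a b o w} → Odd o → o * a ≡ w * b → Ratio s a b (w * inv s o)
  ratio-odd {s} {a} {b} {o} {w} oo eq with inv-correct s oo
  ... | by (divides q eq′) = mkRatio (local oo (divides (- (w * q)) (begin
    o * (a - w * inv s o * b)             ≡⟨ lem o a w b (inv s o) ⟩
    o * a - w * b - w * b * (o * inv s o - 1ℤ) ≡⟨ cong₂ (λ y z → y - w * b - w * b * z) eq eq′ ⟩
    w * b - w * b - w * b * (q * 2^ s)    ≡⟨ lem′ w b q (2^ s) ⟩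
    - (w * q) * (2^ s * b)                ∎)))
    where
    open ≡-Reasoning
    lem : ∀ o a w b i → o * (a - w * i * b) ≡ o * a - w * b - w * b * (o * i - 1ℤ)
    lem = solve-∀
    lem′ : ∀ w b q x → w * b - w * b - w * b * (q * x) ≡ - (w * q) * (x * b)
    lem′ = solve-∀

-- Powers of 2 in factorials and binomial coefficients

module Factorials where
  open TwoAdic
  open import Algebra.Solver.CommutativeMonoid ℕ.*-1-commutativeMonoid using (solve; _⊜_) renaming (_⊕_ to infixl 7 _⊗_)
  open import Data.Nat.Base using (_+_; _*_; _^_; _≤_; _<_)
  open import Data.Nat.Properties
  open import Data.Nat.Tactic.RingSolver using (solve-∀)

  C-factorial : ∀ a b → ((a + b) C a) * (a ! * b !) ≡ (a + b) !
  C-factorial a b = begin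
    ((a + b) C a) * (a ! * b !)                      ≡⟨ cong (λ z → ((a + b) C a) * (a ! * z !)) (m+n∸m≡n a b) ⟨
    ((a + b) C a) * (a ! * (a + b ∸ a) !)            ≡⟨ cong (_* (a ! * (a + b ∸ a) !)) (nCk≡n!/k![n-k]! (m≤m+n a b)) ⟩
    (a + b) ! / (a ! * (a + b ∸ a) !) * (a ! * (a + b ∸ a) !)  ≡⟨ m/n*n≡m (k![n∸k]!∣n! (m≤m+n a b)) ⟩
    (a + b) !                                        ∎
    where
    open ≡-Reasoning
    instance
      _ = a !≢0
      _ = (a + b ∸ a) !≢0
      _ = m*n≢0 (a !) ((a + b ∸ a) !)

  C-factorial′ : ∀ a b → ((a + b) C b) * (a ! * b !) ≡ (a + b) !
  C-factorial′ a b = begin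
    ((a + b) C b) * (a ! * b !)   ≡⟨ cong₂ (λ x y → (x C b) * y) (+-comm a b) (*-comm (a !) (b !)) ⟩
    ((b + a) C b) * (b ! * a !)   ≡⟨ C-factorial b a ⟩
    (b + a) !                     ≡⟨ cong _! (+-comm b a) ⟩
    (a + b) !                     ∎
    where open ≡-Reasoning

  Oddℕ : ℕ → Set
  Oddℕ n = Odd (+ n)

  oddℕ-* : ∀ {a b} → Oddℕ a → Oddℕ b → Oddℕ (a * b)
  oddℕ-* {a} {b} p q = subst Odd (sym (ℤ.pos-* a b)) (odd-* p q)

  oddℕ-2* : ∀ n → Oddℕ (1 + n * 2)
  oddℕ-2* n = + n , cong (λ z → + 1 ℤ.+ z) (ℤ.pos-* n 2)

  oddℕ : ∀ {a} n → a ≡ 1 + n * 2 → Oddℕ a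
  oddℕ n refl = oddℕ-2* n

  oddℕ-*⁻ˡ : ∀ a b → Oddℕ (a * b) → Oddℕ a
  oddℕ-*⁻ˡ a b o = odd-*⁻ʳ {+ b} (+ a) (subst Odd (trans (cong +_ (*-comm a b)) (ℤ.pos-* b a)) o)

  -- The product (4 i + 1)(4 i + 2)(4 i + 3) without the single 2 in its middle factor.
  oddBlock : ℕ → ℕ
  oddBlock i = (1 + i * 4) * (1 + i * 2) * (3 + i * 4)

  -- oddTail c n is the product of the odd parts of 4 n + 1, …, 4 n + c, and
  -- oddBlocks n that of the odd parts of the i ≤ 4 n not divisible by 4.
  oddTail : Fin 4 → ℕ → ℕ
  oddTail zero                   n = 1
  oddTail (suc zero)             n = 1 + n * 4
  oddTail (suc (suc zero))       n = (1 + n * 4) * (1 + n * 2)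
  oddTail (suc (suc (suc zero))) n = oddBlock n

  oddBlocks : ℕ → ℕ
  oddBlocks zero    = 1
  oddBlocks (suc n) = oddBlocks n * oddBlock n

  oddFactor : Fin 4 → ℕ → ℕ
  oddFactor c n = oddBlocks n * oddTail c n

  -- The exponent of 2 in (4 n + 1) ⋯ (4 n + c), to which only 4 n + 2 contributes.
  twos : Fin 4 → ℕ
  twos zero          = 0
  twos (suc zero)    = 0
  twos (suc (suc _)) = 1

  oddℕ-1+4* : ∀ n → Oddℕ (1 + n * 4)
  oddℕ-1+4* n = oddℕ (n * 2) (lem n)
    where
    lem : ∀ n → 1 + n * 4 ≡ 1 + n * 2 * 2
    lem = solve-∀

  oddBlock-odd : ∀ i → Oddℕ (oddBlock i)
  oddBlock-odd i = oddℕ-* {(1 + i * 4) * (1 + i * 2)} (oddℕ-* {1 + i * 4} (oddℕ-1+4* i) (oddℕ-2* i)) (oddℕ (1 + i * 2) (lem i))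
    where
    lem : ∀ n → 3 + n * 4 ≡ 1 + (1 + n * 2) * 2
    lem = solve-∀

  oddTail-odd : ∀ c n → Oddℕ (oddTail c n)
  oddTail-odd zero                   n = odd-1
  oddTail-odd (suc zero)             n = oddℕ-1+4* n
  oddTail-odd (suc (suc zero))       n = oddℕ-* {1 + n * 4} (oddℕ-1+4* n) (oddℕ-2* n)
  oddTail-odd (suc (suc (suc zero))) n = oddBlock-odd n

  oddBlocks-odd : ∀ n → Oddℕ (oddBlocks n)
  oddBlocks-odd zero    = odd-1
  oddBlocks-odd (suc n) = oddℕ-* {oddBlocks n} (oddBlocks-odd n) (oddBlock-odd n)

  oddFactor-odd : ∀ c n → Oddℕ (oddFactor c n)
  oddFactor-odd c n = oddℕ-* {oddBlocks n} (oddBlocks-odd n) (oddTail-odd c n)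

  -- Among four consecutive factors, 4 n + 4 gives 4 (n + 1) and 4 n + 2 gives one more 2, hence an
  -- 8 for each block.
  factorial-4* : ∀ n → (n * 4) ! ≡ 8 ^ n * (n ! * oddBlocks n)
  factorial-4* zero    = refl
  factorial-4* (suc n) = begin
    (4 + n * 4) * ((3 + n * 4) * ((2 + n * 4) * ((1 + n * 4) * (n * 4) !)))
      ≡⟨ cong (λ z → (4 + n * 4) * ((3 + n * 4) * ((2 + n * 4) * ((1 + n * 4) * z)))) (factorial-4* n) ⟩
    (4 + n * 4) * ((3 + n * 4) * ((2 + n * 4) * ((1 + n * 4) * (8 ^ n * (n ! * oddBlocks n)))))
      ≡⟨ lem n (8 ^ n) (n !) (oddBlocks n) ⟩
    8 * 8 ^ n * ((1 + n) * n ! * (oddBlocks n * oddBlock n)) ∎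
    where
    open ≡-Reasoning
    lem : ∀ n e f w → (4 + n * 4) * ((3 + n * 4) * ((2 + n * 4) * ((1 + n * 4) * (e * (f * w))))) ≡
                      8 * e * ((1 + n) * f * (w * ((1 + n * 4) * (1 + n * 2) * (3 + n * 4))))
    lem = solve-∀

  factorial-4*+ : ∀ c n → (n * 4 + toℕ c) ! ≡ 8 ^ n * 2 ^ twos c * (n ! * oddFactor c n)
  factorial-4*+ c n = trans (cong _! (+-comm (n * 4) (toℕ c))) (by-digit c)
    where
    lem₀ : ∀ e f w → e * (f * w) ≡ e * 1 * (f * (w * 1))
    lem₀ = solve-∀
    lem₁ : ∀ n e f w → (1 + n * 4) * (e * (f * w)) ≡ e * 1 * (f * (w * (1 + n * 4)))
    lem₁ = solve-∀
    lem₂ : ∀ n e f w → (2 + n * 4) * ((1 + n * 4) * (e * (f * w))) ≡ e * 2 * (f * (w * ((1 + n * 4) * (1 + n * 2))))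
    lem₂ = solve-∀
    lem₃ : ∀ n e f w → (3 + n * 4) * ((2 + n * 4) * ((1 + n * 4) * (e * (f * w)))) ≡
                       e * 2 * (f * (w * ((1 + n * 4) * (1 + n * 2) * (3 + n * 4))))
    lem₃ = solve-∀
    by-digit : ∀ c → (toℕ c + n * 4) ! ≡ 8 ^ n * 2 ^ twos c * (n ! * oddFactor c n)
    by-digit zero = trans (factorial-4* n) (lem₀ (8 ^ n) (n !) (oddBlocks n))
    by-digit (suc zero) = trans (cong ((1 + n * 4) *_) (factorial-4* n)) (lem₁ n (8 ^ n) (n !) (oddBlocks n))
    by-digit (suc (suc zero)) = trans (cong (λ z → (2 + n * 4) * ((1 + n * 4) * z)) (factorial-4* n)) (lem₂ n (8 ^ n) (n !) (oddBlocks n))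
    by-digit (suc (suc (suc zero))) = trans (cong (λ z → (3 + n * 4) * ((2 + n * 4) * ((1 + n * 4) * z))) (factorial-4* n)) (lem₃ n (8 ^ n) (n !) (oddBlocks n))

  factorial-2* : ∀ n → ∃ λ o → Oddℕ o × (n * 2) ! ≡ 2 ^ n * (n ! * o)
  factorial-2* zero    = 1 , odd-1 , refl
  factorial-2* (suc n) with factorial-2* n
  ... | o , odd-o , eq = o * (1 + n * 2) , oddℕ-* {o} odd-o (oddℕ-2* n) ,
    trans (cong (λ z → (2 + n * 2) * ((1 + n * 2) * z)) eq) (lem n (2 ^ n) (n !) o)
    where
    lem : ∀ n e f w → (2 + n * 2) * ((1 + n * 2) * (e * (f * w))) ≡ 2 * e * ((1 + n) * f * (w * (1 + n * 2)))
    lem = solve-∀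

  -- This is Legendre's formula in relative form: n minus the exponent of 2 in n! is the binary
  -- digit sum of n, which multiplication by `2 ^ t` preserves. The factor `2 ^ x` on the left
  -- avoids a subtraction of exponents.
  factorial-*2^ : ∀ x t → ∃ λ o → Oddℕ o × (x * 2 ^ t) ! * 2 ^ x ≡ 2 ^ (x * 2 ^ t) * (x ! * o)
  factorial-*2^ x zero    = 1 , odd-1 , (begin
    (x * 1) ! * 2 ^ x        ≡⟨ cong (λ z → z ! * 2 ^ x) (*-identityʳ x) ⟩
    x ! * 2 ^ x              ≡⟨ lem (x !) (2 ^ x) ⟩
    2 ^ x * (x ! * 1)        ≡⟨ cong (λ z → 2 ^ z * (x ! * 1)) (*-identityʳ x) ⟨
    2 ^ (x * 1) * (x ! * 1)  ∎)
    where
    open ≡-Reasoning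
    lem : ∀ a b → a * b ≡ b * (a * 1)
    lem = solve-∀
  factorial-*2^ x (suc t) with factorial-*2^ x t | factorial-2* (x * 2 ^ t)
  ... | o , odd-o , eq | o′ , odd-o′ , eq′ = o * o′ , oddℕ-* {o} odd-o odd-o′ , (begin
    (x * (2 * 2 ^ t)) ! * 2 ^ x                         ≡⟨ cong (λ z → z ! * 2 ^ x) double ⟩
    (x * 2 ^ t * 2) ! * 2 ^ x                           ≡⟨ cong (_* 2 ^ x) eq′ ⟩
    2 ^ n * (n ! * o′) * 2 ^ x                          ≡⟨ lem (2 ^ n) (n !) o′ (2 ^ x) ⟩
    2 ^ n * o′ * (n ! * 2 ^ x)                          ≡⟨ cong (2 ^ n * o′ *_) eq ⟩
    2 ^ n * o′ * (2 ^ n * (x ! * o))                    ≡⟨ lem′ (2 ^ n) o′ (x !) o ⟩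
    2 ^ n * 2 ^ n * (x ! * (o * o′))                    ≡⟨ cong (_* (x ! * (o * o′))) (^-distribˡ-+-* 2 n n) ⟨
    2 ^ (n + n) * (x ! * (o * o′))                      ≡⟨ cong (λ z → 2 ^ z * (x ! * (o * o′))) (trans (twice n) (sym double)) ⟩
    2 ^ (x * (2 * 2 ^ t)) * (x ! * (o * o′))            ∎)
    where
    open ≡-Reasoning
    n = x * 2 ^ t
    double : x * (2 * 2 ^ t) ≡ x * 2 ^ t * 2
    double = d x (2 ^ t)
      where
      d : ∀ x p → x * (2 * p) ≡ x * p * 2
      d = solve-∀
    twice : ∀ n → n + n ≡ n * 2
    twice = solve-∀
    lem : ∀ a b c d → a * (b * c) * d ≡ a * c * (b * d)
    lem = solve-∀
    lem′ : ∀ a b c d → a * b * (a * (c * d)) ≡ a * a * (c * (d * b))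
    lem′ = solve-∀

  -- For x = 3, 9, 12, x! is 2^(x - 2) times an odd number.
  factorial-two-bits : ∀ x t → ∀ u w → Oddℕ w → x ! ≡ u * w → 2 ^ x ≡ 4 * u → .{{NonZero u}} →
    ∃ λ o → Oddℕ o × (x * 2 ^ t) ! * 4 ≡ 2 ^ (x * 2 ^ t) * o
  factorial-two-bits x t u w odd-w eqw equ with factorial-*2^ x t
  ... | o , odd-o , eq = w * o , oddℕ-* {w} odd-w odd-o , *-cancelʳ-≡ _ _ u (begin
    (x * 2 ^ t) ! * 4 * u           ≡⟨ *-assoc ((x * 2 ^ t) !) 4 u ⟩
    (x * 2 ^ t) ! * (4 * u)         ≡⟨ cong ((x * 2 ^ t) ! *_) equ ⟨
    (x * 2 ^ t) ! * 2 ^ x           ≡⟨ eq ⟩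
    2 ^ (x * 2 ^ t) * (x ! * o)     ≡⟨ cong (λ z → 2 ^ (x * 2 ^ t) * (z * o)) eqw ⟩
    2 ^ (x * 2 ^ t) * (u * w * o)   ≡⟨ lem (2 ^ (x * 2 ^ t)) u w o ⟩
    2 ^ (x * 2 ^ t) * (w * o) * u   ∎)
    where
    open ≡-Reasoning
    lem : ∀ e u w o → e * (u * w * o) ≡ e * (w * o) * u
    lem = solve-∀

  factorial-3*2^ : ∀ t → ∃ λ o → Oddℕ o × (3 * 2 ^ t) ! * 4 ≡ 2 ^ (3 * 2 ^ t) * o
  factorial-3*2^ t = factorial-two-bits 3 t 2 3 (oddℕ-2* 1) refl refl

  factorial-9*2^ : ∀ t → ∃ λ o → Oddℕ o × (9 * 2 ^ t) ! * 4 ≡ 2 ^ (9 * 2 ^ t) * o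
  factorial-9*2^ t = factorial-two-bits 9 t 128 2835 (oddℕ-2* 1417) refl refl

  factorial-12*2^ : ∀ t → ∃ λ o → Oddℕ o × (12 * 2 ^ t) ! * 4 ≡ 2 ^ (12 * 2 ^ t) * o
  factorial-12*2^ t = factorial-two-bits 12 t 1024 467775 (oddℕ-2* 233887) refl refl

  -- For odd `o₁`, `o₂`, `o₃` the hypotheses say that `a`, `b` and `a + b` have two binary digits 1
  -- each. By Kummer's theorem adding `a` and `b` then takes 2 + 2 - 2 carries, whence the 4.
  C-two-bits : ∀ a b o₁ o₂ o₃ → a ! * 4 ≡ 2 ^ a * o₁ → b ! * 4 ≡ 2 ^ b * o₂ → (a + b) ! * 4 ≡ 2 ^ (a + b) * o₃ →
    ((a + b) C b) * (o₁ * o₂) ≡ 4 * o₃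
  C-two-bits a b o₁ o₂ o₃ eq₁ eq₂ eq₃ = *-cancelʳ-≡ _ _ (2 ^ a * 2 ^ b) (begin
    x * (o₁ * o₂) * (2 ^ a * 2 ^ b)        ≡⟨ lem x o₁ o₂ (2 ^ a) (2 ^ b) ⟩
    x * (2 ^ a * o₁ * (2 ^ b * o₂))        ≡⟨ cong₂ (λ u v → x * (u * v)) eq₁ eq₂ ⟨
    x * (a ! * 4 * (b ! * 4))              ≡⟨ lem′ x (a !) (b !) ⟩
    4 * (x * (a ! * b !) * 4)              ≡⟨ cong (λ z → 4 * (z * 4)) (C-factorial′ a b) ⟩
    4 * ((a + b) ! * 4)                    ≡⟨ cong (4 *_) eq₃ ⟩
    4 * (2 ^ (a + b) * o₃)                 ≡⟨ cong (λ z → 4 * (z * o₃)) (^-distribˡ-+-* 2 a b) ⟩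
    4 * (2 ^ a * 2 ^ b * o₃)               ≡⟨ lem″ (2 ^ a * 2 ^ b) o₃ ⟩
    4 * o₃ * (2 ^ a * 2 ^ b)               ∎)
    where
    open ≡-Reasoning
    x = (a + b) C b
    instance
      _ = m^n≢0 2 a
      _ = m^n≢0 2 b
      _ = m*n≢0 (2 ^ a) (2 ^ b)
    lem : ∀ x a b e f → x * (a * b) * (e * f) ≡ x * (e * a * (f * b))
    lem = solve-∀
    lem′ : ∀ x a b → x * (a * 4 * (b * 4)) ≡ 4 * (x * (a * b) * 4)
    lem′ = solve-∀
    lem″ : ∀ e o → 4 * (e * o) ≡ 4 * o * e
    lem″ = solve-∀

  -- C (N - 1) b is the fraction (N - b) / N of C N b; here N is four times N - b.
  C-pred-a : ∀ a b → suc a + b ≡ 4 * suc a → (suc a + b) C b ≡ 4 * ((a + b) C b)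
  C-pred-a a b total = *-cancelʳ-≡ _ _ (suc a * (a ! * b !)) (begin
    ((suc a + b) C b) * (suc a * (a ! * b !))  ≡⟨ cong (((suc a + b) C b) *_) (*-assoc (suc a) (a !) (b !)) ⟨
    ((suc a + b) C b) * (suc a ! * b !)        ≡⟨ C-factorial′ (suc a) b ⟩
    (suc a + b) * (a + b) !                    ≡⟨ cong₂ _*_ total (sym (C-factorial′ a b)) ⟩
    4 * suc a * (y * (a ! * b !))              ≡⟨ lem (suc a) y (a ! * b !) ⟩
    4 * y * (suc a * (a ! * b !))              ∎)
    where
    open ≡-Reasoning
    y = (a + b) C b
    instance
      _ = m*n≢0 (a !) (b !) {{a !≢0}} {{b !≢0}}
      _ = m*n≢0 (suc a) (a ! * b !)
    lem : ∀ s y f → 4 * s * (y * f) ≡ 4 * y * (s * f)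
    lem = solve-∀

  -- C (N - 1) (c - 1) is the fraction c / N of C N c; here c = 3 a and N = 4 a.
  C-pred-b : ∀ a b .{{_ : NonZero a}} → suc b ≡ 3 * a → 3 * ((a + suc b) C suc b) ≡ 4 * ((a + b) C b)
  C-pred-b a b eq = *-cancelʳ-≡ _ _ (a * (a ! * b !)) (begin
    3 * x * (a * (a ! * b !))     ≡⟨ lem x a (a !) (b !) ⟩
    x * (a ! * (3 * a * b !))     ≡⟨ cong (λ z → x * (a ! * (z * b !))) eq ⟨
    x * (a ! * suc b !)           ≡⟨ C-factorial′ a (suc b) ⟩
    (a + suc b) !                 ≡⟨ cong _! (+-suc a b) ⟩
    suc (a + b) * (a + b) !       ≡⟨ cong₂ _*_ (trans (sym (+-suc a b)) (cong (λ z → a + z) eq)) (sym (C-factorial′ a b)) ⟩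
    (a + 3 * a) * (y * (a ! * b !)) ≡⟨ lem′ a y (a ! * b !) ⟩
    4 * y * (a * (a ! * b !))     ∎)
    where
    open ≡-Reasoning
    x = (a + suc b) C suc b
    y = (a + b) C b
    instance
      _ = m*n≢0 (a !) (b !) {{a !≢0}} {{b !≢0}}
      _ = m*n≢0 a (a ! * b !)
    lem : ∀ x a f g → 3 * x * (a * (f * g)) ≡ x * (f * (3 * a * g))
    lem = solve-∀
    lem′ : ∀ s y f → (s + 3 * s) * (y * f) ≡ 4 * y * (s * f)
    lem′ = solve-∀

  -- After every factorial of a number 4 y + d is expanded by `factorial-4*+`, the same smaller
  -- factorials occur on both sides and `pow` matches the powers of 2. The pair (`K`, `c″`)
  -- describes the complementary lower index 4 H - (4 k + c), the pair (`M`, `c′`) the upper index 4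
  -- n + c + μ.
  binomial-ratio : ∀ H η k l n K M μ (c c″ c′ : Fin 4) →
    H ! * 4 ≡ 2 ^ H * η →
    (k * 4 + toℕ c) + (K * 4 + toℕ c″) ≡ H * 4 →
    (n * 4 + toℕ c) + μ ≡ M * 4 + toℕ c′ →
    k + l ≡ n →
    l + μ ≡ K + M →
    8 ^ H * 2 ^ H * 8 ^ n ≡ 4 * (8 ^ k * 8 ^ K * 8 ^ M * (2 ^ twos c″ * 2 ^ twos c′)) →
    ((H * 4) C (k * 4 + toℕ c)) * ((l + μ) C μ) * (oddFactor c k * oddFactor c″ K * oddFactor c′ M) ≡
    (η * oddBlocks H) * oddFactor c n * ((n C k) * ((M + K) C K)) * ((n * 4 + toℕ c + μ) C μ)
  binomial-ratio H η k l n K M μ c c″ c′ H! eq₁ eq₂ refl eq₄ pow =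
    *-cancelʳ-≡ _ _ Z (begin
      C₁ * Cˡ * (oddFactor c k * oddFactor c″ K * oddFactor c′ M) * Z
        ≡⟨ lem₁ C₁ Cˡ (oddFactor c k) (oddFactor c″ K) (oddFactor c′ M) (8 ^ k) (2 ^ twos c) (k !) (8 ^ K) (2 ^ twos c″) (K !) (l !) (μ !) (8 ^ M) (2 ^ twos c′) (M !) ⟩
      C₁ * (8 ^ k * 2 ^ twos c * (k ! * oddFactor c k) * (8 ^ K * 2 ^ twos c″ * (K ! * oddFactor c″ K))) * 4 * (Cˡ * (l ! * μ !)) * (8 ^ M * 2 ^ twos c′ * (M ! * oddFactor c′ M))
        ≡⟨ cong₂ _*_ (cong₂ _*_ partA partB) partC ⟩
      8 ^ H * (2 ^ H * η * oddBlocks H) * (C₂ * (M ! * K !)) * (Cᴺ * (8 ^ n * 2 ^ twos c * ((n C k) * (k ! * l !) * oddFactor c n) * μ !))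
        ≡⟨ lem₂ (8 ^ H) (2 ^ H) (8 ^ n) η (oddBlocks H) C₂ (M !) (K !) Cᴺ (2 ^ twos c) (n C k) (k !) (l !) (oddFactor c n) (μ !) ⟩
      8 ^ H * 2 ^ H * 8 ^ n * (η * oddBlocks H * oddFactor c n * ((n C k) * C₂) * Cᴺ * (2 ^ twos c * k ! * K ! * (l ! * μ !) * M !))
        ≡⟨ cong (_* (η * oddBlocks H * oddFactor c n * ((n C k) * C₂) * Cᴺ * (2 ^ twos c * k ! * K ! * (l ! * μ !) * M !))) pow ⟩
      4 * (8 ^ k * 8 ^ K * 8 ^ M * (2 ^ twos c″ * 2 ^ twos c′)) * (η * oddBlocks H * oddFactor c n * ((n C k) * C₂) * Cᴺ * (2 ^ twos c * k ! * K ! * (l ! * μ !) * M !))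
        ≡⟨ lem₃ (8 ^ k) (8 ^ K) (8 ^ M) (2 ^ twos c″) (2 ^ twos c′) (η * oddBlocks H * oddFactor c n * ((n C k) * C₂) * Cᴺ) (2 ^ twos c) (k !) (K !) (l !) (μ !) (M !) ⟩
      η * oddBlocks H * oddFactor c n * ((n C k) * C₂) * Cᴺ * Z ∎)
    where
    open ≡-Reasoning
    C₁ = (H * 4) C (k * 4 + toℕ c)
    Cˡ = (l + μ) C μ
    C₂ = (M + K) C K
    Cᴺ = (n * 4 + toℕ c + μ) C μ
    Z₁ = 8 ^ k * 2 ^ twos c * k !
    Z₂ = 8 ^ K * 2 ^ twos c″ * K !
    Z₃ = 8 ^ M * 2 ^ twos c′ * M !
    -- The common factor collects the denominators of the coefficients involved; the 4 is the one
    -- that `H!` needs to become a power of 2 times `η`.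
    Z = 4 * (Z₁ * Z₂ * (l ! * μ !) * Z₃)
    nz : ∀ x i → NonZero (8 ^ x * 2 ^ i * x !)
    nz x i = m*n≢0 (8 ^ x * 2 ^ i) (x !) {{m*n≢0 (8 ^ x) (2 ^ i) {{m^n≢0 8 x}} {{m^n≢0 2 i}}}} {{x !≢0}}
    instance
      _ = m*n≢0 (l !) (μ !) {{l !≢0}} {{μ !≢0}}
      _ = nz k (twos c)
      _ = nz K (twos c″)
      _ = nz M (twos c′)
      _ = m*n≢0 Z₁ Z₂
      _ = m*n≢0 (Z₁ * Z₂) (l ! * μ !)
      _ = m*n≢0 (Z₁ * Z₂ * (l ! * μ !)) Z₃
      _ = m*n≢0 4 (Z₁ * Z₂ * (l ! * μ !) * Z₃)
    partA : C₁ * (8 ^ k * 2 ^ twos c * (k ! * oddFactor c k) * (8 ^ K * 2 ^ twos c″ * (K ! * oddFactor c″ K))) * 4 ≡ 8 ^ H * (2 ^ H * η * oddBlocks H)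
    partA = begin
      C₁ * (8 ^ k * 2 ^ twos c * (k ! * oddFactor c k) * (8 ^ K * 2 ^ twos c″ * (K ! * oddFactor c″ K))) * 4
        ≡⟨ cong₂ (λ a b → C₁ * (a * b) * 4) (sym (factorial-4*+ c k)) (sym (factorial-4*+ c″ K)) ⟩
      C₁ * ((k * 4 + toℕ c) ! * (K * 4 + toℕ c″) !) * 4
        ≡⟨ cong (λ z → (z C (k * 4 + toℕ c)) * ((k * 4 + toℕ c) ! * (K * 4 + toℕ c″) !) * 4) (sym eq₁) ⟩
      (((k * 4 + toℕ c) + (K * 4 + toℕ c″)) C (k * 4 + toℕ c)) * ((k * 4 + toℕ c) ! * (K * 4 + toℕ c″) !) * 4
        ≡⟨ cong (_* 4) (trans (C-factorial (k * 4 + toℕ c) (K * 4 + toℕ c″)) (cong _! eq₁)) ⟩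
      (H * 4) ! * 4                       ≡⟨ cong (_* 4) (factorial-4* H) ⟩
      8 ^ H * (H ! * oddBlocks H) * 4     ≡⟨ lem (8 ^ H) (H !) (oddBlocks H) ⟩
      8 ^ H * (H ! * 4 * oddBlocks H)     ≡⟨ cong (λ z → 8 ^ H * (z * oddBlocks H)) H! ⟩
      8 ^ H * (2 ^ H * η * oddBlocks H)   ∎
      where
      lem : ∀ e f w → e * (f * w) * 4 ≡ e * (f * 4 * w)
      lem = solve-∀
    partB : Cˡ * (l ! * μ !) ≡ C₂ * (M ! * K !)
    partB = trans (C-factorial′ l μ) (trans (cong _! (trans eq₄ (+-comm K M))) (sym (C-factorial′ M K)))
    partC : 8 ^ M * 2 ^ twos c′ * (M ! * oddFactor c′ M) ≡ Cᴺ * (8 ^ n * 2 ^ twos c * ((n C k) * (k ! * l !) * oddFactor c n) * μ !)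
    partC = begin
      8 ^ M * 2 ^ twos c′ * (M ! * oddFactor c′ M)  ≡⟨ factorial-4*+ c′ M ⟨
      (M * 4 + toℕ c′) !                            ≡⟨ cong _! eq₂ ⟨
      (n * 4 + toℕ c + μ) !                         ≡⟨ C-factorial′ (n * 4 + toℕ c) μ ⟨
      Cᴺ * ((n * 4 + toℕ c) ! * μ !)                ≡⟨ cong (λ z → Cᴺ * (z * μ !)) (factorial-4*+ c n) ⟩
      Cᴺ * (8 ^ n * 2 ^ twos c * (n ! * oddFactor c n) * μ !) ≡⟨ cong (λ z → Cᴺ * (8 ^ n * 2 ^ twos c * (z * oddFactor c n) * μ !)) (C-factorial k l) ⟨
      Cᴺ * (8 ^ n * 2 ^ twos c * ((n C k) * (k ! * l !) * oddFactor c n) * μ !) ∎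
    lem₁ : ∀ C₁ Cˡ f g h e₁ t₁ k! e₂ t₂ K! l! μ! e₃ t₃ M! →
      C₁ * Cˡ * (f * g * h) * (4 * (e₁ * t₁ * k! * (e₂ * t₂ * K!) * (l! * μ!) * (e₃ * t₃ * M!))) ≡
      C₁ * (e₁ * t₁ * (k! * f) * (e₂ * t₂ * (K! * g))) * 4 * (Cˡ * (l! * μ!)) * (e₃ * t₃ * (M! * h))
    lem₁ = solve 17 (λ four C₁ Cˡ f g h e₁ t₁ k! e₂ t₂ K! l! μ! e₃ t₃ M! →
      C₁ ⊗ Cˡ ⊗ (f ⊗ g ⊗ h) ⊗ (four ⊗ (e₁ ⊗ t₁ ⊗ k! ⊗ (e₂ ⊗ t₂ ⊗ K!) ⊗ (l! ⊗ μ!) ⊗ (e₃ ⊗ t₃ ⊗ M!))) ⊜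
      C₁ ⊗ (e₁ ⊗ t₁ ⊗ (k! ⊗ f) ⊗ (e₂ ⊗ t₂ ⊗ (K! ⊗ g))) ⊗ four ⊗ (Cˡ ⊗ (l! ⊗ μ!)) ⊗ (e₃ ⊗ t₃ ⊗ (M! ⊗ h))) refl 4
    lem₂ : ∀ eH hH en η w C₂ M! K! Cᴺ t Cⁿ k! l! f μ! →
      eH * (hH * η * w) * (C₂ * (M! * K!)) * (Cᴺ * (en * t * (Cⁿ * (k! * l!) * f) * μ!)) ≡
      eH * hH * en * (η * w * f * (Cⁿ * C₂) * Cᴺ * (t * k! * K! * (l! * μ!) * M!))
    lem₂ = solve 15 (λ eH hH en η w C₂ M! K! Cᴺ t Cⁿ k! l! f μ! →
      eH ⊗ (hH ⊗ η ⊗ w) ⊗ (C₂ ⊗ (M! ⊗ K!)) ⊗ (Cᴺ ⊗ (en ⊗ t ⊗ (Cⁿ ⊗ (k! ⊗ l!) ⊗ f) ⊗ μ!)) ⊜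
      eH ⊗ hH ⊗ en ⊗ (η ⊗ w ⊗ f ⊗ (Cⁿ ⊗ C₂) ⊗ Cᴺ ⊗ (t ⊗ k! ⊗ K! ⊗ (l! ⊗ μ!) ⊗ M!))) refl
    lem₃ : ∀ a b c d e R t k! K! l! μ! M! →
      4 * (a * b * c * (d * e)) * (R * (t * k! * K! * (l! * μ!) * M!)) ≡
      R * (4 * (a * t * k! * (b * d * K!) * (l! * μ!) * (c * e * M!)))
    lem₃ = solve 13 (λ four a b c d e R t k! K! l! μ! M! →
      four ⊗ (a ⊗ b ⊗ c ⊗ (d ⊗ e)) ⊗ (R ⊗ (t ⊗ k! ⊗ K! ⊗ (l! ⊗ μ!) ⊗ M!)) ⊜
      R ⊗ (four ⊗ (a ⊗ t ⊗ k! ⊗ (b ⊗ d ⊗ K!) ⊗ (l! ⊗ μ!) ⊗ (c ⊗ e ⊗ M!)))) refl 4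

open TwoAdic
open Factorials
open import Data.Integer.Base using (_+_; _*_; -_; _-_)
open import Data.Integer.Tactic.RingSolver using (solve-∀)

-- Power series

+-congˡ : ∀ x {y z} → y ≡ z → x + y ≡ x + z
+-congˡ x = cong (λ z → x + z)

infix 4 _≈_
_≈_ : PowerSeries → PowerSeries → Set
f ≈ g = ∀ n → f n ≡ g n

-- A record, so that f and g can be inferred from a proof of f ≋ g.
infix 4 _≋_
record _≋_ (f g : PowerSeries) : Set where
  constructor coeffs
  field at : f ≈ g
open _≋_ public

infixl 6 _⊕_
_⊕_ : PowerSeries → PowerSeries → PowerSeries
(f ⊕ g) n = f n + g n

⊖_ : PowerSeries → PowerSeries
(⊖ f) n = - f n

𝟘 : PowerSeries
𝟘 _ = 0ℤ

infixr 7 _·_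
_·_ : ℤ → PowerSeries → PowerSeries
(c · f) n = c * f n

tl : PowerSeries → PowerSeries
tl f n = f (suc n)

⊛-cong-≤ : ∀ n {f f′ g g′} → (∀ i → i ℕ.≤ n → f i ≡ f′ i) → (∀ i → i ℕ.≤ n → g i ≡ g′ i) →
           (f ⊛ g) n ≡ (f′ ⊛ g′) n
⊛-cong-≤ zero    p q = cong (_+ 0ℤ) (cong₂ _*_ (p 0 z≤n) (q 0 z≤n))
⊛-cong-≤ (suc n) p q = cong₂ _+_ (cong₂ _*_ (p 0 z≤n) (q (suc n) ℕ.≤-refl))
  (⊛-cong-≤ n (λ i i≤n → p (suc i) (s≤s i≤n)) (λ i i≤n → q i (ℕ.m≤n⇒m≤1+n i≤n)))

⊛-cong : ∀ {f f′ g g′} → f ≈ f′ → g ≈ g′ → f ⊛ g ≈ f′ ⊛ g′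
⊛-cong p q n = ⊛-cong-≤ n (λ i _ → p i) (λ i _ → q i)

⊛-distribʳ : ∀ h f g → (f ⊕ g) ⊛ h ≈ (f ⊛ h) ⊕ (g ⊛ h)
⊛-distribʳ h f g zero    = lem (f 0) (g 0) (h 0)
  where
  lem : ∀ a b c → (a + b) * c + 0ℤ ≡ (a * c + 0ℤ) + (b * c + 0ℤ)
  lem = solve-∀
⊛-distribʳ h f g (suc n) = trans
  (+-congˡ ((f 0 + g 0) * h (suc n)) (⊛-distribʳ h (tl f) (tl g) n))
  (lem (f 0) (g 0) (h (suc n)) ((tl f ⊛ h) n) ((tl g ⊛ h) n))
  where
  lem : ∀ a b c x y → (a + b) * c + (x + y) ≡ (a * c + x) + (b * c + y)
  lem = solve-∀

·-⊛ : ∀ c f g → (c · f) ⊛ g ≈ c · (f ⊛ g)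
·-⊛ c f g zero    = lem c (f 0) (g 0)
  where
  lem : ∀ c a b → c * a * b + 0ℤ ≡ c * (a * b + 0ℤ)
  lem = solve-∀
·-⊛ c f g (suc n) = trans
  (+-congˡ (c * f 0 * g (suc n)) (·-⊛ c (tl f) g n))
  (lem c (f 0) (g (suc n)) ((tl f ⊛ g) n))
  where
  lem : ∀ c a b x → c * a * b + c * x ≡ c * (a * b + x)
  lem = solve-∀

-- By definition `_⊛_` peels off the first coefficient of its left factor. Peeling the right factor
-- as well makes commutativity an induction.
⊛-sucʳ : ∀ f g n → (f ⊛ g) (suc n) ≡ (f ⊛ tl g) n + f (suc n) * g 0
⊛-sucʳ f g zero    = lem (f 0) (g 1) (f 1) (g 0)
  where
  lem : ∀ a b c d → a * b + (c * d + 0ℤ) ≡ (a * b + 0ℤ) + c * d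
  lem = solve-∀
⊛-sucʳ f g (suc n) = trans
  (+-congˡ (f 0 * g (suc (suc n))) (⊛-sucʳ (tl f) g n))
  (sym (ℤ.+-assoc (f 0 * g (suc (suc n))) ((tl f ⊛ tl g) n) (f (suc (suc n)) * g 0)))

⊛-comm : ∀ f g → f ⊛ g ≈ g ⊛ f
⊛-comm f g zero    = cong (_+ 0ℤ) (ℤ.*-comm (f 0) (g 0))
⊛-comm f g (suc n) = trans
  (cong₂ _+_ (ℤ.*-comm (f 0) (g (suc n))) (⊛-comm (tl f) g n))
  (trans (ℤ.+-comm (g (suc n) * f 0) ((g ⊛ tl f) n)) (sym (⊛-sucʳ g f n)))

⊛-assoc : ∀ f g h → (f ⊛ g) ⊛ h ≈ f ⊛ (g ⊛ h)
⊛-assoc f g h zero    = lem (f 0) (g 0) (h 0)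
  where
  lem : ∀ a b c → (a * b + 0ℤ) * c + 0ℤ ≡ a * (b * c + 0ℤ) + 0ℤ
  lem = solve-∀
⊛-assoc f g h (suc n) = begin
  (f 0 * g 0 + 0ℤ) * h (suc n) + (((f 0 · tl g) ⊕ (tl f ⊛ g)) ⊛ h) n
    ≡⟨ +-congˡ ((f 0 * g 0 + 0ℤ) * h (suc n)) (trans (⊛-distribʳ h (f 0 · tl g) (tl f ⊛ g) n)
         (cong₂ _+_ (·-⊛ (f 0) (tl g) h n) (⊛-assoc (tl f) g h n))) ⟩
  (f 0 * g 0 + 0ℤ) * h (suc n) + (f 0 * (tl g ⊛ h) n + (tl f ⊛ (g ⊛ h)) n)
    ≡⟨ lem (f 0) (g 0) (h (suc n)) ((tl g ⊛ h) n) ((tl f ⊛ (g ⊛ h)) n) ⟩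
  f 0 * (g 0 * h (suc n) + (tl g ⊛ h) n) + (tl f ⊛ (g ⊛ h)) n ∎
  where
  open ≡-Reasoning
  lem : ∀ a b c x y → (a * b + 0ℤ) * c + (a * x + y) ≡ a * (b * c + x) + y
  lem = solve-∀

⊛-zeroˡ : ∀ f → 𝟘 ⊛ f ≈ 𝟘
⊛-zeroˡ f zero    = refl
⊛-zeroˡ f (suc n) = trans (ℤ.+-identityˡ _) (⊛-zeroˡ f n)

⊛-identityˡ : ∀ f → one ⊛ f ≈ f
⊛-identityˡ f zero    = trans (ℤ.+-identityʳ _) (ℤ.*-identityˡ (f 0))
⊛-identityˡ f (suc n) = trans (cong₂ _+_ (ℤ.*-identityˡ (f (suc n))) (⊛-zeroˡ f n)) (ℤ.+-identityʳ _)

⊛-distribˡ : ∀ h f g → h ⊛ (f ⊕ g) ≈ (h ⊛ f) ⊕ (h ⊛ g)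
⊛-distribˡ h f g n = trans (⊛-comm h (f ⊕ g) n)
  (trans (⊛-distribʳ h f g n) (cong₂ _+_ (⊛-comm f h n) (⊛-comm g h n)))

-- This makes the laws of exponents and the binomial theorem available for power series.
powerSeriesRing : CommutativeRing 0ℓ 0ℓ
powerSeriesRing = record
  { Carrier = PowerSeries ; _≈_ = _≋_ ; _+_ = _⊕_ ; _*_ = _⊛_ ; -_ = ⊖_ ; 0# = 𝟘 ; 1# = one
  ; isCommutativeRing = record
    { isRing = record
      { +-isAbelianGroup = record
        { isGroup = record
          { isMonoid = record
            { isSemigroup = record
              { isMagma = record
                { isEquivalence = record
                  { refl = coeffs λ _ → refl ; sym = λ p → coeffs λ n → sym (at p n) ; trans = λ p q → coeffs λ n → trans (at p n) (at q n) }
                ; ∙-cong = λ p q → coeffs λ n → cong₂ _+_ (at p n) (at q n) }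
              ; assoc = λ f g h → coeffs λ n → ℤ.+-assoc (f n) (g n) (h n) }
            ; identity = (λ f → coeffs λ n → ℤ.+-identityˡ (f n)) , (λ f → coeffs λ n → ℤ.+-identityʳ (f n)) }
          ; inverse = (λ f → coeffs λ n → ℤ.+-inverseˡ (f n)) , (λ f → coeffs λ n → ℤ.+-inverseʳ (f n))
          ; ⁻¹-cong = λ p → coeffs λ n → cong -_ (at p n) }
        ; comm = λ f g → coeffs λ n → ℤ.+-comm (f n) (g n) }
      ; *-cong = λ p q → coeffs (⊛-cong (at p) (at q))
      ; *-assoc = λ f g h → coeffs (⊛-assoc f g h)
      ; *-identity = (λ f → coeffs (⊛-identityˡ f)) , λ f → coeffs λ n → trans (⊛-comm f one n) (⊛-identityˡ f n)
      ; distrib = (λ h f g → coeffs (⊛-distribˡ h f g)) , (λ h f g → coeffs (⊛-distribʳ h f g)) }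
    ; *-comm = λ f g → coeffs (⊛-comm f g) } }

module PS = CommutativeRing powerSeriesRing
open import Algebra.Properties.CommutativeSemiring.Exp PS.commutativeSemiring
  public using () renaming (_^_ to _^ᴾ_; ^-homo-* to ^ᴾ-homo-*; ^-distrib-* to ^ᴾ-distrib-*; ^-assocʳ to ^ᴾ-assocʳ; ^-congˡ to ^ᴾ-congˡ)

⊛-congˡ : ∀ f {g h} → g ≋ h → f ⊛ g ≋ f ⊛ h
⊛-congˡ f p = PS.*-cong {f} {f} PS.refl p

⊛-congʳ : ∀ h {f g} → f ≋ g → f ⊛ h ≋ g ⊛ h
⊛-congʳ h p = PS.*-cong p (PS.refl {h})

^ˢ≈^ᴾ : ∀ f n → f ^ˢ n ≋ f ^ᴾ n
^ˢ≈^ᴾ f zero    = PS.refl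
^ˢ≈^ᴾ f (suc n) = ⊛-congˡ f (^ˢ≈^ᴾ f n)

-- The substitution x ↦ x².
dil : PowerSeries → PowerSeries
dil f zero          = f 0
dil f (suc zero)    = 0ℤ
dil f (suc (suc n)) = dil (tl f) n

dil-cong-≤ : ∀ n {f g} → (∀ i → i ℕ.≤ n → f i ≡ g i) → dil f n ≡ dil g n
dil-cong-≤ zero          p = p 0 z≤n
dil-cong-≤ (suc zero)    p = refl
dil-cong-≤ (suc (suc n)) p = dil-cong-≤ n (λ i i≤n → p (suc i) (ℕ.m≤n⇒m≤1+n (s≤s i≤n)))

dil-cong : ∀ {f g} → f ≋ g → dil f ≋ dil g
dil-cong p = coeffs λ n → dil-cong-≤ n (λ i _ → at p i)

dil-⊕ : ∀ f g → dil (f ⊕ g) ≈ dil f ⊕ dil g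
dil-⊕ f g zero          = refl
dil-⊕ f g (suc zero)    = refl
dil-⊕ f g (suc (suc n)) = dil-⊕ (tl f) (tl g) n

dil-· : ∀ c f → dil (c · f) ≈ c · dil f
dil-· c f zero          = refl
dil-· c f (suc zero)    = sym (ℤ.*-zeroʳ c)
dil-· c f (suc (suc n)) = dil-· c (tl f) n

dil-⊛ : ∀ f g → dil (f ⊛ g) ≈ dil f ⊛ dil g
dil-⊛ f g zero          = refl
dil-⊛ f g (suc zero)    = lem (f 0) (g 0)
  where
  lem : ∀ a b → 0ℤ ≡ a * 0ℤ + (0ℤ * b + 0ℤ)
  lem = solve-∀
dil-⊛ f g (suc (suc n)) = trans (dil-⊕ (f 0 · tl g) (tl f ⊛ g) n)
  (cong₂ _+_ (dil-· (f 0) (tl g) n) (trans (dil-⊛ (tl f) g n) (sym (ℤ.+-identityˡ _))))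

dil-one : dil one ≈ one
dil-one zero          = refl
dil-one (suc zero)    = refl
dil-one (suc (suc n)) = dil-𝟘 n
  where
  dil-𝟘 : ∀ n → dil 𝟘 n ≡ 0ℤ
  dil-𝟘 zero          = refl
  dil-𝟘 (suc zero)    = refl
  dil-𝟘 (suc (suc n)) = dil-𝟘 n

dil-^ : ∀ f n → dil (f ^ᴾ n) ≋ dil f ^ᴾ n
dil-^ f zero    = coeffs dil-one
dil-^ f (suc n) = PS.trans (coeffs (dil-⊛ f (f ^ᴾ n))) (⊛-congˡ (dil f) (dil-^ f n))

-- Selecting the coefficients in one residue class modulo 4 commutes with multiplication by a series
-- in x⁴.
dil²-⊛ : ∀ f g (c : Fin 4) n → (dil (dil f) ⊛ g) (n ℕ.* 4 ℕ.+ toℕ c) ≡ (f ⊛ (λ k → g (k ℕ.* 4 ℕ.+ toℕ c))) n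
dil²-⊛ f g zero zero = refl
dil²-⊛ f g (suc zero) zero = refl
dil²-⊛ f g (suc (suc zero)) zero = refl
dil²-⊛ f g (suc (suc (suc zero))) zero = refl
-- Three zero coefficients of `dil (dil f)` follow each coefficient of `f`; each `ℤ.+-identityˡ`
-- removes one.
dil²-⊛ f g c (suc n) = +-congˡ (f 0 * g (suc n ℕ.* 4 ℕ.+ toℕ c))
  (trans (trans (ℤ.+-identityˡ _) (trans (ℤ.+-identityˡ _) (ℤ.+-identityˡ _)))
    (dil²-⊛ (tl f) g c n))

dil-even : ∀ f n → dil f (n ℕ.* 2) ≡ f n
dil-even f zero    = refl
dil-even f (suc n) = dil-even (tl f) n

dil-odd : ∀ f n → dil f (suc (n ℕ.* 2)) ≡ 0ℤ
dil-odd f zero    = refl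
dil-odd f (suc n) = dil-odd (tl f) n

data Parity : ℕ → Set where
  even : ∀ n → Parity (n ℕ.* 2)
  odd′ : ∀ n → Parity (suc (n ℕ.* 2))

parity : ∀ n → Parity n
parity zero = even 0
parity (suc n) with parity n
... | even k = odd′ k
... | odd′ k = even (suc k)

1-x^-diag : ∀ d → (1-x^ suc d) (suc d) ≡ -1ℤ
1-x^-diag d = cong (if_then -1ℤ else 0ℤ) (dec-true (suc d ℕ.≟ suc d) refl)

1-x^-off : ∀ d n → suc n ≢ d → (1-x^ d) (suc n) ≡ 0ℤ
1-x^-off d n n≢d = cong (if_then -1ℤ else 0ℤ) (dec-false (suc n ℕ.≟ d) n≢d)

even≢odd : ∀ a b → a ℕ.* 2 ≢ suc (b ℕ.* 2)
even≢odd (suc a) (suc b) eq = even≢odd a b (ℕ.suc-injective (ℕ.suc-injective eq))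

dil-1-x^ : ∀ d → dil (1-x^ suc d) ≈ 1-x^ (suc d ℕ.* 2)
dil-1-x^ d n with parity n
... | even zero = refl
... | odd′ k = trans (dil-odd (1-x^ suc d) k)
  (sym (1-x^-off (suc d ℕ.* 2) (k ℕ.* 2) (λ eq → even≢odd (suc d) k (sym eq))))
... | even (suc k) with suc k ℕ.≟ suc d
...   | yes refl = trans (dil-even (1-x^ suc d) (suc d))
          (trans (1-x^-diag d) (sym (1-x^-diag (suc (d ℕ.* 2)))))
...   | no ne = trans (dil-even (1-x^ suc d) (suc k)) (trans (1-x^-off (suc d) k ne)
          (sym (1-x^-off (suc d ℕ.* 2) (suc (k ℕ.* 2)) (λ eq → ne (ℕ.*-cancelʳ-≡ (suc k) (suc d) 2 eq)))))

-- The functional equation T(x) = (1 - x) T(x²) and its iterate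

1-x : PowerSeries
1-x = 1-x^ 1

dil-factor : ∀ j → dil (factor j) ≈ factor (suc j)
dil-factor j n with 2 ℕ.^ j in eq
... | zero  = contradiction (subst (0 ℕ.<_) eq (ℕ.m^n>0 2 j)) λ ()
... | suc d = trans (dil-1-x^ d n) (cong (λ e → (1-x^ e) n) (ℕ.*-comm (suc d) 2))

∏<-dil : ∀ J → ∏< (suc J) factor ≋ 1-x ⊛ dil (∏< J factor)
∏<-dil zero    = ⊛-congˡ 1-x (PS.sym (coeffs dil-one))
∏<-dil (suc J) = begin
  factor (suc J) ⊛ ∏< (suc J) factor           ≈⟨ PS.*-cong (PS.sym (coeffs (dil-factor J))) (∏<-dil J) ⟩
  dil (factor J) ⊛ (1-x ⊛ dil (∏< J factor))   ≈⟨ PS.*-assoc (dil (factor J)) 1-x (dil (∏< J factor)) ⟨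
  (dil (factor J) ⊛ 1-x) ⊛ dil (∏< J factor)   ≈⟨ ⊛-congʳ (dil (∏< J factor)) (PS.*-comm (dil (factor J)) 1-x) ⟩
  (1-x ⊛ dil (factor J)) ⊛ dil (∏< J factor)   ≈⟨ PS.*-assoc 1-x (dil (factor J)) (dil (∏< J factor)) ⟩
  1-x ⊛ (dil (factor J) ⊛ dil (∏< J factor))   ≈⟨ ⊛-congˡ 1-x (coeffs (dil-⊛ (factor J) (∏< J factor))) ⟨
  1-x ⊛ dil (∏< (suc J) factor)                ∎
  where open import Relation.Binary.Reasoning.Setoid PS.setoid

T-stable : ∀ {i n} → i ℕ.≤ n → ∏< n factor i ≡ T i
T-stable {i} {n} i≤n = trans (cong (λ J → ∏< J factor i) (sym (ℕ.m∸n+n≡m i≤n))) (T-limit i (n ∸ i))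

-- The identity for finite products passes to the limit one coefficient at a time: up to degree n, n
-- factors already give `T`.
T-dil : T ≋ 1-x ⊛ dil T
T-dil = coeffs λ n → begin
  T n                               ≡⟨ sym (T-stable (ℕ.n≤1+n n)) ⟩
  ∏< (suc n) factor n               ≡⟨ at (∏<-dil n) n ⟩
  (1-x ⊛ dil (∏< n factor)) n       ≡⟨ ⊛-cong-≤ n {f = 1-x} (λ _ _ → refl) (λ i i≤n → dil-cong-≤ i (λ k k≤i → T-stable (ℕ.≤-trans k≤i i≤n))) ⟩
  (1-x ⊛ dil T) n                   ∎
  where open ≡-Reasoning

Tᵖ-dil : ∀ m → T ^ᴾ m ≋ 1-x ^ᴾ m ⊛ dil (T ^ᴾ m)
Tᵖ-dil m = begin
  T ^ᴾ m                        ≈⟨ ^ᴾ-congˡ m T-dil ⟩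
  (1-x ⊛ dil T) ^ᴾ m            ≈⟨ ^ᴾ-distrib-* 1-x (dil T) m ⟩
  1-x ^ᴾ m ⊛ dil T ^ᴾ m         ≈⟨ ⊛-congˡ (1-x ^ᴾ m) (dil-^ T m) ⟨
  1-x ^ᴾ m ⊛ dil (T ^ᴾ m)       ∎
  where open import Relation.Binary.Reasoning.Setoid PS.setoid

mask : ℕ → PowerSeries
mask m = 1-x ^ᴾ m ⊛ dil (1-x ^ᴾ m)

Tᵖ-dil² : ∀ m → T ^ᴾ m ≋ dil (dil (T ^ᴾ m)) ⊛ mask m
Tᵖ-dil² m = begin
  T ^ᴾ m                                              ≈⟨ Tᵖ-dil m ⟩
  1-x ^ᴾ m ⊛ dil (T ^ᴾ m)                             ≈⟨ ⊛-congˡ (1-x ^ᴾ m) (PS.trans (dil-cong (Tᵖ-dil m)) (coeffs (dil-⊛ (1-x ^ᴾ m) (dil (T ^ᴾ m))))) ⟩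
  1-x ^ᴾ m ⊛ (dil (1-x ^ᴾ m) ⊛ dil (dil (T ^ᴾ m)))   ≈⟨ PS.*-assoc (1-x ^ᴾ m) (dil (1-x ^ᴾ m)) (dil (dil (T ^ᴾ m))) ⟨
  mask m ⊛ dil (dil (T ^ᴾ m))                         ≈⟨ PS.*-comm (mask m) (dil (dil (T ^ᴾ m))) ⟩
  dil (dil (T ^ᴾ m)) ⊛ mask m                         ∎
  where open import Relation.Binary.Reasoning.Setoid PS.setoid

maskᶜ : ℕ → Fin 4 → PowerSeries
maskᶜ m c k = mask m (k ℕ.* 4 ℕ.+ toℕ c)

t-refinement : ∀ m c n → t m (n ℕ.* 4 ℕ.+ toℕ c) ≡ (maskᶜ m c ⊛ t m) n
t-refinement m c n = begin
  t m (n ℕ.* 4 ℕ.+ toℕ c)                                ≡⟨ at (^ˢ≈^ᴾ T m) _ ⟩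
  (T ^ᴾ m) (n ℕ.* 4 ℕ.+ toℕ c)                           ≡⟨ at (Tᵖ-dil² m) _ ⟩
  (dil (dil (T ^ᴾ m)) ⊛ mask m) (n ℕ.* 4 ℕ.+ toℕ c)      ≡⟨ dil²-⊛ (T ^ᴾ m) (mask m) c n ⟩
  (T ^ᴾ m ⊛ maskᶜ m c) n                                  ≡⟨ ⊛-comm (T ^ᴾ m) (maskᶜ m c) n ⟩
  (maskᶜ m c ⊛ T ^ᴾ m) n                                  ≡⟨ at (⊛-congˡ (maskᶜ m c) (^ˢ≈^ᴾ T m)) n ⟨
  (maskᶜ m c ⊛ t m) n                                     ∎
  where open ≡-Reasoning

-- Odd parts and residues

remainder-unique-≤ : ∀ {d r r′} → r′ ℕ.< d → r ℕ.≤ r′ → + r ≡ + r′ [mod + d ] → r ≡ r′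
remainder-unique-≤ {d} {r} {r′} r′<d r≤r′ p with r′ ∸ r in eq
... | zero  = ℕ.≤-antisym r≤r′ (ℕ.m∸n≡0⇒m≤n eq)
... | suc k = contradiction (ℕ.∣⇒≤ d∣) (ℕ.<⇒≱ (ℕ.≤-<-trans (ℕ.≤-trans (ℕ.≤-reflexive (sym eq)) (ℕ.m∸n≤m r′ r)) r′<d))
  where
  d∣ : d ℕ.∣ suc k
  d∣ = ∣⇒∣ᵤ {+ d} {+ suc k} (subst (+ d ∣_)
    (trans (ℤ.m-n≡m⊖n r′ r) (trans (ℤ.⊖-≥ r≤r′) (cong +_ eq))) (_≡_[mod_].difference (mod-sym p)))

remainder-unique : ∀ {d r r′} → r ℕ.< d → r′ ℕ.< d → + r ≡ + r′ [mod + d ] → r ≡ r′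
remainder-unique {d} {r} {r′} r<d r′<d p with ℕ.≤-total r r′
... | inj₁ r≤r′ = remainder-unique-≤ r′<d r≤r′ p
... | inj₂ r′≤r = sym (remainder-unique-≤ r<d r′≤r (mod-sym p))

%ℕ-mod : ∀ a d .{{_ : ℕ.NonZero d}} → + (a %ℕ d) ≡ a [mod + d ]
%ℕ-mod a d = mod-sym (by (divides (a /ℕ d) (trans (cong (_- + (a %ℕ d)) (a≡a%ℕn+[a/ℕn]*n a d)) (lem (+ (a %ℕ d)) (a /ℕ d * + d)))))
  where
  lem : ∀ r q → (r + q) - r ≡ q
  lem = solve-∀

mod2^-cong : ∀ s {a b} → a ≡ b [mod 2^ s ] → a mod2^ s ≡ b mod2^ s
mod2^-cong s {a} {b} p = fromℕ<-cong _ _ (remainder-unique (n%ℕd<d a (2 ℕ.^ s)) (n%ℕd<d b (2 ℕ.^ s))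
  (mod-trans (%ℕ-mod a (2 ℕ.^ s)) (mod-trans p (mod-sym (%ℕ-mod b (2 ℕ.^ s)))))) _ _
  where instance _ = ℕ.m^n≢0 2 s

⟦_⟧ : ∀ {n} → Fin n → ℤ
⟦ i ⟧ = + toℕ i

⟦mod2^⟧ : ∀ s a → ⟦ a mod2^ s ⟧ ≡ a [mod 2^ s ]
⟦mod2^⟧ s a = subst (λ r → + r ≡ a [mod 2^ s ]) (sym (toℕ-fromℕ< (n%ℕd<d a (2 ℕ.^ s)))) (%ℕ-mod a (2 ℕ.^ s))
  where instance _ = ℕ.m^n≢0 2 s

2^v∣⇒ν₂≡ : ∀ a .{{_ : ℤ.NonZero a}} v o → a ≡ o * 2^ v → Odd o → ν₂ a ≡ v
2^v∣⇒ν₂≡ a v o eq oo with ℕ.≤-total (ν₂ a) v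
... | inj₂ v≤ν with ℕ.m≤n⇒m<n∨m≡n v≤ν
...   | inj₂ v≡ν = sym v≡ν
...   | inj₁ v<ν = contradiction
        (*-cancelʳ-∣ (2^ v) {{≢-nonZero (2^≢0 v)}} (subst₂ _∣_ (2^-suc v) eq
          (∣-trans (2^-mono v<ν) (∣ᵤ⇒∣ (ν₂-divides a))))) (odd⇒¬even oo)
2^v∣⇒ν₂≡ a v o eq oo | inj₁ ν≤v = ℕ.≤-antisym ν≤v (ν₂-largest a v (∣⇒∣ᵤ (divides o eq)))

/ℕ-exact : ∀ o d .{{_ : ℕ.NonZero d}} → (o * + d) /ℕ d ≡ o
/ℕ-exact o d = ℤ.*-cancelʳ-≡ _ o (+ d) (sym (trans (a≡a%ℕn+[a/ℕn]*n (o * + d) d)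
  (trans (cong (λ r → + r + (o * + d) /ℕ d * + d) r≡0) (ℤ.+-identityˡ _))))
  where
  r≡0 : (o * + d) %ℕ d ≡ 0
  r≡0 = remainder-unique (n%ℕd<d (o * + d) d) (ℕ.>-nonZero⁻¹ d)
    (mod-trans (%ℕ-mod (o * + d) d) (by (divides o (ℤ.+-identityʳ _))))

odd-part : ∀ {a} v o → a ≡ o * 2^ v → Odd o → odd a ≡ o
odd-part {a} v o eq oo with a ℤ.≟ 0ℤ
... | yes refl with ℤ.i*j≡0⇒i≡0∨j≡0 o (sym eq)
...   | inj₁ refl = refl
...   | inj₂ z = contradiction z (2^≢0 v)
odd-part {a} v o eq oo | no a≢0 = begin
  _/ℕ_ a (2 ℕ.^ ν₂ a) {{ℕ.m^n≢0 2 (ν₂ a)}}  ≡⟨ cong (λ k → _/ℕ_ a (2 ℕ.^ k) {{ℕ.m^n≢0 2 k}}) (2^v∣⇒ν₂≡ a v o eq oo) ⟩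
  _/ℕ_ a (2 ℕ.^ v) {{ℕ.m^n≢0 2 v}}          ≡⟨ cong (λ x → _/ℕ_ x (2 ℕ.^ v) {{ℕ.m^n≢0 2 v}}) eq ⟩
  _/ℕ_ (o * 2^ v) (2 ℕ.^ v) {{ℕ.m^n≢0 2 v}} ≡⟨ /ℕ-exact o (2 ℕ.^ v) {{ℕ.m^n≢0 2 v}} ⟩
  o ∎
  where
  open ≡-Reasoning
  instance _ = ≢-nonZero a≢0

record Decomposed (a : ℤ) : Set where
  constructor decomposed
  field
    val   : ℕ
    part  : ℤ
    isOdd : Odd part
    split : a ≡ part * 2^ val

decompose : ∀ {a} → a ≢ 0ℤ → Decomposed a
decompose {a} a≢0 with ∣ᵤ⇒∣ {+ (2 ℕ.^ ν₂ a {{≢-nonZero a≢0}})} (ν₂-divides a {{≢-nonZero a≢0}})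
... | divides q eq with even∨odd q
...   | inj₁ oq = decomposed (ν₂ a {{≢-nonZero a≢0}}) q oq eq
...   | inj₂ (divides p refl) = contradiction
        (ν₂-largest a (suc ν) (∣⇒∣ᵤ (divides p (trans eq (trans (ℤ.*-assoc p (+ 2) (2^ ν)) (cong (p *_) (sym (2^-suc ν)))))))) (ℕ.<⇒≱ (ℕ.n<1+n ν))
  where
  instance _ = ≢-nonZero a≢0
  ν = ν₂ a

odd-odd : ∀ {a} → a ≢ 0ℤ → Odd (odd a)
odd-odd a≢0 with decompose a≢0
... | decomposed v o oo eq = subst Odd (sym (odd-part v o eq oo)) oo

odd-split : ∀ {a} → a ≢ 0ℤ → ∃ λ v → a ≡ odd a * 2^ v
odd-split a≢0 with decompose a≢0
... | decomposed v o oo eq = v , trans eq (cong (_* 2^ v) (sym (odd-part v o eq oo)))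

odd-distrib-* : ∀ {a b} → a ≢ 0ℤ → b ≢ 0ℤ → odd (a * b) ≡ odd a * odd b
odd-distrib-* {a} {b} a≢0 b≢0 with odd-split a≢0 | odd-split b≢0
... | v , eq | w , eq′ = odd-part (v ℕ.+ w) (odd a * odd b) (begin
  a * b                                 ≡⟨ cong₂ _*_ eq eq′ ⟩
  odd a * 2^ v * (odd b * 2^ w)         ≡⟨ lem (odd a) (2^ v) (odd b) (2^ w) ⟩
  odd a * odd b * (2^ v * 2^ w)         ≡⟨ cong (odd a * odd b *_) (2^-+ v w) ⟨
  odd a * odd b * 2^ (v ℕ.+ w)          ∎) (odd-* (odd-odd a≢0) (odd-odd b≢0))
  where
  open ≡-Reasoning
  lem : ∀ a v b w → a * v * (b * w) ≡ a * b * (v * w)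
  lem = solve-∀

odd-of-odd : ∀ {a} → Odd a → odd a ≡ a
odd-of-odd {a} o = odd-part 0 a (sym (ℤ.*-identityʳ a)) o

-- The case a = 0 occurs in the automaton, whose vector of odd parts starts with `odd 0` when n = 0.
odd-double : ∀ a → odd (a * + 2) ≡ odd a
odd-double a = helper (a ℤ.≟ 0ℤ)
  where
  helper : Dec (a ≡ 0ℤ) → odd (a * + 2) ≡ odd a
  helper (yes refl) = refl
  helper (no a≢0) with decompose a≢0
  ... | decomposed v o oo eq = trans (odd-part (suc v) o (trans (cong (_* + 2) eq)
        (trans (ℤ.*-assoc o (2^ v) (+ 2)) (cong (o *_) (trans (ℤ.*-comm (2^ v) (+ 2)) (sym (2^-suc v)))))) oo) (sym (odd-part v o eq oo))

-- Finite state sets and automata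

record Finite (S : Set) : Set where
  field
    size      : ℕ
    encode    : S → Fin size
    decode    : Fin size → S
    decode-encode : ∀ x → decode (encode x) ≡ x
open Finite

finite-Fin : ∀ n → Finite (Fin n)
finite-Fin n = record { size = n ; encode = λ i → i ; decode = λ i → i ; decode-encode = λ _ → refl }

finite-× : ∀ {A B} → Finite A → Finite B → Finite (A × B)
finite-× F G = record
  { size   = size F ℕ.* size G
  ; encode = λ (a , b) → combine (encode F a) (encode G b)
  ; decode = λ i → let (j , k) = remQuot {size F} (size G) i in decode F j , decode G k
  ; decode-encode = λ (a , b) → trans
      (cong (λ (j , k) → decode F j , decode G k) (remQuot-combine (encode F a) (encode G b)))
      (cong₂ _,_ (decode-encode F a) (decode-encode G b)) }

finite-Vec : ∀ {A} → Finite A → ∀ n → Finite (Vec A n)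
finite-Vec F zero    = record { size = 1 ; encode = λ _ → zero ; decode = λ _ → [] ; decode-encode = λ { [] → refl } }
finite-Vec F (suc n) = record
  { size   = size FG
  ; encode = λ { (x ∷ xs) → encode FG (x , xs) }
  ; decode = λ i → uncurry _∷_ (decode FG i)
  ; decode-encode = λ { (x ∷ xs) → cong (uncurry _∷_) (decode-encode FG (x , xs)) } }
  where FG = finite-× F (finite-Vec F n)

-- After reading the digits of n the automaton is in the code of `σ n`. The digits of n are stored
-- from the least significant one, so running over the reversed list is a `foldr`, and the empty
-- list stands for 0, whence the initial state.
automatic : ∀ {A S : Set} → Finite S → (σ : ℕ → S) (step : S → Bit → S) →
  (∀ b n → σ (n ℕ.* 2 ℕ.+ toℕ b) ≡ step (σ n) b) → (out : S → A) → 2-Automatic (out ∘ σ)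
automatic {A} {S} F σ step σ-step out = M , correct
  where
  step′ : Fin (size F) → Bit → Fin (size F)
  step′ i b = encode F (step (decode F i) b)
  M : DFAO A
  M = record { size = size F ; initial = encode F (σ 0) ; step = step′ ; output = out ∘ decode F }
  folded : ∀ ds → foldr (flip step′) (encode F (σ 0)) ds ≡ encode F (σ (fromDigits ds))
  folded []       = refl
  folded (d ∷ ds) = trans (cong (flip step′ d) (folded ds)) (cong (encode F) (begin
    step (decode F (encode F (σ n))) d  ≡⟨ cong (flip step d) (decode-encode F (σ n)) ⟩
    step (σ n) d                        ≡⟨ σ-step d n ⟨
    σ (n ℕ.* 2 ℕ.+ toℕ d)               ≡⟨ cong σ (ℕ.+-comm (n ℕ.* 2) (toℕ d)) ⟩
    σ (toℕ d ℕ.+ n ℕ.* 2)               ∎))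
    where
    open ≡-Reasoning
    n = fromDigits ds
  correct : ∀ n → DFAO.run M (binaryMSB n) ≡ out (σ n)
  correct n with toDigits 2 n
  ... | ds , refl = trans (cong (out ∘ decode F) (trans (reverse-foldl step′ (encode F (σ 0)) ds) (folded ds)))
    (cong out (decode-encode F (σ (fromDigits ds))))

-- Coefficients of the mask

nC0≡1 : ∀ n → n C 0 ≡ 1
nC0≡1 n = trans (nCk≡nC[n∸k] {0} {n} z≤n) (nCn≡1 n)

1-x-⊛-suc : ∀ g n → (1-x ⊛ g) (suc n) ≡ g (suc n) - g n
1-x-⊛-suc g n = cong₂ _+_ (ℤ.*-identityˡ (g (suc n))) (tail n)
  where
  tail : ∀ n → (tl 1-x ⊛ g) n ≡ - g n
  tail zero    = trans (ℤ.+-identityʳ _) (ℤ.-1*i≡-i (g 0))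
  tail (suc n) = trans (cong₂ _+_ (ℤ.-1*i≡-i (g (suc n))) (⊛-zeroˡ g n)) (ℤ.+-identityʳ _)

1-x-⊛-0 : ∀ g → (1-x ⊛ g) 0 ≡ g 0
1-x-⊛-0 g = trans (ℤ.+-identityʳ _) (ℤ.*-identityˡ (g 0))

sgn : ℕ → ℤ
sgn j = -1ℤ ℤ.^ j

1-x^-coeff : ∀ N j → (1-x ^ᴾ N) j ≡ sgn j * + (N C j)
1-x^-coeff zero    zero    = refl
1-x^-coeff zero    (suc j) = sym (trans (cong (λ c → sgn (suc j) * + c) (k>n⇒nCk≡0 {0} {suc j} (s≤s z≤n))) (ℤ.*-zeroʳ (sgn (suc j))))
1-x^-coeff (suc N) zero    = trans (1-x-⊛-0 (1-x ^ᴾ N)) (trans (1-x^-coeff N 0)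
  (cong (λ c → 1ℤ * + c) (trans (nC0≡1 N) (sym (nC0≡1 (suc N))))))
1-x^-coeff (suc N) (suc j) = begin
  (1-x ⊛ 1-x ^ᴾ N) (suc j)                       ≡⟨ 1-x-⊛-suc (1-x ^ᴾ N) j ⟩
  (1-x ^ᴾ N) (suc j) - (1-x ^ᴾ N) j              ≡⟨ cong₂ _-_ (1-x^-coeff N (suc j)) (1-x^-coeff N j) ⟩
  -1ℤ * sgn j * + (N C suc j) - sgn j * + (N C j) ≡⟨ lem (sgn j) (+ (N C suc j)) (+ (N C j)) ⟩
  -1ℤ * sgn j * (+ (N C j) + + (N C suc j))      ≡⟨ cong (λ c → -1ℤ * sgn j * + c) (nCk+nC[k+1]≡[n+1]C[k+1] N j) ⟩
  sgn (suc j) * + (suc N C suc j)                ∎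
  where
  open ≡-Reasoning
  lem : ∀ s a b → -1ℤ * s * a - s * b ≡ -1ℤ * s * (b + a)
  lem = solve-∀

-- The coefficients of (1 - x)^-(a + 1).
negBinomial : ℕ → PowerSeries
negBinomial a k = + ((a ℕ.+ k) C k)

1-x⊛negBinomial : ∀ a → 1-x ⊛ negBinomial (suc a) ≋ negBinomial a
1-x⊛negBinomial a = coeffs pointwise
  where
  pointwise : ∀ n → (1-x ⊛ negBinomial (suc a)) n ≡ negBinomial a n
  pointwise zero    = trans (1-x-⊛-0 (negBinomial (suc a))) (cong +_ (trans (nC0≡1 (suc a ℕ.+ 0)) (sym (nC0≡1 (a ℕ.+ 0)))))
  pointwise (suc n) = begin
    (1-x ⊛ negBinomial (suc a)) (suc n)                          ≡⟨ 1-x-⊛-suc (negBinomial (suc a)) n ⟩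
    + (suc (a ℕ.+ suc n) C suc n) - + (suc (a ℕ.+ n) C n)        ≡⟨ cong₂ (λ x y → + x - + y) (sym (nCk+nC[k+1]≡[n+1]C[k+1] (a ℕ.+ suc n) n)) (cong (_C n) (sym (ℕ.+-suc a n))) ⟩
    + ((a ℕ.+ suc n) C n) + + ((a ℕ.+ suc n) C suc n) - + ((a ℕ.+ suc n) C n) ≡⟨ lem (+ ((a ℕ.+ suc n) C n)) (+ ((a ℕ.+ suc n) C suc n)) ⟩
    + ((a ℕ.+ suc n) C suc n)                                    ∎
    where
    open ≡-Reasoning
    lem : ∀ x y → x + y - x ≡ y
    lem = solve-∀

1-x^⊛negBinomial : ∀ n a → 1-x ^ᴾ n ⊛ negBinomial (n ℕ.+ a) ≋ negBinomial a
1-x^⊛negBinomial zero    a = PS.*-identityˡ (negBinomial a)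
1-x^⊛negBinomial (suc n) a = begin
  (1-x ⊛ 1-x ^ᴾ n) ⊛ negBinomial (suc n ℕ.+ a)  ≈⟨ ⊛-congʳ (negBinomial (suc n ℕ.+ a)) (PS.*-comm 1-x (1-x ^ᴾ n)) ⟩
  (1-x ^ᴾ n ⊛ 1-x) ⊛ negBinomial (suc n ℕ.+ a)  ≈⟨ PS.*-assoc (1-x ^ᴾ n) 1-x (negBinomial (suc n ℕ.+ a)) ⟩
  1-x ^ᴾ n ⊛ (1-x ⊛ negBinomial (suc n ℕ.+ a))  ≈⟨ ⊛-congˡ (1-x ^ᴾ n) (1-x⊛negBinomial (n ℕ.+ a)) ⟩
  1-x ^ᴾ n ⊛ negBinomial (n ℕ.+ a)              ≈⟨ 1-x^⊛negBinomial n a ⟩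
  negBinomial a                                 ∎
  where open import Relation.Binary.Reasoning.Setoid PS.setoid

-- Expansion of the mask in powers of 1 - x

𝕩 4𝕩 : PowerSeries
𝕩 (suc zero) = 1ℤ
𝕩 _          = 0ℤ
4𝕩 (suc zero) = + 4
4𝕩 _          = 0ℤ

4𝕩-⊛-suc : ∀ g n → (4𝕩 ⊛ g) (suc n) ≡ + 4 * g n
4𝕩-⊛-suc g n = trans (ℤ.+-identityˡ _) (tail n)
  where
  tail : ∀ n → (tl 4𝕩 ⊛ g) n ≡ + 4 * g n
  tail zero    = ℤ.+-identityʳ _
  tail (suc n) = trans (+-congˡ (+ 4 * g (suc n)) (⊛-zeroˡ g n)) (ℤ.+-identityʳ _)

4𝕩^-⊛ : ∀ k g i → (4𝕩 ^ᴾ k ⊛ g) (k ℕ.+ i) ≡ ((+ 4) ℤ.^ k) * g i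
4𝕩^-⊛ zero    g i = trans (⊛-identityˡ g i) (sym (ℤ.*-identityˡ (g i)))
4𝕩^-⊛ (suc k) g i = begin
  ((4𝕩 ⊛ 4𝕩 ^ᴾ k) ⊛ g) (suc (k ℕ.+ i))  ≡⟨ ⊛-assoc 4𝕩 (4𝕩 ^ᴾ k) g (suc (k ℕ.+ i)) ⟩
  (4𝕩 ⊛ (4𝕩 ^ᴾ k ⊛ g)) (suc (k ℕ.+ i))  ≡⟨ 4𝕩-⊛-suc (4𝕩 ^ᴾ k ⊛ g) (k ℕ.+ i) ⟩
  + 4 * (4𝕩 ^ᴾ k ⊛ g) (k ℕ.+ i)         ≡⟨ cong (+ 4 *_) (4𝕩^-⊛ k g i) ⟩
  + 4 * (((+ 4) ℤ.^ k) * g i)               ≡⟨ ℤ.*-assoc (+ 4) (((+ 4) ℤ.^ k)) (g i) ⟨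
  ((+ 4) ℤ.^ suc k) * g i                   ∎
  where open ≡-Reasoning

4𝕩^-⊛-< : ∀ k g {j} → j ℕ.< k → (4𝕩 ^ᴾ k ⊛ g) j ≡ 0ℤ
4𝕩^-⊛-< (suc k) g {zero}  _         = trans (⊛-assoc 4𝕩 (4𝕩 ^ᴾ k) g 0) refl
4𝕩^-⊛-< (suc k) g {suc j} (s≤s j<k) = trans (⊛-assoc 4𝕩 (4𝕩 ^ᴾ k) g (suc j))
  (trans (4𝕩-⊛-suc (4𝕩 ^ᴾ k ⊛ g) j) (trans (cong (+ 4 *_) (4𝕩^-⊛-< k g j<k)) refl))

module _ {c ℓ} (R : CommutativeSemiring c ℓ) where
  open CommutativeSemiring R renaming (_+_ to _✚_; _*_ to _✱_; _≈_ to _∼_; refl to ∼-refl)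
  open import Algebra.Solver.Ring.NaturalCoefficients.Default R
  -- For u = 1 - x the series 1 + x is `u ✚ (x ✚ x)`, so no subtraction occurs. The factor `u ✚ x`
  -- makes the identity homogeneous; it becomes 1 in the application.
  square-expansion : ∀ u x → u ✱ (u ✱ (u ✚ (x ✚ x))) ✱ (u ✱ (u ✱ (u ✚ (x ✚ x))) ✱ 1#) ∼
    (u ✚ x) ✱ (x ✚ x ✚ x ✚ x) ✱ (u ✱ (u ✱ (u ✱ (u ✱ 1#)))) ✚ (u ✱ (u ✱ (u ✱ (u ✱ (u ✱ (u ✱ 1#))))))
  square-expansion = solve 2 (λ u x →
    u :* (u :* (u :+ (x :+ x))) :* (u :* (u :* (u :+ (x :+ x))) :* con 1) :=
    (u :+ x) :* (x :+ x :+ x :+ x) :* (u :* (u :* (u :* (u :* con 1)))) :+ (u :* (u :* (u :* (u :* (u :* (u :* con 1)))))))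
    ∼-refl

1-x⊕𝕩 : 1-x ⊕ 𝕩 ≋ one
1-x⊕𝕩 = coeffs λ { zero → refl ; (suc zero) → refl ; (suc (suc n)) → refl }

dil1-x : dil 1-x ≋ 1-x ⊛ (1-x ⊕ (𝕩 ⊕ 𝕩))
dil1-x = coeffs λ n → trans (dil-1-x^ 0 n) (sym (pointwise n))
  where
  pointwise : ∀ n → (1-x ⊛ (1-x ⊕ (𝕩 ⊕ 𝕩))) n ≡ (1-x^ 2) n
  pointwise zero                = refl
  pointwise (suc zero)          = refl
  pointwise (suc (suc zero))    = refl
  pointwise (suc (suc (suc n))) = 1-x-⊛-suc (1-x ⊕ (𝕩 ⊕ 𝕩)) (suc (suc n))

mask₂ : (1-x ⊛ dil 1-x) ^ᴾ 2 ≋ 4𝕩 ⊛ 1-x ^ᴾ 4 ⊕ 1-x ^ᴾ 6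
mask₂ = begin
  (1-x ⊛ dil 1-x) ^ᴾ 2                           ≈⟨ ^ᴾ-congˡ 2 (⊛-congˡ 1-x dil1-x) ⟩
  (1-x ⊛ (1-x ⊛ (1-x ⊕ (𝕩 ⊕ 𝕩)))) ^ᴾ 2           ≈⟨ square-expansion PS.commutativeSemiring 1-x 𝕩 ⟩
  (1-x ⊕ 𝕩) ⊛ (𝕩 ⊕ 𝕩 ⊕ 𝕩 ⊕ 𝕩) ⊛ 1-x ^ᴾ 4 ⊕ 1-x ^ᴾ 6  ≈⟨ PS.+-congʳ {1-x ^ᴾ 6} (⊛-congʳ (1-x ^ᴾ 4) (PS.trans (⊛-congʳ (𝕩 ⊕ 𝕩 ⊕ 𝕩 ⊕ 𝕩) 1-x⊕𝕩) (PS.trans (PS.*-identityˡ (𝕩 ⊕ 𝕩 ⊕ 𝕩 ⊕ 𝕩)) four))) ⟩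
  4𝕩 ⊛ 1-x ^ᴾ 4 ⊕ 1-x ^ᴾ 6                       ∎
  where
  open import Relation.Binary.Reasoning.Setoid PS.setoid
  four : 𝕩 ⊕ 𝕩 ⊕ 𝕩 ⊕ 𝕩 ≋ 4𝕩
  four = coeffs λ { zero → refl ; (suc zero) → refl ; (suc (suc n)) → refl }

open import Algebra.Properties.CommutativeSemiring.Binomial PS.commutativeSemiring using (binomialTerm) renaming (theorem to binomial-theorem)
open import Algebra.Properties.Semiring.Sum PS.semiring using () renaming (sum to sumᴾ)
open import Algebra.Properties.Semiring.Mult PS.semiring using () renaming (_×_ to _×ᴾ_)

sumᴾ-at : ∀ n (g : Fin n → PowerSeries) j → sumᴾ g j ≡ sum (λ i → g i j)
sumᴾ-at zero    g j = refl
sumᴾ-at (suc n) g j = +-congˡ (g zero j) (sumᴾ-at n (g ∘ suc) j)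

×ᴾ-at : ∀ n f j → (n ×ᴾ f) j ≡ + n * f j
×ᴾ-at zero    f j = refl
×ᴾ-at (suc n) f j = trans (+-congˡ (f j) (×ᴾ-at n f j)) (sym (ℤ.suc-* (+ n) (f j)))

-- The exponent is 4 k + 6 (h - k): k factors `4𝕩 ⊛ 1-x ^ᴾ 4` and h - k factors `1-x ^ᴾ 6`.
maskTerm : ℕ → ℕ → PowerSeries
maskTerm h k = 4𝕩 ^ᴾ k ⊛ 1-x ^ᴾ (6 ℕ.* h ∸ 2 ℕ.* k)

mask-expansion : ∀ h j → mask (2 ℕ.* h) j ≡ sum {suc h} (λ k → + (h C toℕ k) * maskTerm h (toℕ k) j)
mask-expansion h j = begin
  mask (2 ℕ.* h) j                                                    ≡⟨ at power j ⟩
  ((4𝕩 ⊛ 1-x ^ᴾ 4 ⊕ 1-x ^ᴾ 6) ^ᴾ h) j                                ≡⟨ at (binomial-theorem h (4𝕩 ⊛ 1-x ^ᴾ 4) (1-x ^ᴾ 6)) j ⟩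
  sumᴾ {suc h} (binomialTerm (4𝕩 ⊛ 1-x ^ᴾ 4) (1-x ^ᴾ 6) h) j        ≡⟨ sumᴾ-at (suc h) (binomialTerm (4𝕩 ⊛ 1-x ^ᴾ 4) (1-x ^ᴾ 6) h) j ⟩
  sum {suc h} (λ k → binomialTerm (4𝕩 ⊛ 1-x ^ᴾ 4) (1-x ^ᴾ 6) h k j) ≡⟨ sum-cong-≗ {suc h} (λ k → trans
      (×ᴾ-at (h C toℕ k) ((4𝕩 ⊛ 1-x ^ᴾ 4) ^ᴾ toℕ k ⊛ (1-x ^ᴾ 6) ^ᴾ (h ∸ toℕ k)) j) (cong (+ (h C toℕ k) *_) (at (term (toℕ k) (toℕ≤pred[n] k)) j))) ⟩
  sum {suc h} (λ k → + (h C toℕ k) * maskTerm h (toℕ k) j)           ∎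
  where
  open ≡-Reasoning
  module S where open import Relation.Binary.Reasoning.Setoid PS.setoid public
  power : mask (2 ℕ.* h) ≋ (4𝕩 ⊛ 1-x ^ᴾ 4 ⊕ 1-x ^ᴾ 6) ^ᴾ h
  power = S.begin
    1-x ^ᴾ (2 ℕ.* h) ⊛ dil (1-x ^ᴾ (2 ℕ.* h))  S.≈⟨ ⊛-congˡ (1-x ^ᴾ (2 ℕ.* h)) (dil-^ 1-x (2 ℕ.* h)) ⟩
    1-x ^ᴾ (2 ℕ.* h) ⊛ dil 1-x ^ᴾ (2 ℕ.* h)    S.≈⟨ ^ᴾ-distrib-* 1-x (dil 1-x) (2 ℕ.* h) ⟨
    (1-x ⊛ dil 1-x) ^ᴾ (2 ℕ.* h)              S.≈⟨ ^ᴾ-assocʳ (1-x ⊛ dil 1-x) 2 h ⟨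
    ((1-x ⊛ dil 1-x) ^ᴾ 2) ^ᴾ h               S.≈⟨ ^ᴾ-congˡ h mask₂ ⟩
    (4𝕩 ⊛ 1-x ^ᴾ 4 ⊕ 1-x ^ᴾ 6) ^ᴾ h           S.∎
  exponent : ∀ k → k ℕ.≤ h → 4 ℕ.* k ℕ.+ 6 ℕ.* (h ∸ k) ≡ 6 ℕ.* h ∸ 2 ℕ.* k
  exponent k k≤h = sym (trans (cong (λ z → 6 ℕ.* z ∸ 2 ℕ.* k) (sym (ℕ.m+[n∸m]≡n k≤h)))
    (trans (cong (_∸ 2 ℕ.* k) (lem k (h ∸ k))) (ℕ.m+n∸m≡n (2 ℕ.* k) (4 ℕ.* k ℕ.+ 6 ℕ.* (h ∸ k)))))
    where
    lem : ∀ k l → 6 ℕ.* (k ℕ.+ l) ≡ 2 ℕ.* k ℕ.+ (4 ℕ.* k ℕ.+ 6 ℕ.* l)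
    lem = ℕRing.solve-∀
  term : ∀ k → k ℕ.≤ h → (4𝕩 ⊛ 1-x ^ᴾ 4) ^ᴾ k ⊛ (1-x ^ᴾ 6) ^ᴾ (h ∸ k) ≋ maskTerm h k
  term k k≤h = S.begin
    (4𝕩 ⊛ 1-x ^ᴾ 4) ^ᴾ k ⊛ (1-x ^ᴾ 6) ^ᴾ (h ∸ k)            S.≈⟨ PS.*-cong (^ᴾ-distrib-* 4𝕩 (1-x ^ᴾ 4) k) (^ᴾ-assocʳ 1-x 6 (h ∸ k)) ⟩
    4𝕩 ^ᴾ k ⊛ (1-x ^ᴾ 4) ^ᴾ k ⊛ 1-x ^ᴾ (6 ℕ.* (h ∸ k))      S.≈⟨ PS.*-assoc (4𝕩 ^ᴾ k) ((1-x ^ᴾ 4) ^ᴾ k) (1-x ^ᴾ (6 ℕ.* (h ∸ k))) ⟩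
    4𝕩 ^ᴾ k ⊛ ((1-x ^ᴾ 4) ^ᴾ k ⊛ 1-x ^ᴾ (6 ℕ.* (h ∸ k)))    S.≈⟨ ⊛-congˡ (4𝕩 ^ᴾ k) (⊛-congʳ (1-x ^ᴾ (6 ℕ.* (h ∸ k))) (^ᴾ-assocʳ 1-x 4 k)) ⟩
    4𝕩 ^ᴾ k ⊛ (1-x ^ᴾ (4 ℕ.* k) ⊛ 1-x ^ᴾ (6 ℕ.* (h ∸ k)))   S.≈⟨ ⊛-congˡ (4𝕩 ^ᴾ k) (PS.sym (^ᴾ-homo-* 1-x (4 ℕ.* k) (6 ℕ.* (h ∸ k)))) ⟩
    4𝕩 ^ᴾ k ⊛ 1-x ^ᴾ (4 ℕ.* k ℕ.+ 6 ℕ.* (h ∸ k))            S.≡⟨ cong (λ e → 4𝕩 ^ᴾ k ⊛ 1-x ^ᴾ e) (exponent k k≤h) ⟩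
    maskTerm h k                                             S.∎

-- Divisibility of binomial coefficients

C-step : ∀ k l → suc k ℕ.* ((k ℕ.+ suc l) C suc k) ≡ suc l ℕ.* ((k ℕ.+ suc l) C k)
C-step k l = ℕ.*-cancelʳ-≡ _ _ (k ! ℕ.* l !) {{ℕ.m*n≢0 (k !) (l !) {{k ℕ.!≢0}} {{l ℕ.!≢0}}}} (begin
  suc k ℕ.* x ℕ.* (k ! ℕ.* l !)     ≡⟨ lem (suc k) x (k !) (l !) ⟩
  x ℕ.* (suc k ! ℕ.* l !)           ≡⟨ cong (λ n → (n C suc k) ℕ.* (suc k ! ℕ.* l !)) (ℕ.+-suc k l) ⟩
  ((suc k ℕ.+ l) C suc k) ℕ.* (suc k ! ℕ.* l !) ≡⟨ C-factorial (suc k) l ⟩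
  (suc k ℕ.+ l) !                   ≡⟨ cong _! (ℕ.+-suc k l) ⟨
  (k ℕ.+ suc l) !                   ≡⟨ C-factorial k (suc l) ⟨
  y ℕ.* (k ! ℕ.* suc l !)           ≡⟨ lem′ y (k !) (suc l) (l !) ⟩
  suc l ℕ.* y ℕ.* (k ! ℕ.* l !)     ∎)
  where
  open ≡-Reasoning
  x = (k ℕ.+ suc l) C suc k
  y = (k ℕ.+ suc l) C k
  lem : ∀ s x a b → s ℕ.* x ℕ.* (a ℕ.* b) ≡ x ℕ.* (s ℕ.* a ℕ.* b)
  lem = ℕRing.solve-∀
  lem′ : ∀ y a s b → y ℕ.* (a ℕ.* (s ℕ.* b)) ≡ s ℕ.* y ℕ.* (a ℕ.* b)
  lem′ = ℕRing.solve-∀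

C-step′ : ∀ {k n} → k ℕ.< n → + suc k * + (n C suc k) ≡ + (n ∸ k) * + (n C k)
C-step′ {k} {n} k<n = begin
  + suc k * + (n C suc k)                  ≡⟨ ℤ.pos-* (suc k) (n C suc k) ⟨
  + (suc k ℕ.* (n C suc k))                ≡⟨ cong (λ n → + (suc k ℕ.* (n C suc k))) n≡ ⟨
  + (suc k ℕ.* ((k ℕ.+ suc l) C suc k))    ≡⟨ cong +_ (C-step k l) ⟩
  + (suc l ℕ.* ((k ℕ.+ suc l) C k))        ≡⟨ cong (λ n → + (suc l ℕ.* (n C k))) n≡ ⟩
  + (suc l ℕ.* (n C k))                    ≡⟨ cong (λ z → + (z ℕ.* (n C k))) (ℕ.+-∸-assoc 1 k<n) ⟨
  + ((n ∸ k) ℕ.* (n C k))                  ≡⟨ ℤ.pos-* (n ∸ k) (n C k) ⟩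
  + (n ∸ k) * + (n C k)                    ∎
  where
  open ≡-Reasoning
  l = n ∸ suc k
  n≡ : k ℕ.+ suc l ≡ n
  n≡ = trans (ℕ.+-suc k l) (ℕ.m+[n∸m]≡n k<n)

-- C n (k + 1) arises from C n k by the factor (n - k) / (k + 1). The denominators are the same for
-- `n` and `n′`, so only the numerators have to be compared.
C-∣₂-step : ∀ {k n n′ c d} → k ℕ.< n → k ℕ.< n′ → + (n ∸ k) ∣₂ d * + (n′ ∸ k) →
  + (n C k) ∣₂ c * + (n′ C k) → + (n C suc k) ∣₂ d * c * + (n′ C suc k)
C-∣₂-step {k} {n} {n′} {c} {d} k<n k<n′ p q = ∣₂-cancelˡ {+ suc k} (λ ())
  (subst₂ _∣₂_ (sym (C-step′ k<n)) (begin
    d * + (n′ ∸ k) * (c * + (n′ C k))    ≡⟨ lem d (+ (n′ ∸ k)) c (+ (n′ C k)) ⟩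
    d * c * (+ (n′ ∸ k) * + (n′ C k))    ≡⟨ cong (d * c *_) (C-step′ k<n′) ⟨
    d * c * (+ suc k * + (n′ C suc k))   ≡⟨ lem′ (d * c) (+ suc k) (+ (n′ C suc k)) ⟩
    + suc k * (d * c * + (n′ C suc k))   ∎)
    (∣₂-* p q))
  where
  open ≡-Reasoning
  lem : ∀ d x c y → d * x * (c * y) ≡ d * c * (x * y)
  lem = solve-∀
  lem′ : ∀ d x c → d * (x * c) ≡ x * (d * c)
  lem′ = solve-∀

module _ (u : ℕ) (q : ℕ) (q≡ : + q ≡ 2^ u) where
  private
    q≢0 : q ≢ 0
    q≢0 refl = 2^≢0 u (sym q≡)
    instance
      q-nonZero : NonZero q
      q-nonZero = ℕ.≢-nonZero q≢0

  4q∤ : ∀ {x} → 6 ℕ.* q ℕ.< x → x ℕ.≤ 9 ℕ.* q → x ≢ 8 ℕ.* q → ¬ (4 ℕ.* q) ℕ.∣ x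
  4q∤ lo hi ne (ℕ.divides w refl) with w
  ... | 0 = ℕ.<⇒≱ lo z≤n
  ... | 1 = ℕ.<⇒≱ lo (ℕ.≤-trans (ℕ.≤-reflexive (ℕ.+-identityʳ (4 ℕ.* q))) (ℕ.*-monoˡ-≤ q {4} {6} (s≤s (s≤s (s≤s (s≤s z≤n))))))
  ... | 2 = ne (lem q)
    where
    lem : ∀ q → 2 ℕ.* (4 ℕ.* q) ≡ 8 ℕ.* q
    lem = ℕRing.solve-∀
  ... | suc (suc (suc w)) = ℕ.<⇒≱ (ℕ.*-monoˡ-< q {9} {12} (ℕ.m≤n⇒m≤1+n (ℕ.m≤n⇒m≤1+n ℕ.≤-refl)))
          (ℕ.≤-trans (ℕ.≤-trans (ℕ.≤-reflexive (lem q)) (ℕ.*-monoˡ-≤ (4 ℕ.* q) {3} {3 ℕ.+ w} (s≤s (s≤s (s≤s z≤n))))) hi)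
    where
    lem : ∀ q → 12 ℕ.* q ≡ 3 ℕ.* (4 ℕ.* q)
    lem = ℕRing.solve-∀

  -- The two numbers differ by 6 q, a multiple of 2^(u+1). Hence only a multiple of 4 q could
  -- violate the claim, and the only one above 6 q and up to 9 q is 8 q, which belongs to i = q.
  factor-∣₂ : ∀ {i} → i ℕ.< 3 ℕ.* q → i ≢ q → + (9 ℕ.* q ∸ i) ∣₂ + (3 ℕ.* q ∸ i)
  factor-∣₂ {i} i<3q i≢q = conclude (decompose x≢0)
    where
    x = 9 ℕ.* q ∸ i
    y = 3 ℕ.* q ∸ i
    x≡ : x ≡ 6 ℕ.* q ℕ.+ y
    x≡ = trans (cong (_∸ i) (lem q)) (ℕ.+-∸-assoc (6 ℕ.* q) (ℕ.<⇒≤ i<3q))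
      where
      lem : ∀ q → 9 ℕ.* q ≡ 6 ℕ.* q ℕ.+ 3 ℕ.* q
      lem = ℕRing.solve-∀
    y>0 : 0 ℕ.< y
    y>0 = ℕ.m<n⇒0<n∸m i<3q
    6q<x : 6 ℕ.* q ℕ.< x
    6q<x = ℕ.≤-trans (ℕ.≤-trans (ℕ.≤-reflexive (ℕ.+-comm 1 (6 ℕ.* q))) (ℕ.+-monoʳ-≤ (6 ℕ.* q) y>0)) (ℕ.≤-reflexive (sym x≡))
    x≢8q : x ≢ 8 ℕ.* q
    x≢8q eq = i≢q (ℕ.+-cancelˡ-≡ (8 ℕ.* q) i q (trans (cong (ℕ._+ i) (sym eq)) (trans (ℕ.m∸n+n≡m i≤9q) (lem q))))
      where
      i≤9q : i ℕ.≤ 9 ℕ.* q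
      i≤9q = ℕ.≤-trans (ℕ.<⇒≤ i<3q) (ℕ.*-monoˡ-≤ q {3} {9} (s≤s (s≤s (s≤s z≤n))))
      lem : ∀ q → 9 ℕ.* q ≡ 8 ℕ.* q ℕ.+ q
      lem = ℕRing.solve-∀
    x≢0 : + x ≢ 0ℤ
    x≢0 eq = ℕ.<⇒≢ (ℕ.≤-trans (s≤s z≤n) 6q<x) (sym (ℤ.+-injective eq))
    4q≡ : 2^ (2 ℕ.+ u) ≡ + (4 ℕ.* q)
    4q≡ = trans (2^-+ 2 u) (trans (cong (+ 4 *_) (sym q≡)) (sym (ℤ.pos-* 4 q)))
    2q∣6q : 2^ (1 ℕ.+ u) ∣ + (6 ℕ.* q)
    2q∣6q = divides (+ 3) (trans (ℤ.pos-* 6 q) (trans (cong (+ 6 *_) q≡) (trans (ℤ.*-assoc (+ 3) (+ 2) (2^ u)) (cong (+ 3 *_) (sym (2^-suc u))))))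
    conclude : Decomposed (+ x) → + x ∣₂ + y
    conclude (decomposed e o odd-o eq) with ℕ.<-≤-connex (1 ℕ.+ u) e
    ... | inj₁ e≥2+u = contradiction (∣⇒∣ᵤ {+ (4 ℕ.* q)} {+ x} (subst (_∣ + x) 4q≡ (∣-trans (2^-mono e≥2+u) (divides o eq))))
                         (4q∤ 6q<x (ℕ.m∸n≤m (9 ℕ.* q) i) x≢8q)
    ... | inj₂ e≤1+u = local odd-o (subst (_∣ o * + y) (sym eq) (*-monoʳ-∣ o
            (∣m+n∣m⇒∣n (subst (2^ e ∣_) (cong +_ x≡) (divides o eq)) (∣-trans (2^-mono e≤1+u) 2q∣6q))))

  C-low : ∀ k → k ℕ.≤ q → + ((9 ℕ.* q) C k) ∣₂ 1ℤ * + ((3 ℕ.* q) C k)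
  C-low zero    _   = ∣⇒∣₂ (divides 1ℤ (cong (λ x → 1ℤ * + x) (trans (nC0≡1 (3 ℕ.* q)) (sym (nC0≡1 (9 ℕ.* q))))))
  C-low (suc k) k<q = C-∣₂-step {c = 1ℤ} {d = 1ℤ} k<9q k<3q (subst (+ (9 ℕ.* q ∸ k) ∣₂_) (sym (ℤ.*-identityˡ _)) (factor-∣₂ k<3q (ℕ.<⇒≢ k<q))) (C-low k (ℕ.<⇒≤ k<q))
    where
    k<3q = ℕ.<-≤-trans k<q (ℕ.m≤m+n q (2 ℕ.* q))
    k<9q = ℕ.<-≤-trans k<q (ℕ.m≤m+n q (8 ℕ.* q))

  -- The numerators 8 q and 2 q at position q cost one factor 4; the later positions cost nothing.
  C-high : ∀ j → q ℕ.+ j ℕ.< 3 ℕ.* q → + ((9 ℕ.* q) C suc (q ℕ.+ j)) ∣₂ + 4 * + ((3 ℕ.* q) C suc (q ℕ.+ j))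
  C-high zero lt = C-∣₂-step {c = 1ℤ} {d = + 4} (ℕ.<-≤-trans lt 3q≤9q) lt
    (subst₂ (λ a b → + a ∣₂ + 4 * + b) (sym (trans (cong (9 ℕ.* q ∸_) (ℕ.+-identityʳ q)) (ℕ.m+n∸m≡n q (8 ℕ.* q))))
      (sym (trans (cong (3 ℕ.* q ∸_) (ℕ.+-identityʳ q)) (ℕ.m+n∸m≡n q (2 ℕ.* q)))) (∣⇒∣₂ (divides 1ℤ (trans (sym (ℤ.pos-* 4 (2 ℕ.* q))) (trans (cong +_ (lem q)) (sym (ℤ.*-identityˡ _)))))))
    (C-low (q ℕ.+ 0) (ℕ.≤-reflexive (ℕ.+-identityʳ q)))
    where
    3q≤9q = ℕ.*-monoˡ-≤ q {3} {9} (s≤s (s≤s (s≤s z≤n)))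
    lem : ∀ q → 4 ℕ.* (2 ℕ.* q) ≡ 8 ℕ.* q
    lem = ℕRing.solve-∀
  C-high (suc j) lt = C-∣₂-step {c = + 4} {d = 1ℤ} (ℕ.<-≤-trans lt 3q≤9q) lt
    (subst (+ (9 ℕ.* q ∸ (q ℕ.+ suc j)) ∣₂_) (sym (ℤ.*-identityˡ _)) (factor-∣₂ lt (λ eq → ℕ.m+1+n≢m q eq)))
    (subst (λ z → + ((9 ℕ.* q) C z) ∣₂ + 4 * + ((3 ℕ.* q) C z)) (sym (ℕ.+-suc q j)) (C-high j (ℕ.<-trans (ℕ.+-monoʳ-< q (ℕ.n<1+n j)) lt)))
    where
    3q≤9q = ℕ.*-monoˡ-≤ q {3} {9} (s≤s (s≤s (s≤s z≤n)))

  -- Up to the lower index q nothing is lost, and beyond it k ≥ q ≥ 2, so that 4 divides `2^ k`.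
  C-9q-∣₂ : 2 ℕ.≤ q → ∀ k → suc k ℕ.≤ 3 ℕ.* q → + ((9 ℕ.* q) C suc k) ∣₂ 2^ k * + ((3 ℕ.* q) C suc k)
  C-9q-∣₂ 2≤q k k<3q with ℕ.≤-<-connex (suc k) q
  ... | inj₁ k<q = ∣₂-trans (C-low (suc k) k<q) (∣⇒∣₂ (*-monoˡ-∣ (+ ((3 ℕ.* q) C suc k)) (2^-mono {0} {k} z≤n)))
  ... | inj₂ (s≤s q≤k) with ℕ.m≤n⇒∃[o]m+o≡n q≤k
  ...   | j , refl = ∣₂-trans (C-high j k<3q) (∣⇒∣₂ (*-monoˡ-∣ (+ ((3 ℕ.* q) C suc k)) (2^-mono {2} {k} (ℕ.≤-trans 2≤q q≤k))))

-- Each (2 n)! is `2 ^ n` times n! times an odd number, and the powers of 2 of the three factorials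
-- cancel.
C-double : ∀ k l → + ((k ℕ.* 2 ℕ.+ l ℕ.* 2) C (k ℕ.* 2)) ∣₂ + ((k ℕ.+ l) C k)
C-double k l with factorial-2* k | factorial-2* l | factorial-2* (k ℕ.+ l)
... | oₖ , oddₖ , eqₖ | oₗ , oddₗ , eqₗ | o , odd-o , eq =
  local odd-o (divides (+ (oₖ ℕ.* oₗ)) (trans (sym (ℤ.pos-* o y)) (trans (cong +_ key) (ℤ.pos-* (oₖ ℕ.* oₗ) x))))
  where
  open ≡-Reasoning
  x = (k ℕ.* 2 ℕ.+ l ℕ.* 2) C (k ℕ.* 2)
  y = (k ℕ.+ l) C k
  instance
    _ = ℕ.m^n≢0 2 k
    _ = ℕ.m^n≢0 2 l
    _ = k ℕ.!≢0
    _ = l ℕ.!≢0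
    _ = ℕ.m*n≢0 (2 ℕ.^ k) (2 ℕ.^ l)
    _ = ℕ.m*n≢0 (k !) (l !)
    _ = ℕ.m*n≢0 (2 ℕ.^ k ℕ.* 2 ℕ.^ l) (k ! ℕ.* l !)
  lem₁ : ∀ o y e f a b → o ℕ.* y ℕ.* (e ℕ.* f ℕ.* (a ℕ.* b)) ≡ e ℕ.* f ℕ.* (y ℕ.* (a ℕ.* b) ℕ.* o)
  lem₁ = ℕRing.solve-∀
  lem₂ : ∀ x e f a b c d → x ℕ.* (e ℕ.* (a ℕ.* c) ℕ.* (f ℕ.* (b ℕ.* d))) ≡ c ℕ.* d ℕ.* x ℕ.* (e ℕ.* f ℕ.* (a ℕ.* b))
  lem₂ = ℕRing.solve-∀
  lem₃ : ∀ k l → (k ℕ.+ l) ℕ.* 2 ≡ k ℕ.* 2 ℕ.+ l ℕ.* 2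
  lem₃ = ℕRing.solve-∀
  key : o ℕ.* y ≡ oₖ ℕ.* oₗ ℕ.* x
  key = ℕ.*-cancelʳ-≡ _ _ (2 ℕ.^ k ℕ.* 2 ℕ.^ l ℕ.* (k ! ℕ.* l !)) (begin
    o ℕ.* y ℕ.* (2 ℕ.^ k ℕ.* 2 ℕ.^ l ℕ.* (k ! ℕ.* l !))              ≡⟨ lem₁ o y (2 ℕ.^ k) (2 ℕ.^ l) (k !) (l !) ⟩
    2 ℕ.^ k ℕ.* 2 ℕ.^ l ℕ.* (y ℕ.* (k ! ℕ.* l !) ℕ.* o)              ≡⟨ cong₂ (λ a b → a ℕ.* (b ℕ.* o)) (sym (ℕ.^-distribˡ-+-* 2 k l)) (C-factorial k l) ⟩
    2 ℕ.^ (k ℕ.+ l) ℕ.* ((k ℕ.+ l) ! ℕ.* o)                          ≡⟨ eq ⟨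
    ((k ℕ.+ l) ℕ.* 2) !                                              ≡⟨ cong _! (lem₃ k l) ⟩
    (k ℕ.* 2 ℕ.+ l ℕ.* 2) !                                          ≡⟨ C-factorial (k ℕ.* 2) (l ℕ.* 2) ⟨
    x ℕ.* ((k ℕ.* 2) ! ℕ.* (l ℕ.* 2) !)                              ≡⟨ cong₂ (λ a b → x ℕ.* (a ℕ.* b)) eqₖ eqₗ ⟩
    x ℕ.* (2 ℕ.^ k ℕ.* (k ! ℕ.* oₖ) ℕ.* (2 ℕ.^ l ℕ.* (l ! ℕ.* oₗ)))  ≡⟨ lem₂ x (2 ℕ.^ k) (2 ℕ.^ l) (k !) (l !) oₖ oₗ ⟩
    oₖ ℕ.* oₗ ℕ.* x ℕ.* (2 ℕ.^ k ℕ.* 2 ℕ.^ l ℕ.* (k ! ℕ.* l !))      ∎)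

-- From (2 k)! = 2^k k! o with o odd one gets k! C (2 k) k = 2^k o.
C-central : ∀ k → + ((k ℕ.+ k) C k) ∣₂ 2^ k
C-central k with factorial-2* k
... | o , odd-o , eq = local odd-o (divides (+ (k !)) (trans (sym (ℤ.pos-* o (2 ℕ.^ k))) (trans (cong +_ key) (ℤ.pos-* (k !) x))))
  where
  open ≡-Reasoning
  x = (k ℕ.+ k) C k
  lem₁ : ∀ o e f → o ℕ.* e ℕ.* f ≡ e ℕ.* (f ℕ.* o)
  lem₁ = ℕRing.solve-∀
  lem₂ : ∀ x f → x ℕ.* (f ℕ.* f) ≡ f ℕ.* x ℕ.* f
  lem₂ = ℕRing.solve-∀
  lem₃ : ∀ k → k ℕ.* 2 ≡ k ℕ.+ k
  lem₃ = ℕRing.solve-∀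
  key : o ℕ.* 2 ℕ.^ k ≡ k ! ℕ.* x
  key = ℕ.*-cancelʳ-≡ _ _ (k !) {{k ℕ.!≢0}} (begin
    o ℕ.* 2 ℕ.^ k ℕ.* k !     ≡⟨ lem₁ o (2 ℕ.^ k) (k !) ⟩
    2 ℕ.^ k ℕ.* (k ! ℕ.* o)   ≡⟨ eq ⟨
    (k ℕ.* 2) !               ≡⟨ cong _! (lem₃ k) ⟩
    (k ℕ.+ k) !               ≡⟨ C-factorial k k ⟨
    x ℕ.* (k ! ℕ.* k !)       ≡⟨ lem₂ x (k !) ⟩
    k ! ℕ.* x ℕ.* k !         ∎)

-- Both sides count the ways of splitting k + i + (k + i′) elements into
-- parts of sizes k, k, i and i′.
C-multinomial : ∀ k i i′ → ((k ℕ.+ i ℕ.+ (k ℕ.+ i′)) C (k ℕ.+ i)) ℕ.* (((k ℕ.+ i) C k) ℕ.* ((k ℕ.+ i′) C k)) ≡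
  ((k ℕ.+ k ℕ.+ (i ℕ.+ i′)) C (k ℕ.+ k)) ℕ.* (((k ℕ.+ k) C k) ℕ.* ((i ℕ.+ i′) C i))
C-multinomial k i i′ = ℕ.*-cancelʳ-≡ _ _ (k ! ℕ.* k ! ℕ.* (i ! ℕ.* i′ !)) (begin
  a ℕ.* (b ℕ.* c) ℕ.* (k ! ℕ.* k ! ℕ.* (i ! ℕ.* i′ !))        ≡⟨ lem₁ a b c (k !) (i !) (i′ !) ⟩
  a ℕ.* (b ℕ.* (k ! ℕ.* i !) ℕ.* (c ℕ.* (k ! ℕ.* i′ !)))      ≡⟨ cong₂ (λ x y → a ℕ.* (x ℕ.* y)) (C-factorial k i) (C-factorial k i′) ⟩
  a ℕ.* ((k ℕ.+ i) ! ℕ.* (k ℕ.+ i′) !)                        ≡⟨ C-factorial (k ℕ.+ i) (k ℕ.+ i′) ⟩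
  (k ℕ.+ i ℕ.+ (k ℕ.+ i′)) !                                  ≡⟨ cong _! (lem₂ k i i′) ⟩
  (k ℕ.+ k ℕ.+ (i ℕ.+ i′)) !                                  ≡⟨ C-factorial (k ℕ.+ k) (i ℕ.+ i′) ⟨
  d ℕ.* ((k ℕ.+ k) ! ℕ.* (i ℕ.+ i′) !)                        ≡⟨ cong₂ (λ x y → d ℕ.* (x ℕ.* y)) (C-factorial k k) (C-factorial i i′) ⟨
  d ℕ.* (e ℕ.* (k ! ℕ.* k !) ℕ.* (f ℕ.* (i ! ℕ.* i′ !)))      ≡⟨ lem₃ d e f (k !) (i !) (i′ !) ⟩
  d ℕ.* (e ℕ.* f) ℕ.* (k ! ℕ.* k ! ℕ.* (i ! ℕ.* i′ !))        ∎)
  where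
  open ≡-Reasoning
  a = (k ℕ.+ i ℕ.+ (k ℕ.+ i′)) C (k ℕ.+ i)
  b = (k ℕ.+ i) C k
  c = (k ℕ.+ i′) C k
  d = (k ℕ.+ k ℕ.+ (i ℕ.+ i′)) C (k ℕ.+ k)
  e = (k ℕ.+ k) C k
  f = (i ℕ.+ i′) C i
  instance
    _ = k ℕ.!≢0
    _ = i ℕ.!≢0
    _ = i′ ℕ.!≢0
    _ = ℕ.m*n≢0 (k !) (k !)
    _ = ℕ.m*n≢0 (i !) (i′ !)
    _ = ℕ.m*n≢0 (k ! ℕ.* k !) (i ! ℕ.* i′ !)
  lem₁ : ∀ a b c k i j → a ℕ.* (b ℕ.* c) ℕ.* (k ℕ.* k ℕ.* (i ℕ.* j)) ≡ a ℕ.* (b ℕ.* (k ℕ.* i) ℕ.* (c ℕ.* (k ℕ.* j)))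
  lem₁ = ℕRing.solve-∀
  lem₂ : ∀ k i j → k ℕ.+ i ℕ.+ (k ℕ.+ j) ≡ k ℕ.+ k ℕ.+ (i ℕ.+ j)
  lem₂ = ℕRing.solve-∀
  lem₃ : ∀ a b c k i j → a ℕ.* (b ℕ.* (k ℕ.* k) ℕ.* (c ℕ.* (i ℕ.* j))) ≡ a ℕ.* (b ℕ.* c) ℕ.* (k ℕ.* k ℕ.* (i ℕ.* j))
  lem₃ = ℕRing.solve-∀

4^≡ : ∀ k → ((+ 4) ℤ.^ k) ≡ 2^ k * 2^ k
4^≡ zero    = refl
4^≡ (suc k) = trans (cong (+ 4 *_) (4^≡ k)) (trans (lem (2^ k)) (cong₂ _*_ (sym (2^-suc k)) (sym (2^-suc k))))
  where
  lem : ∀ x → + 4 * (x * x) ≡ + 2 * x * (+ 2 * x)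
  lem = solve-∀

∣₂-sum : ∀ {a} n (f : Fin n → ℤ) → (∀ i → a ∣₂ f i) → a ∣₂ sum f
∣₂-sum zero    f p = ∣⇒∣₂ (divides 0ℤ refl)
∣₂-sum (suc n) f p = ∣₂-+ (p zero) (∣₂-sum n (f ∘ suc) (p ∘ suc))

sgn-odd : ∀ j → Odd (sgn j)
sgn-odd zero    = odd-1
sgn-odd (suc j) = odd-* {x = -1ℤ} {y = sgn j} (-1ℤ , refl) (sgn-odd j)

module _ (u q : ℕ) (q≡ : + q ≡ 2^ u) (2≤q : 2 ℕ.≤ q) where
  private
    h = 3 ℕ.* q

  -- Write 4^k = 2 · 2^(k-1) · 2^k. The factor 2^(k-1) pays for replacing C (9 q) k by C (3 q) k,
  -- the factor 2^k pays for the central coefficient, and a 2 is left over. This spare 2 makes all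
  -- terms with k ≥ 1 negligible modulo 2.
  coefficient-∣₂ : ∀ k′ l → let k = suc k′ in k ℕ.≤ h → k ℕ.+ l ≡ 9 ℕ.* q →
    + 2 * (+ ((k ℕ.* 2 ℕ.+ l ℕ.* 2) C (k ℕ.* 2)) * + ((k ℕ.+ k) C k)) ∣₂ + (h C k) * ((+ 4) ℤ.^ k)
  coefficient-∣₂ k′ l k≤h eq = subst (+ 2 * (+ ((k ℕ.* 2 ℕ.+ l ℕ.* 2) C (k ℕ.* 2)) * + ((k ℕ.+ k) C k)) ∣₂_) rearrange (∣₂-* (∣₂-refl (+ 2)) (∣₂-*
      (∣₂-trans (C-double k l) (subst (λ n → + (n C k) ∣₂ 2^ k′ * + (h C k)) (sym eq) (C-9q-∣₂ u q q≡ 2≤q k′ k≤h))) (C-central k)))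
    where
    open ≡-Reasoning
    k = suc k′
    lem : ∀ x c y → + 2 * (x * c * y) ≡ c * (+ 2 * x * y)
    lem = solve-∀
    rearrange : + 2 * (2^ k′ * + (h C k) * 2^ k) ≡ + (h C k) * ((+ 4) ℤ.^ k)
    rearrange = trans (lem (2^ k′) (+ (h C k)) (2^ k)) (cong (+ (h C k) *_) (trans (cong (_* 2^ k) (sym (2^-suc k′))) (sym (4^≡ k))))

  6h∸2k : ∀ {k l} → k ℕ.+ l ≡ 9 ℕ.* q → 6 ℕ.* h ∸ 2 ℕ.* k ≡ l ℕ.* 2
  6h∸2k {k} {l} eq = trans (cong (_∸ 2 ℕ.* k) (trans (lem q) (trans (cong (ℕ._* 2) (sym eq)) (lem′ k l)))) (ℕ.m+n∸m≡n (2 ℕ.* k) (l ℕ.* 2))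
    where
    lem : ∀ q → 6 ℕ.* (3 ℕ.* q) ≡ 9 ℕ.* q ℕ.* 2
    lem = ℕRing.solve-∀
    lem′ : ∀ k l → (k ℕ.+ l) ℕ.* 2 ≡ 2 ℕ.* k ℕ.+ l ℕ.* 2
    lem′ = ℕRing.solve-∀

  6h≡ : ∀ {k l} → k ℕ.+ l ≡ 9 ℕ.* q → 6 ℕ.* h ≡ k ℕ.+ k ℕ.+ l ℕ.* 2
  6h≡ {k} {l} eq = trans (lem q) (trans (cong (ℕ._* 2) (sym eq)) (lem′ k l))
    where
    lem : ∀ q → 6 ℕ.* (3 ℕ.* q) ≡ 9 ℕ.* q ℕ.* 2
    lem = ℕRing.solve-∀
    lem′ : ∀ k l → (k ℕ.+ l) ℕ.* 2 ≡ k ℕ.+ k ℕ.+ l ℕ.* 2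
    lem′ = ℕRing.solve-∀

  -- By `C-multinomial`, C (6 h) (k + i) divides the product of C (6 h) (2 k), C (2 k) k and C (2 l)
  -- i; the first two are covered by `coefficient-∣₂`, the third is present in the term.
  inner-term-∣₂ : ∀ k′ l i i′ → let k = suc k′ in k ℕ.≤ h → k ℕ.+ l ≡ 9 ℕ.* q → i ℕ.+ i′ ≡ l ℕ.* 2 →
    + 2 * + ((6 ℕ.* h) C (k ℕ.+ i)) ∣₂ + (h C k) * (((+ 4) ℤ.^ k) * (sgn i * + ((i ℕ.+ i′) C i)))
  inner-term-∣₂ k′ l i i′ k≤h eq eq′ = ∣₂-trans
    (∣⇒∣₂ (divides (+ (b ℕ.* c)) multiple))
    (subst (+ 2 * (+ d * + e) * + f ∣₂_) (target (+ (h C k)) ((+ 4) ℤ.^ k) (sgn i) (+ f))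
      (∣₂-*ʳ (sgn i) (∣₂-* (coefficient-∣₂ k′ l k≤h eq) (∣₂-refl (+ f)))))
    where
    open ≡-Reasoning
    k = suc k′
    a = (6 ℕ.* h) C (k ℕ.+ i)
    b = (k ℕ.+ i) C k
    c = (k ℕ.+ i′) C k
    d = (k ℕ.* 2 ℕ.+ l ℕ.* 2) C (k ℕ.* 2)
    e = (k ℕ.+ k) C k
    f = (i ℕ.+ i′) C i
    target : ∀ h p s f → h * p * f * s ≡ h * (p * (s * f))
    target = solve-∀
    lem : ∀ k i i′ → k ℕ.+ k ℕ.+ (i ℕ.+ i′) ≡ k ℕ.+ i ℕ.+ (k ℕ.+ i′)
    lem = ℕRing.solve-∀
    lem₂ : ∀ k → k ℕ.+ k ≡ k ℕ.* 2
    lem₂ = ℕRing.solve-∀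
    natural : a ℕ.* (b ℕ.* c) ≡ d ℕ.* (e ℕ.* f)
    natural = begin
      a ℕ.* (b ℕ.* c)
        ≡⟨ cong (λ n → (n C (k ℕ.+ i)) ℕ.* (b ℕ.* c)) (trans (6h≡ {k} {l} eq) (trans (cong (k ℕ.+ k ℕ.+_) (sym eq′)) (lem k i i′))) ⟩
      ((k ℕ.+ i ℕ.+ (k ℕ.+ i′)) C (k ℕ.+ i)) ℕ.* (b ℕ.* c)
        ≡⟨ C-multinomial k i i′ ⟩
      ((k ℕ.+ k ℕ.+ (i ℕ.+ i′)) C (k ℕ.+ k)) ℕ.* (e ℕ.* f)
        ≡⟨ cong₂ (λ x y → ((x ℕ.+ y) C x) ℕ.* (e ℕ.* f)) (lem₂ k) eq′ ⟩
      d ℕ.* (e ℕ.* f) ∎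
    swap : ∀ d e f → + 2 * (d * e) * f ≡ + 2 * (d * (e * f))
    swap = solve-∀
    swap′ : ∀ a z → + 2 * (a * z) ≡ z * (+ 2 * a)
    swap′ = solve-∀
    multiple : + 2 * (+ d * + e) * + f ≡ + (b ℕ.* c) * (+ 2 * + a)
    multiple = begin
      + 2 * (+ d * + e) * + f       ≡⟨ swap (+ d) (+ e) (+ f) ⟩
      + 2 * (+ d * (+ e * + f))     ≡⟨ cong (λ z → + 2 * (+ d * z)) (ℤ.pos-* e f) ⟨
      + 2 * (+ d * + (e ℕ.* f))     ≡⟨ cong (+ 2 *_) (ℤ.pos-* d (e ℕ.* f)) ⟨
      + 2 * + (d ℕ.* (e ℕ.* f))     ≡⟨ cong (λ z → + 2 * + z) natural ⟨
      + 2 * + (a ℕ.* (b ℕ.* c))     ≡⟨ cong (+ 2 *_) (ℤ.pos-* a (b ℕ.* c)) ⟩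
      + 2 * (+ a * + (b ℕ.* c))     ≡⟨ swap′ (+ a) (+ (b ℕ.* c)) ⟩
      + (b ℕ.* c) * (+ 2 * + a)     ∎

  zero-∣₂ : ∀ {a b} → b ≡ 0ℤ → a ∣₂ b
  zero-∣₂ refl = ∣⇒∣₂ (divides 0ℤ refl)

  term-∣₂ : ∀ k′ j → let k = suc k′ in k ℕ.≤ h → + 2 * + ((6 ℕ.* h) C j) ∣₂ + (h C k) * maskTerm h k j
  term-∣₂ k′ j k≤h with ℕ.<-≤-connex j (suc k′)
  ... | inj₁ j<k = zero-∣₂ (trans (cong (+ (h C suc k′) *_) (4𝕩^-⊛-< (suc k′) (1-x ^ᴾ (6 ℕ.* h ∸ 2 ℕ.* suc k′)) j<k)) (ℤ.*-zeroʳ (+ (h C suc k′))))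
  ... | inj₂ k≤j with ℕ.m≤n⇒∃[o]m+o≡n k≤j | ℕ.m≤n⇒∃[o]m+o≡n {suc k′} {9 ℕ.* q} (ℕ.≤-trans k≤h (ℕ.*-monoˡ-≤ q {3} {9} (s≤s (s≤s (s≤s z≤n)))))
  ...   | i , refl | l , eq = subst (λ z → + 2 * + ((6 ℕ.* h) C (suc k′ ℕ.+ i)) ∣₂ + (h C suc k′) * z) (sym value) by-size
    where
    k = suc k′
    value : maskTerm h k (k ℕ.+ i) ≡ ((+ 4) ℤ.^ k) * (sgn i * + ((l ℕ.* 2) C i))
    value = trans (4𝕩^-⊛ k (1-x ^ᴾ (6 ℕ.* h ∸ 2 ℕ.* k)) i) (cong (((+ 4) ℤ.^ k) *_)
      (trans (1-x^-coeff (6 ℕ.* h ∸ 2 ℕ.* k) i) (cong (λ n → sgn i * + (n C i)) (6h∸2k {k} {l} eq))))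
    zeros : ∀ a b c → a * (b * (c * 0ℤ)) ≡ 0ℤ
    zeros = solve-∀
    by-size : + 2 * + ((6 ℕ.* h) C (k ℕ.+ i)) ∣₂ + (h C k) * (((+ 4) ℤ.^ k) * (sgn i * + ((l ℕ.* 2) C i)))
    by-size with ℕ.<-≤-connex (l ℕ.* 2) i
    ... | inj₁ 2l<i = zero-∣₂ (trans (cong (λ z → + (h C k) * (((+ 4) ℤ.^ k) * (sgn i * + z))) (k>n⇒nCk≡0 2l<i)) (zeros (+ (h C k)) ((+ 4) ℤ.^ k) (sgn i)))
    ... | inj₂ i≤2l with ℕ.m≤n⇒∃[o]m+o≡n i≤2l
    ...   | i′ , eq′ = subst (λ n → + 2 * + ((6 ℕ.* h) C (k ℕ.+ i)) ∣₂ + (h C k) * (((+ 4) ℤ.^ k) * (sgn i * + (n C i)))) eq′ (inner-term-∣₂ k′ l i i′ k≤h eq eq′)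

  -- The term k = 0 of the expansion is ± C (6 h) j, and the others add up to a 2-adic multiple of
  -- twice that number.
  mask-ratio : ∀ s j → ∃ λ e → Odd e × Ratio s (mask (2 ℕ.* h) j) (+ ((6 ℕ.* h) C j)) e
  mask-ratio s j = conclude tail-∣₂
    where
    open ≡-Reasoning
    B = + ((6 ℕ.* h) C j)
    tail = sum {h} (λ k → + (h C suc (toℕ k)) * maskTerm h (suc (toℕ k)) j)
    tail-∣₂ : + 2 * B ∣₂ tail
    tail-∣₂ = ∣₂-sum h _ (λ k → term-∣₂ (toℕ k) j (toℕ<n k))
    split : mask (2 ℕ.* h) j ≡ sgn j * B + tail
    split = trans (mask-expansion h j) (cong (_+ tail) (begin
      + (h C 0) * (one ⊛ 1-x ^ᴾ (6 ℕ.* h)) j   ≡⟨ cong₂ (λ x y → + x * y) (nC0≡1 h) (⊛-identityˡ (1-x ^ᴾ (6 ℕ.* h)) j) ⟩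
      1ℤ * (1-x ^ᴾ (6 ℕ.* h)) j                ≡⟨ ℤ.*-identityˡ _ ⟩
      (1-x ^ᴾ (6 ℕ.* h)) j                     ≡⟨ 1-x^-coeff (6 ℕ.* h) j ⟩
      sgn j * B                                ∎))
    conclude : + 2 * B ∣₂ tail → ∃ λ e → Odd e × Ratio s (mask (2 ℕ.* h) j) B e
    conclude (local {d} odd-d (divides p eq)) = (d * sgn j + p * + 2) * inv s d , odd-* {d * sgn j + p * + 2} odd-sum (inv-odd s odd-d) ,
      ratio-odd {w = d * sgn j + p * + 2} odd-d (begin
        d * mask (2 ℕ.* h) j            ≡⟨ cong (d *_) split ⟩
        d * (sgn j * B + tail)          ≡⟨ lem d (sgn j) B tail ⟩
        d * sgn j * B + d * tail        ≡⟨ cong (λ z → d * sgn j * B + z) eq ⟩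
        d * sgn j * B + p * (+ 2 * B)   ≡⟨ lem′ (d * sgn j) B p ⟩
        (d * sgn j + p * + 2) * B       ∎)
      where
      lem : ∀ d s b t → d * (s * b + t) ≡ d * s * b + d * t
      lem = solve-∀
      lem′ : ∀ d b p → d * b + p * (+ 2 * b) ≡ (d + p * + 2) * b
      lem′ = solve-∀
      lem″ : ∀ x p → (x + p * + 2) - x ≡ p * + 2
      lem″ = solve-∀
      odd-sum : Odd (d * sgn j + p * + 2)
      odd-sum = odd-mod (by (divides p (lem″ (d * sgn j) p))) (odd-* {d} odd-d (sgn-odd j))

mask-ratio-at : ∀ u q → + q ≡ 2^ u → 2 ℕ.≤ q → ∀ {m N} → 2 ℕ.* (3 ℕ.* q) ≡ m → 6 ℕ.* (3 ℕ.* q) ≡ N →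
  ∀ s j → ∃ λ e → Odd e × Ratio s (mask m j) (+ (N C j)) e
mask-ratio-at u q q≡ 2≤q refl refl = mask-ratio u q q≡ 2≤q

-- Periodicity modulo powers of two

modℕ-* : ∀ {M} a b c d → + a ≡ + b [mod M ] → + c ≡ + d [mod M ] → + (a ℕ.* c) ≡ + (b ℕ.* d) [mod M ]
modℕ-* {M} a b c d p q = subst₂ (_≡_[mod M ]) (sym (ℤ.pos-* a c)) (sym (ℤ.pos-* b d)) (mod-* p q)

-- The quotient of `oddBlocks (n + j)` by `oddBlocks n`. Its number of factors does not depend on n,
-- so congruences of n pass to it directly.
blockRange : ℕ → ℕ → ℕ
blockRange n zero    = 1
blockRange n (suc j) = blockRange n j ℕ.* oddBlock (n ℕ.+ j)

oddBlocks-+ : ∀ n j → oddBlocks (n ℕ.+ j) ≡ oddBlocks n ℕ.* blockRange n j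
oddBlocks-+ n zero    = trans (cong oddBlocks (ℕ.+-identityʳ n)) (sym (ℕ.*-identityʳ _))
oddBlocks-+ n (suc j) = trans (cong oddBlocks (ℕ.+-suc n j))
  (trans (cong (ℕ._* oddBlock (n ℕ.+ j)) (oddBlocks-+ n j)) (ℕ.*-assoc (oddBlocks n) (blockRange n j) (oddBlock (n ℕ.+ j))))

blockRange-odd : ∀ n j → Oddℕ (blockRange n j)
blockRange-odd n zero    = odd-1
blockRange-odd n (suc j) = oddℕ-* {blockRange n j} (blockRange-odd n j) (oddBlock-odd (n ℕ.+ j))

odd⇒nonZero : ∀ {n} → Oddℕ n → NonZero n
odd⇒nonZero {zero}  o = contradiction (divides 0ℤ refl) (odd⇒¬even o)
odd⇒nonZero {suc n} o = _

module _ {M : ℤ} where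
  linear-cong : ∀ a b {n n′} → + n ≡ + n′ [mod M ] → + (a ℕ.+ n ℕ.* b) ≡ + (a ℕ.+ n′ ℕ.* b) [mod M ]
  linear-cong a b {n} {n′} p = mod-+ (mod-refl (+ a)) (modℕ-* n n′ b b p (mod-refl (+ b)))

  oddBlock-cong : ∀ {n n′} → + n ≡ + n′ [mod M ] → + oddBlock n ≡ + oddBlock n′ [mod M ]
  oddBlock-cong {n} {n′} p = modℕ-* ((1 ℕ.+ n ℕ.* 4) ℕ.* (1 ℕ.+ n ℕ.* 2)) ((1 ℕ.+ n′ ℕ.* 4) ℕ.* (1 ℕ.+ n′ ℕ.* 2)) (3 ℕ.+ n ℕ.* 4) (3 ℕ.+ n′ ℕ.* 4)
    (modℕ-* (1 ℕ.+ n ℕ.* 4) (1 ℕ.+ n′ ℕ.* 4) (1 ℕ.+ n ℕ.* 2) (1 ℕ.+ n′ ℕ.* 2) (linear-cong 1 4 {n} {n′} p) (linear-cong 1 2 {n} {n′} p)) (linear-cong 3 4 {n} {n′} p)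

  oddTail-cong : ∀ c {n n′} → + n ≡ + n′ [mod M ] → + oddTail c n ≡ + oddTail c n′ [mod M ]
  oddTail-cong zero                   p = mod-refl 1ℤ
  oddTail-cong (suc zero)             {n} {n′} p = linear-cong 1 4 {n} {n′} p
  oddTail-cong (suc (suc zero))       {n} {n′} p =
    modℕ-* (1 ℕ.+ n ℕ.* 4) (1 ℕ.+ n′ ℕ.* 4) (1 ℕ.+ n ℕ.* 2) (1 ℕ.+ n′ ℕ.* 2) (linear-cong 1 4 {n} {n′} p) (linear-cong 1 2 {n} {n′} p)
  oddTail-cong (suc (suc (suc zero))) {n} {n′} p = oddBlock-cong {n} {n′} p

  blockRange-cong : ∀ j {n n′} → + n ≡ + n′ [mod M ] → + blockRange n j ≡ + blockRange n′ j [mod M ]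
  blockRange-cong zero    p = mod-refl 1ℤ
  blockRange-cong (suc j) {n} {n′} p = modℕ-* (blockRange n j) (blockRange n′ j) _ _ (blockRange-cong j {n} {n′} p)
    (oddBlock-cong {n ℕ.+ j} {n′ ℕ.+ j} (mod-+ p (mod-refl (+ j))))

-- Summing a function of period P over a multiple of P yields a function
-- whose increments over P are constant, hence one of period 2^s P modulo 2^s.
C-periodic : ∀ s k n → + ((n ℕ.+ 2 ℕ.^ (s ℕ.* k)) C k) ≡ + (n C k) [mod 2^ s ]
C-periodic s zero    n = mod-reflexive (cong +_ (trans (nC0≡1 (n ℕ.+ 2 ℕ.^ (s ℕ.* 0))) (sym (nC0≡1 n))))
C-periodic s (suc k) n = subst (λ e → + ((n ℕ.+ e) C suc k) ≡ + (n C suc k) [mod 2^ s ])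
  (sym (trans (cong (2 ℕ.^_) (ℕ.*-suc s k)) (ℕ.^-distribˡ-+-* 2 s (s ℕ.* k))))
  (mod-trans (increments (2 ℕ.^ s) n) (subst (+ (n C suc k) + 2^ s * δ ≡_[mod 2^ s ]) (ℤ.+-identityʳ _)
    (mod-+ {c = 2^ s * δ} {d = 0ℤ} (mod-refl (+ (n C suc k))) (by (divides δ (trans (ℤ.+-identityʳ _) (ℤ.*-comm (2^ s) δ)))))))
  where
  P = 2 ℕ.^ (s ℕ.* k)
  -- The constant increment is read off at n = 0, where the coefficient itself vanishes.
  δ = + (P C suc k)
  pascal : ∀ n → + (suc n C suc k) ≡ + (n C k) + + (n C suc k)
  pascal n = cong +_ (sym (nCk+nC[k+1]≡[n+1]C[k+1] n k))
  increment : ∀ n → + ((n ℕ.+ P) C suc k) ≡ + (n C suc k) + δ [mod 2^ s ]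
  increment zero    = mod-reflexive (sym (trans (cong (λ z → + z + δ) (k>n⇒nCk≡0 {0} {suc k} (s≤s z≤n))) (ℤ.+-identityˡ δ)))
  increment (suc n) = subst₂ (_≡_[mod 2^ s ]) (sym (pascal (n ℕ.+ P)))
    (trans (sym (ℤ.+-assoc (+ (n C k)) (+ (n C suc k)) δ)) (cong (_+ δ) (sym (pascal n))))
    (mod-+ (C-periodic s k n) (increment n))
  increments : ∀ i n → + ((n ℕ.+ i ℕ.* P) C suc k) ≡ + (n C suc k) + + i * δ [mod 2^ s ]
  increments zero    n = mod-reflexive (trans (cong (λ z → + (z C suc k)) (ℕ.+-identityʳ n)) (sym (ℤ.+-identityʳ _)))
  increments (suc i) n = subst₂ (_≡_[mod 2^ s ])
    (cong (λ z → + (z C suc k)) (ℕ.+-assoc n P (i ℕ.* P)))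
    (trans (ℤ.+-assoc (+ (n C suc k)) δ (+ i * δ)) (cong (λ z → + (n C suc k) + z) (sym (ℤ.suc-* (+ i) δ))))
    (mod-trans (increments i (n ℕ.+ P)) (mod-+ (increment n) (mod-refl (+ i * δ))))

C-periodic* : ∀ s k j n → + ((n ℕ.+ j ℕ.* 2 ℕ.^ (s ℕ.* k)) C k) ≡ + (n C k) [mod 2^ s ]
C-periodic* s k zero    n = mod-reflexive (cong (λ z → + (z C k)) (ℕ.+-identityʳ n))
C-periodic* s k (suc j) n = subst (λ z → + (z C k) ≡ + (n C k) [mod 2^ s ]) (ℕ.+-assoc n _ _)
  (mod-trans (C-periodic* s k j (n ℕ.+ 2 ℕ.^ (s ℕ.* k))) (C-periodic s k n))

C-periodic-≤ : ∀ s {k K} → k ℕ.≤ K → ∀ j n → + ((n ℕ.+ j ℕ.* 2 ℕ.^ (s ℕ.* K)) C k) ≡ + (n C k) [mod 2^ s ]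
C-periodic-≤ s {k} {K} k≤K j n = subst (λ z → + ((n ℕ.+ z) C k) ≡ + (n C k) [mod 2^ s ]) period
  (C-periodic* s k (j ℕ.* 2 ℕ.^ (s ℕ.* (K ∸ k))) n)
  where
  open ≡-Reasoning
  period : j ℕ.* 2 ℕ.^ (s ℕ.* (K ∸ k)) ℕ.* 2 ℕ.^ (s ℕ.* k) ≡ j ℕ.* 2 ℕ.^ (s ℕ.* K)
  period = begin
    j ℕ.* 2 ℕ.^ (s ℕ.* (K ∸ k)) ℕ.* 2 ℕ.^ (s ℕ.* k)    ≡⟨ ℕ.*-assoc j _ _ ⟩
    j ℕ.* (2 ℕ.^ (s ℕ.* (K ∸ k)) ℕ.* 2 ℕ.^ (s ℕ.* k))  ≡⟨ cong (j ℕ.*_) (ℕ.^-distribˡ-+-* 2 (s ℕ.* (K ∸ k)) (s ℕ.* k)) ⟨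
    j ℕ.* 2 ℕ.^ (s ℕ.* (K ∸ k) ℕ.+ s ℕ.* k)            ≡⟨ cong (λ e → j ℕ.* 2 ℕ.^ e) (ℕ.*-distribˡ-+ s (K ∸ k) k) ⟨
    j ℕ.* 2 ℕ.^ (s ℕ.* (K ∸ k ℕ.+ k))                  ≡⟨ cong (λ e → j ℕ.* 2 ℕ.^ (s ℕ.* e)) (ℕ.m∸n+n≡m k≤K) ⟩
    j ℕ.* 2 ℕ.^ (s ℕ.* K)                              ∎

odd-*-≡ : ∀ {o x} → Odd o → o * x ≡ x [mod + 2 ]
odd-*-≡ {o} {x} oo = subst (o * x ≡_[mod + 2 ]) (ℤ.*-identityˡ x) (mod-* (odd⇒≡1 oo) (mod-refl x))

-- The weights of the recurrence

-- The exponent is m = 4 (p + 1), where p + 1 = 3 · 2^(r - 2).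
record Exponent : Set where
  field
    p u H G μ m : ℕ
    H≡3a      : H ≡ 3 ℕ.* suc p
    H≡suc-G   : H ≡ suc G
    μ≡        : μ ≡ 3 ℕ.+ p ℕ.* 4
    m≡suc-μ   : m ≡ suc μ
    3q≡2a     : 3 ℕ.* 2 ℕ.^ u ≡ 2 ℕ.* suc p
    2≤q       : 2 ℕ.≤ 2 ℕ.^ u
    η         : ℕ
    η-odd     : Oddℕ η
    H!-twos   : H ! ℕ.* 4 ≡ 2 ℕ.^ H ℕ.* η
    C-odd₀    : Oddℕ ((p ℕ.+ H) C H)
    C-odd₁    : Oddℕ ((suc p ℕ.+ G) C G)

-- A 2-adic multiple of 0 is 0. Thus the mask vanishes wherever C (4 H) does, and its degree need
-- not be computed.
ratio-of-0 : ∀ {s a b w} → b ≡ 0ℤ → Ratio s a b w → a ≡ 0ℤ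
ratio-of-0 {a = a} {b} b≡0 r = conclude (ratio-∣₂ r)
  where
  conclude : b ∣₂ a → a ≡ 0ℤ
  conclude (local {d} odd-d p) with ℤ.i*j≡0⇒i≡0∨j≡0 d (0∣⇒≡0 (subst (_∣ d * a) b≡0 p))
  ... | inj₂ a≡0 = a≡0
  ... | inj₁ d≡0 = contradiction (subst (+ 2 ∣_) (sym d≡0) (divides 0ℤ refl)) (odd⇒¬even odd-d)

module Weights (𝓔 : Exponent) (s : ℕ) where
  open Exponent 𝓔
  multichoose : ℕ → ℕ
  multichoose n = (n ℕ.+ μ) C μ

  -- `bound c` is the largest k with 4 k + c ≤ 4 H. `offset c` is the quotient by 4 of c + μ, where
  -- μ = 4 p + 3.
  bound offset : Fin 4 → ℕ
  bound zero    = H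
  bound (suc _) = G
  offset zero    = p
  offset (suc _) = suc p

  -- The last base-4 digits of 4 H - c and of c + μ, that is, of -c and c - 1 modulo 4.
  co pre : Fin 4 → Fin 4
  co zero                    = zero
  co (suc zero)              = suc (suc (suc zero))
  co (suc (suc zero))        = suc (suc zero)
  co (suc (suc (suc zero)))  = suc zero
  pre zero                   = suc (suc (suc zero))
  pre (suc zero)             = zero
  pre (suc (suc zero))       = suc zero
  pre (suc (suc (suc zero))) = suc (suc zero)

  bound≤H : ∀ c → bound c ℕ.≤ H
  bound≤H zero    = ℕ.≤-refl
  bound≤H (suc _) = ℕ.≤-trans (ℕ.n≤1+n _) (ℕ.≤-reflexive (sym H≡suc-G))

  complement : ∀ c {k K} → k ℕ.+ K ≡ bound c → (k ℕ.* 4 ℕ.+ toℕ c) ℕ.+ (K ℕ.* 4 ℕ.+ toℕ (co c)) ≡ H ℕ.* 4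
  complement zero {k} {K} eq = trans (lem k K) (cong (ℕ._* 4) eq)
    where
    lem : ∀ k K → (k ℕ.* 4 ℕ.+ 0) ℕ.+ (K ℕ.* 4 ℕ.+ 0) ≡ (k ℕ.+ K) ℕ.* 4
    lem = ℕRing.solve-∀
  complement (suc c) {k} {K} eq = trans (by-digit c) (cong (ℕ._* 4) (trans (cong suc eq) (sym H≡suc-G)))
    where
    lem₁ : ∀ k K → (k ℕ.* 4 ℕ.+ 1) ℕ.+ (K ℕ.* 4 ℕ.+ 3) ≡ suc (k ℕ.+ K) ℕ.* 4
    lem₁ = ℕRing.solve-∀
    lem₂ : ∀ k K → (k ℕ.* 4 ℕ.+ 2) ℕ.+ (K ℕ.* 4 ℕ.+ 2) ≡ suc (k ℕ.+ K) ℕ.* 4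
    lem₂ = ℕRing.solve-∀
    lem₃ : ∀ k K → (k ℕ.* 4 ℕ.+ 3) ℕ.+ (K ℕ.* 4 ℕ.+ 1) ≡ suc (k ℕ.+ K) ℕ.* 4
    lem₃ = ℕRing.solve-∀
    by-digit : ∀ c → (k ℕ.* 4 ℕ.+ toℕ (suc c)) ℕ.+ (K ℕ.* 4 ℕ.+ toℕ (co (suc c))) ≡ suc (k ℕ.+ K) ℕ.* 4
    by-digit zero             = lem₁ k K
    by-digit (suc zero)       = lem₂ k K
    by-digit (suc (suc zero)) = lem₃ k K

  predecessor : ∀ c n → (n ℕ.* 4 ℕ.+ toℕ c) ℕ.+ μ ≡ (n ℕ.+ offset c) ℕ.* 4 ℕ.+ toℕ (pre c)
  predecessor zero                   n = trans (cong (λ z → n ℕ.* 4 ℕ.+ 0 ℕ.+ z) μ≡) (lem n p)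
    where
    lem : ∀ n p → (n ℕ.* 4 ℕ.+ 0) ℕ.+ (3 ℕ.+ p ℕ.* 4) ≡ (n ℕ.+ p) ℕ.* 4 ℕ.+ 3
    lem = ℕRing.solve-∀
  predecessor (suc zero)             n = trans (cong (λ z → n ℕ.* 4 ℕ.+ 1 ℕ.+ z) μ≡) (lem n p)
    where
    lem : ∀ n p → (n ℕ.* 4 ℕ.+ 1) ℕ.+ (3 ℕ.+ p ℕ.* 4) ≡ (n ℕ.+ suc p) ℕ.* 4 ℕ.+ 0
    lem = ℕRing.solve-∀
  predecessor (suc (suc zero))       n = trans (cong (λ z → n ℕ.* 4 ℕ.+ 2 ℕ.+ z) μ≡) (lem n p)
    where
    lem : ∀ n p → (n ℕ.* 4 ℕ.+ 2) ℕ.+ (3 ℕ.+ p ℕ.* 4) ≡ (n ℕ.+ suc p) ℕ.* 4 ℕ.+ 1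
    lem = ℕRing.solve-∀
  predecessor (suc (suc (suc zero))) n = trans (cong (λ z → n ℕ.* 4 ℕ.+ 3 ℕ.+ z) μ≡) (lem n p)
    where
    lem : ∀ n p → (n ℕ.* 4 ℕ.+ 3) ℕ.+ (3 ℕ.+ p ℕ.* 4) ≡ (n ℕ.+ suc p) ℕ.* 4 ℕ.+ 2
    lem = ℕRing.solve-∀

  bound+offset : ∀ c → bound c ℕ.+ offset c ≡ μ
  bound+offset zero    = trans (cong (ℕ._+ p) H≡3a) (trans (lem p) (sym μ≡))
    where
    lem : ∀ p → 3 ℕ.* suc p ℕ.+ p ≡ 3 ℕ.+ p ℕ.* 4
    lem = ℕRing.solve-∀
  bound+offset (suc _) = ℕ.suc-injective (trans (cong (ℕ._+ suc p) (trans (sym H≡suc-G) H≡3a)) (trans (lem p) (cong suc (sym μ≡))))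
    where
    lem : ∀ p → 3 ℕ.* suc p ℕ.+ suc p ≡ suc (3 ℕ.+ p ℕ.* 4)
    lem = ℕRing.solve-∀

  binomial-top : ∀ c {k K l n} → k ℕ.+ K ≡ bound c → k ℕ.+ l ≡ n → l ℕ.+ μ ≡ K ℕ.+ (n ℕ.+ offset c)
  binomial-top c {k} {K} {l} eq refl = trans (cong (λ z → l ℕ.+ z) (trans (sym (bound+offset c)) (cong (ℕ._+ offset c) (sym eq)))) (lem k K l (offset c))
    where
    lem : ∀ k K l o → l ℕ.+ (k ℕ.+ K ℕ.+ o) ≡ K ℕ.+ (k ℕ.+ l ℕ.+ o)
    lem = ℕRing.solve-∀

  8^suc-p : 2 ℕ.^ H ≡ 8 ℕ.^ suc p
  8^suc-p = trans (cong (2 ℕ.^_) H≡3a) (sym (ℕ.^-*-assoc 2 3 (suc p)))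

  -- The balance rests on `8^suc-p` and on the fact that for every c exactly one of the digits
  -- `co c` and `pre c` is at least 2.
  powers : ∀ c {k K} n → k ℕ.+ K ≡ bound c →
    8 ℕ.^ H ℕ.* 2 ℕ.^ H ℕ.* 8 ℕ.^ n ≡ 4 ℕ.* (8 ℕ.^ k ℕ.* 8 ℕ.^ K ℕ.* 8 ℕ.^ (n ℕ.+ offset c) ℕ.* (2 ℕ.^ twos (co c) ℕ.* 2 ℕ.^ twos (pre c)))
  powers zero {k} {K} n eq = begin
    8 ℕ.^ H ℕ.* 2 ℕ.^ H ℕ.* 8 ℕ.^ n                  ≡⟨ cong₂ (λ x y → x ℕ.* y ℕ.* 8 ℕ.^ n) (trans (cong (8 ℕ.^_) (sym eq)) (ℕ.^-distribˡ-+-* 8 k K)) 8^suc-p ⟩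
    8 ℕ.^ k ℕ.* 8 ℕ.^ K ℕ.* (8 ℕ.* 8 ℕ.^ p) ℕ.* 8 ℕ.^ n ≡⟨ lem (8 ℕ.^ k ℕ.* 8 ℕ.^ K) (8 ℕ.^ p) (8 ℕ.^ n) ⟩
    4 ℕ.* (8 ℕ.^ k ℕ.* 8 ℕ.^ K ℕ.* (8 ℕ.^ n ℕ.* 8 ℕ.^ p) ℕ.* 2) ≡⟨ cong (λ z → 4 ℕ.* (8 ℕ.^ k ℕ.* 8 ℕ.^ K ℕ.* z ℕ.* 2)) (ℕ.^-distribˡ-+-* 8 n p) ⟨
    4 ℕ.* (8 ℕ.^ k ℕ.* 8 ℕ.^ K ℕ.* 8 ℕ.^ (n ℕ.+ p) ℕ.* 2) ∎
    where
    open ≡-Reasoning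
    lem : ∀ x y z → x ℕ.* (8 ℕ.* y) ℕ.* z ≡ 4 ℕ.* (x ℕ.* (z ℕ.* y) ℕ.* 2)
    lem = ℕRing.solve-∀
  powers (suc c) {k} {K} n eq = begin
    8 ℕ.^ H ℕ.* 2 ℕ.^ H ℕ.* 8 ℕ.^ n
      ≡⟨ cong₂ (λ x y → x ℕ.* y ℕ.* 8 ℕ.^ n) (trans (cong (8 ℕ.^_) (trans H≡suc-G (cong suc (sym eq)))) (cong (8 ℕ.*_) (ℕ.^-distribˡ-+-* 8 k K))) 8^suc-p ⟩
    8 ℕ.* (8 ℕ.^ k ℕ.* 8 ℕ.^ K) ℕ.* 8 ℕ.^ suc p ℕ.* 8 ℕ.^ n
      ≡⟨ lem (8 ℕ.^ k ℕ.* 8 ℕ.^ K) (8 ℕ.^ suc p) (8 ℕ.^ n) ⟩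
    4 ℕ.* (8 ℕ.^ k ℕ.* 8 ℕ.^ K ℕ.* (8 ℕ.^ n ℕ.* 8 ℕ.^ suc p) ℕ.* 2)
      ≡⟨ cong₂ (λ z w → 4 ℕ.* (8 ℕ.^ k ℕ.* 8 ℕ.^ K ℕ.* z ℕ.* w)) (sym (ℕ.^-distribˡ-+-* 8 n (suc p))) (by-digit c) ⟩
    4 ℕ.* (8 ℕ.^ k ℕ.* 8 ℕ.^ K ℕ.* 8 ℕ.^ (n ℕ.+ suc p) ℕ.* (2 ℕ.^ twos (co (suc c)) ℕ.* 2 ℕ.^ twos (pre (suc c)))) ∎
    where
    open ≡-Reasoning
    lem : ∀ x y z → 8 ℕ.* x ℕ.* y ℕ.* z ≡ 4 ℕ.* (x ℕ.* (z ℕ.* y) ℕ.* 2)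
    lem = ℕRing.solve-∀
    by-digit : ∀ c → 2 ≡ 2 ℕ.^ twos (co (suc c)) ℕ.* 2 ℕ.^ twos (pre (suc c))
    by-digit zero             = refl
    by-digit (suc zero)       = refl
    by-digit (suc (suc zero)) = refl

  numerator : Fin 4 → ℕ → ℕ
  numerator c n = η ℕ.* oddBlocks H ℕ.* oddTail c n

  denominator : Fin 4 → ℕ → ℕ → ℕ
  denominator c k n = oddFactor c k ℕ.* oddFactor (co c) (bound c ∸ k) ℕ.* (blockRange n (offset c) ℕ.* oddTail (pre c) (n ℕ.+ offset c))

  binomials : Fin 4 → ℕ → ℕ → ℕ
  binomials c k n = (n C k) ℕ.* ((n ℕ.+ offset c ℕ.+ (bound c ∸ k)) C (bound c ∸ k))

  weight-identity : ∀ c {k l n} → k ℕ.≤ bound c → k ℕ.+ l ≡ n →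
    -- The factor `oddBlocks n` comes from (4 n + c)!. Multiplying both sides by it completes
    -- `blockRange n (offset c)` to the blocks of (4 n + c + μ)!, as `binomial-ratio` requires.
    denominator c k n ℕ.* (((H ℕ.* 4) C (k ℕ.* 4 ℕ.+ toℕ c)) ℕ.* multichoose l) ≡ numerator c n ℕ.* binomials c k n ℕ.* multichoose (n ℕ.* 4 ℕ.+ toℕ c)
  weight-identity c {k} {l} {n} k≤ eq = ℕ.*-cancelʳ-≡ _ _ (oddBlocks n) {{odd⇒nonZero (oddBlocks-odd n)}} (begin
    denominator c k n ℕ.* (C₁ ℕ.* multichoose l) ℕ.* oddBlocks n
      ≡⟨ lem₁ (oddFactor c k) (oddFactor (co c) K) (blockRange n o) (oddTail (pre c) (n ℕ.+ o)) C₁ (multichoose l) (oddBlocks n) ⟩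
    C₁ ℕ.* multichoose l ℕ.* (oddFactor c k ℕ.* oddFactor (co c) K ℕ.* (oddBlocks n ℕ.* blockRange n o ℕ.* oddTail (pre c) (n ℕ.+ o)))
      ≡⟨ cong (λ z → C₁ ℕ.* multichoose l ℕ.* (oddFactor c k ℕ.* oddFactor (co c) K ℕ.* (z ℕ.* oddTail (pre c) (n ℕ.+ o)))) (oddBlocks-+ n o) ⟨
    C₁ ℕ.* multichoose l ℕ.* (oddFactor c k ℕ.* oddFactor (co c) K ℕ.* oddFactor (pre c) (n ℕ.+ o))
      ≡⟨ binomial-ratio H η k l n K (n ℕ.+ o) μ c (co c) (pre c) H!-twos (complement c {k} {K} k+K) (predecessor c n) eq (binomial-top c {k} {K} k+K eq) (powers c {k} {K} n k+K) ⟩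
    η ℕ.* oddBlocks H ℕ.* (oddBlocks n ℕ.* oddTail c n) ℕ.* binomials c k n ℕ.* multichoose (n ℕ.* 4 ℕ.+ toℕ c)
      ≡⟨ lem₂ (η ℕ.* oddBlocks H) (oddBlocks n) (oddTail c n) (binomials c k n) (multichoose (n ℕ.* 4 ℕ.+ toℕ c)) ⟩
    numerator c n ℕ.* binomials c k n ℕ.* multichoose (n ℕ.* 4 ℕ.+ toℕ c) ℕ.* oddBlocks n ∎)
    where
    open ≡-Reasoning
    C₁ = (H ℕ.* 4) C (k ℕ.* 4 ℕ.+ toℕ c)
    K = bound c ∸ k
    o = offset c
    k+K : k ℕ.+ K ≡ bound c
    k+K = ℕ.m+[n∸m]≡n k≤
    lem₁ : ∀ a b x t c r w → a ℕ.* b ℕ.* (x ℕ.* t) ℕ.* (c ℕ.* r) ℕ.* w ≡ c ℕ.* r ℕ.* (a ℕ.* b ℕ.* (w ℕ.* x ℕ.* t))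
    lem₁ = ℕRing.solve-∀
    lem₂ : ∀ a w t b r → a ℕ.* (w ℕ.* t) ℕ.* b ℕ.* r ≡ a ℕ.* t ℕ.* b ℕ.* r ℕ.* w
    lem₂ = ℕRing.solve-∀

  denominator-odd : ∀ c k n → Oddℕ (denominator c k n)
  denominator-odd c k n = oddℕ-* {oddFactor c k ℕ.* oddFactor (co c) (bound c ∸ k)}
    (oddℕ-* {oddFactor c k} (oddFactor-odd c k) (oddFactor-odd (co c) (bound c ∸ k)))
    (oddℕ-* {blockRange n (offset c)} (blockRange-odd n (offset c)) (oddTail-odd (pre c) (n ℕ.+ offset c)))

  numerator-odd : ∀ c n → Oddℕ (numerator c n)
  numerator-odd c n = oddℕ-* {η ℕ.* oddBlocks H} (oddℕ-* {η} η-odd (oddBlocks-odd H)) (oddTail-odd c n)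

  mask-ratio′ : ∀ j → ∃ λ e → Odd e × Ratio s (mask m j) (+ ((H ℕ.* 4) C j)) e
  mask-ratio′ = mask-ratio-at u (2 ℕ.^ u) refl 2≤q m≡ H≡′ s
    where
    m≡ : 2 ℕ.* (3 ℕ.* 2 ℕ.^ u) ≡ m
    m≡ = trans (cong (2 ℕ.*_) 3q≡2a) (trans (lem p) (sym (trans m≡suc-μ (cong suc μ≡))))
      where
      lem : ∀ p → 2 ℕ.* (2 ℕ.* suc p) ≡ 4 ℕ.+ p ℕ.* 4
      lem = ℕRing.solve-∀
    H≡′ : 6 ℕ.* (3 ℕ.* 2 ℕ.^ u) ≡ H ℕ.* 4
    H≡′ = trans (cong (6 ℕ.*_) 3q≡2a) (trans (lem p) (cong (ℕ._* 4) (sym H≡3a)))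
      where
      lem : ∀ p → 6 ℕ.* (2 ℕ.* suc p) ≡ 3 ℕ.* suc p ℕ.* 4
      lem = ℕRing.solve-∀

  unit : Fin 4 → ℕ → ℤ
  unit c k = proj₁ (mask-ratio′ (k ℕ.* 4 ℕ.+ toℕ c))

  weight : Fin 4 → ℕ → ℕ → ℤ
  weight c k n = unit c k * (+ (numerator c n ℕ.* binomials c k n) * inv s (+ denominator c k n))

  weight-ratio : ∀ c {k l n} → k ℕ.≤ bound c → k ℕ.+ l ≡ n →
    Ratio s (maskᶜ m c k * + multichoose l) (+ multichoose (n ℕ.* 4 ℕ.+ toℕ c)) (weight c k n)
  weight-ratio c {k} {l} {n} k≤ eq = ratio-trans {b = + C₁ * + multichoose l}
    (ratio-*ʳ (+ multichoose l) (proj₂ (proj₂ (mask-ratio′ (k ℕ.* 4 ℕ.+ toℕ c)))))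
    (ratio-odd {w = + (numerator c n ℕ.* binomials c k n)} (denominator-odd c k n) (begin
      + denominator c k n * (+ C₁ * + multichoose l)                          ≡⟨ cong (+ denominator c k n *_) (ℤ.pos-* C₁ (multichoose l)) ⟨
      + denominator c k n * + (C₁ ℕ.* multichoose l)                          ≡⟨ ℤ.pos-* (denominator c k n) (C₁ ℕ.* multichoose l) ⟨
      + (denominator c k n ℕ.* (C₁ ℕ.* multichoose l))                        ≡⟨ cong +_ (weight-identity c k≤ eq) ⟩
      + (numerator c n ℕ.* binomials c k n ℕ.* multichoose (n ℕ.* 4 ℕ.+ toℕ c)) ≡⟨ ℤ.pos-* (numerator c n ℕ.* binomials c k n) (multichoose (n ℕ.* 4 ℕ.+ toℕ c)) ⟩
      + (numerator c n ℕ.* binomials c k n) * + multichoose (n ℕ.* 4 ℕ.+ toℕ c) ∎))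
    where
    open ≡-Reasoning
    C₁ = (H ℕ.* 4) C (k ℕ.* 4 ℕ.+ toℕ c)

  unit-ratio : ∀ c k → Ratio s (maskᶜ m c k) (+ ((H ℕ.* 4) C (k ℕ.* 4 ℕ.+ toℕ c))) (unit c k)
  unit-ratio c k = proj₂ (proj₂ (mask-ratio′ (k ℕ.* 4 ℕ.+ toℕ c)))

  beyond-degree : ∀ c {k} → bound c ℕ.< k → H ℕ.* 4 ℕ.< k ℕ.* 4 ℕ.+ toℕ c
  beyond-degree zero    {k} lt = ℕ.<-≤-trans (ℕ.*-monoˡ-< 4 lt) (ℕ.m≤m+n (k ℕ.* 4) 0)
  beyond-degree (suc c) {k} lt = ℕ.≤-<-trans (ℕ.*-monoˡ-≤ 4 (ℕ.≤-trans (ℕ.≤-reflexive H≡suc-G) lt)) (ℕ.m<m+n (k ℕ.* 4) (s≤s z≤n))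

  mask-zero : ∀ c {k} → bound c ℕ.< k → maskᶜ m c k ≡ 0ℤ
  mask-zero c {k} b<k = ratio-of-0 (cong +_ (k>n⇒nCk≡0 (beyond-degree c b<k))) (unit-ratio c k)

  -- The exponent is at least `s * k` for every lower index k ≤ H of a binomial coefficient, and at
  -- least `s`, as the odd factors demand.
  period : ℕ
  period = 2 ℕ.^ (s ℕ.* suc H)

  weight-periodic : ∀ c {k} → k ℕ.≤ bound c → ∀ n j → weight c k (n ℕ.+ j ℕ.* period) ≡ weight c k n [mod 2^ s ]
  weight-periodic c {k} k≤ n j = mod-* (mod-refl (unit c k)) (mod-*
    (modℕ-* (numerator c n′) (numerator c n) (binomials c k n′) (binomials c k n)
      (modℕ-* (η ℕ.* oddBlocks H) (η ℕ.* oddBlocks H) (oddTail c n′) (oddTail c n) (mod-refl (+ (η ℕ.* oddBlocks H))) (oddTail-cong c {n′} {n} n′≡n))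
      (modℕ-* (n′ C k) (n C k) _ _ (C-periodic-≤ s (ℕ.≤-trans k≤ (ℕ.≤-trans (bound≤H c) (ℕ.n≤1+n H))) j n)
        (subst (λ z → + (z C K) ≡ + ((n ℕ.+ o ℕ.+ K) C K) [mod 2^ s ]) (lem n o K (j ℕ.* period))
          (C-periodic-≤ s (ℕ.≤-trans (ℕ.m∸n≤m (bound c) k) (ℕ.≤-trans (bound≤H c) (ℕ.n≤1+n H))) j (n ℕ.+ o ℕ.+ K)))))
    (inv-cong s (modℕ-* F F _ _ (mod-refl (+ F)) (modℕ-* (blockRange n′ o) (blockRange n o) _ _
      (blockRange-cong o {n′} {n} n′≡n) (oddTail-cong (pre c) {n′ ℕ.+ o} {n ℕ.+ o} (mod-+ n′≡n (mod-refl (+ o))))))))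
    where
    n′ = n ℕ.+ j ℕ.* period
    K = bound c ∸ k
    o = offset c
    F = oddFactor c k ℕ.* oddFactor (co c) K
    lem : ∀ n o K x → n ℕ.+ o ℕ.+ K ℕ.+ x ≡ n ℕ.+ x ℕ.+ o ℕ.+ K
    lem = ℕRing.solve-∀
    cancel : ∀ n x → (n + x) - n ≡ x
    cancel = solve-∀
    n′≡n : + n′ ≡ + n [mod 2^ s ]
    n′≡n = by (subst (2^ s ∣_) (sym (trans (cancel (+ n) (+ (j ℕ.* period))) (ℤ.pos-* j period)))
      (∣n⇒∣m*n (+ j) (2^-mono (ℕ.≤-trans (ℕ.m≤m+n s (s ℕ.* H)) (ℕ.≤-reflexive (sym (ℕ.*-suc s H)))))))

  weight-parity : ∀ c k n → weight c k n ≡ + binomials c k n [mod + 2 ]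
  weight-parity c k n = mod-trans (odd-*-≡ (proj₁ (proj₂ (mask-ratio′ (k ℕ.* 4 ℕ.+ toℕ c)))))
    (subst (_≡ + binomials c k n [mod + 2 ]) (begin
      (+ numerator c n * inv s (+ denominator c k n)) * + binomials c k n    ≡⟨ lem (+ numerator c n) (inv s (+ denominator c k n)) (+ binomials c k n) ⟩
      + numerator c n * + binomials c k n * inv s (+ denominator c k n)      ≡⟨ cong (_* inv s (+ denominator c k n)) (ℤ.pos-* (numerator c n) (binomials c k n)) ⟨
      + (numerator c n ℕ.* binomials c k n) * inv s (+ denominator c k n)    ∎)
      (odd-*-≡ (odd-* {+ numerator c n} (numerator-odd c n) (inv-odd s (denominator-odd c k n)))))
    where
    open ≡-Reasoning
    lem : ∀ a i b → (a * i) * b ≡ a * b * i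
    lem = solve-∀

  -- The signed sum is the coefficient of x^(bound c) in
  -- (1 - x)^n (1 - x)^-(n + offset c + 1).
  weights-odd : ∀ c n → Odd (sum {suc (bound c)} (λ k → weight c (toℕ k) n))
  weights-odd c n = odd-mod (mod-trans (mod-sum (suc (bound c)) (λ k → mod-trans (weight-parity c (toℕ k) n) (mod-sym (signed (toℕ k)))))
    (mod-reflexive (at (1-x^⊛negBinomial n (offset c)) (bound c)))) (final c)
    where
    signed : ∀ k → (1-x ^ᴾ n) k * negBinomial (n ℕ.+ offset c) (bound c ∸ k) ≡ + binomials c k n [mod + 2 ]
    signed k = subst₂ (_≡_[mod + 2 ])
      (trans (lem (sgn k) (+ (n C k)) (negBinomial (n ℕ.+ offset c) (bound c ∸ k))) (cong (_* negBinomial (n ℕ.+ offset c) (bound c ∸ k)) (sym (1-x^-coeff n k))))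
      (sym (ℤ.pos-* (n C k) ((n ℕ.+ offset c ℕ.+ (bound c ∸ k)) C (bound c ∸ k))))
      (odd-*-≡ (sgn-odd k))
      where
      lem : ∀ s x y → s * (x * y) ≡ s * x * y
      lem = solve-∀
    final : ∀ c → Odd (negBinomial (offset c) (bound c))
    final zero    = C-odd₀
    final (suc _) = C-odd₁

-- The residues of t m n / C (n + m - 1) (m - 1)

sum-extend : ∀ A B (g : ℕ → ℤ) → (∀ k → A ℕ.≤ k → g k ≡ 0ℤ) → sum {A ℕ.+ B} (g ∘ toℕ) ≡ sum {A} (g ∘ toℕ)
sum-extend zero    B g g≡0 = trans (sum-cong-≗ {B} (λ i → g≡0 (toℕ i) z≤n)) (sum-replicate-zero B)
sum-extend (suc A) B g g≡0 = +-congˡ (g 0) (sum-extend A B (g ∘ suc) (λ k A≤k → g≡0 (suc k) (s≤s A≤k)))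

ratio-sum : ∀ {s b} n (f w : Fin n → ℤ) → (∀ i → Ratio s (f i) b (w i)) → Ratio s (sum f) b (sum w)
ratio-sum zero    f w p = ratio-0
ratio-sum (suc n) f w p = ratio-+ {v = w zero} (p zero) (ratio-sum n (f ∘ suc) (w ∘ suc) (p ∘ suc))

-- Position w + n holds v n, and the positions below w stand for negative arguments, where v is
-- continued by 0.
delay : ℕ → (ℕ → ℤ) → ℕ → ℤ
delay zero    v n       = v n
delay (suc w) v zero    = 0ℤ
delay (suc w) v (suc n) = delay w v n

delay-+ : ∀ w v n → delay w v (w ℕ.+ n) ≡ v n
delay-+ zero    v n = refl
delay-+ (suc w) v n = delay-+ w v n

delay-< : ∀ {w n} v → n ℕ.< w → delay w v n ≡ 0ℤ
delay-< {suc w} {zero}  v _         = refl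
delay-< {suc w} {suc n} v (s≤s n<w) = delay-< v n<w

delay-inside : ∀ w v {n k} → k ℕ.≤ n → delay w v (n ℕ.+ w ∸ k) ≡ v (n ∸ k)
delay-inside w v {n} {k} k≤n = trans (cong (delay w v) (trans (cong (_∸ k) (ℕ.+-comm n w)) (ℕ.+-∸-assoc w k≤n))) (delay-+ w v (n ∸ k))

delay-outside : ∀ {w} v {n k} → 0 ℕ.< w → n ℕ.< k → delay w v (n ℕ.+ w ∸ k) ≡ 0ℤ
delay-outside {suc w} v {n} {k} _ n<k = delay-< v (s≤s (ℕ.≤-trans (ℕ.∸-monoʳ-≤ (n ℕ.+ suc w) n<k)
  (ℕ.≤-reflexive (trans (cong (_∸ suc n) (ℕ.+-suc n w)) (ℕ.m+n∸m≡n n w)))))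

-- With f extended by zero to negative arguments, the convolution runs over
-- the support of g.
⊛-truncate : ∀ w g f b n → 0 ℕ.< w → (∀ {k} → b ℕ.< k → g k ≡ 0ℤ) →
  (g ⊛ f) n ≡ sum {suc b} (λ k → g (toℕ k) * delay w f (n ℕ.+ w ∸ toℕ k))
⊛-truncate w g f b n 0<w g≡0 = begin
  (g ⊛ f) n                               ≡⟨ sum-cong-≗ {suc n} (λ k → cong (g (toℕ k) *_) (sym (delay-inside w f (toℕ≤pred[n] k)))) ⟩
  sum {suc n} (h ∘ toℕ)                   ≡⟨ sum-extend (suc n) (suc b) h (λ k n<k → trans (cong (g k *_) (delay-outside f 0<w n<k)) (ℤ.*-zeroʳ (g k))) ⟨
  sum {suc n ℕ.+ suc b} (h ∘ toℕ)         ≡⟨ cong (λ N → sum {N} (h ∘ toℕ)) (ℕ.+-comm (suc n) (suc b)) ⟩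
  sum {suc b ℕ.+ suc n} (h ∘ toℕ)         ≡⟨ sum-extend (suc b) (suc n) h (λ k b<k → cong (_* delay w f (n ℕ.+ w ∸ k)) (g≡0 b<k)) ⟩
  sum {suc b} (h ∘ toℕ)                   ∎
  where
  open ≡-Reasoning
  h : ℕ → ℤ
  h k = g k * delay w f (n ℕ.+ w ∸ k)

⊛-ratio : ∀ {s} w (g f v ρ : ℕ → ℤ) N (W : ℕ → ℤ) b n → 0 ℕ.< w → (∀ {k} → b ℕ.< k → g k ≡ 0ℤ) →
  (∀ i → i ℕ.≤ n → Ratio s (f i) (ρ i) (v i)) →
  (∀ k → k ℕ.≤ b → k ℕ.≤ n → Ratio s (g k * ρ (n ∸ k)) N (W k)) →
  Ratio s ((g ⊛ f) n) N (sum {suc b} (λ k → W (toℕ k) * delay w v (n ℕ.+ w ∸ toℕ k)))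
⊛-ratio {s} w g f v ρ N W b n 0<w g≡0 v-ratio W-ratio = subst (λ z → Ratio s z N (sum {suc b} (λ k → W (toℕ k) * delay w v (n ℕ.+ w ∸ toℕ k))))
  (sym (⊛-truncate w g f b n 0<w g≡0))
  (ratio-sum (suc b) (λ k → g (toℕ k) * delay w f (n ℕ.+ w ∸ toℕ k)) (λ k → W (toℕ k) * delay w v (n ℕ.+ w ∸ toℕ k)) (λ k → summand (toℕ k) (toℕ≤pred[n] k)))
  where
  summand : ∀ k → k ℕ.≤ b → Ratio s (g k * delay w f (n ℕ.+ w ∸ k)) N (W k * delay w v (n ℕ.+ w ∸ k))
  summand k k≤b with ℕ.<-≤-connex n k
  ... | inj₁ n<k = subst₂ (λ x y → Ratio s (g k * x) N (W k * y)) (sym (delay-outside f 0<w n<k)) (sym (delay-outside v 0<w n<k))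
          (subst₂ (λ x y → Ratio s x N y) (sym (ℤ.*-zeroʳ (g k))) (sym (ℤ.*-zeroʳ (W k))) ratio-0)
  ... | inj₂ k≤n = subst₂ (λ x y → Ratio s (g k * x) N (W k * y)) (sym (delay-inside w f k≤n)) (sym (delay-inside w v k≤n))
          (subst (Ratio s (g k * f (n ∸ k)) N) (ℤ.*-comm (v (n ∸ k)) (W k))
            (ratio-trans {v = v (n ∸ k)} {w = W k} (ratio-*ˡ (g k) (v-ratio (n ∸ k) (ℕ.m∸n≤m n k))) (W-ratio k k≤b k≤n)))

-- Modulo 2 every `v i` is 1, and where the delayed value is 0 instead the weight is even.
delayed-sum-odd : ∀ w (v W : ℕ → ℤ) b n → 0 ℕ.< w → (∀ i → i ℕ.≤ n → Odd (v i)) → (∀ k → n ℕ.< k → W k ≡ 0ℤ [mod + 2 ]) →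
  Odd (sum {suc b} (λ k → W (toℕ k))) → Odd (sum {suc b} (λ k → W (toℕ k) * delay w v (n ℕ.+ w ∸ toℕ k)))
delayed-sum-odd w v W b n 0<w v-odd W≡0 = odd-mod (mod-sum (suc b) (λ k → summand (toℕ k)))
  where
  summand : ∀ k → W k * delay w v (n ℕ.+ w ∸ k) ≡ W k [mod + 2 ]
  summand k with ℕ.<-≤-connex n k
  ... | inj₁ n<k = mod-trans (mod-reflexive (trans (cong (W k *_) (delay-outside v 0<w n<k)) (ℤ.*-zeroʳ (W k)))) (mod-sym (W≡0 k n<k))
  ... | inj₂ k≤n = subst (_≡ W k [mod + 2 ]) (trans (ℤ.*-comm (v (n ∸ k)) (W k)) (cong (W k *_) (sym (delay-inside w v k≤n))))
          (odd-*-≡ (v-odd (n ∸ k) (ℕ.m∸n≤m n k)))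

module Residues (𝓔 : Exponent) (s : ℕ) where
  open Exponent 𝓔
  open Weights 𝓔 s

  0<m : 0 ℕ.< m
  0<m = subst (0 ℕ.<_) (sym m≡suc-μ) (s≤s z≤n)

  f : PowerSeries
  f = t m

  predicted : (ℕ → ℤ) → Fin 4 → ℕ → ℤ
  predicted v c n = sum {suc (bound c)} (λ k → weight c (toℕ k) n * delay m v (n ℕ.+ m ∸ toℕ k))

  predicted-ratio : ∀ v c n → (∀ i → i ℕ.≤ n → Ratio s (f i) (+ multichoose i) (v i)) →
    Ratio s (f (n ℕ.* 4 ℕ.+ toℕ c)) (+ multichoose (n ℕ.* 4 ℕ.+ toℕ c)) (predicted v c n)
  predicted-ratio v c n v-ratio = subst (λ z → Ratio s z (+ multichoose (n ℕ.* 4 ℕ.+ toℕ c)) (predicted v c n)) (sym (t-refinement m c n))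
    (⊛-ratio m (maskᶜ m c) f v (λ i → + multichoose i) (+ multichoose (n ℕ.* 4 ℕ.+ toℕ c)) (λ k → weight c k n) (bound c) n 0<m (mask-zero c) v-ratio
      (λ k k≤b k≤n → weight-ratio c k≤b (ℕ.m+[n∸m]≡n k≤n)))

  predicted-odd : ∀ v c n → (∀ i → i ℕ.≤ n → Odd (v i)) → Odd (predicted v c n)
  predicted-odd v c n v-odd = delayed-sum-odd m v (λ k → weight c k n) (bound c) n 0<m v-odd
    (λ k n<k → mod-trans (weight-parity c k n) (mod-reflexive (cong (λ z → + (z ℕ.* ((n ℕ.+ offset c ℕ.+ (bound c ∸ k)) C (bound c ∸ k)))) (k>n⇒nCk≡0 n<k))))
    (weights-odd c n)

  Residue : ℕ → Set
  Residue n = ∃ λ v → Odd v × Ratio s (f n) (+ multichoose n) v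

  f0≡1 : ∀ n → (T ^ˢ n) 0 ≡ 1ℤ
  f0≡1 zero    = refl
  f0≡1 (suc n) = trans (ℤ.+-identityʳ _) (trans (ℤ.*-identityˡ _) (f0≡1 n))

  residue-0 : Residue 0
  residue-0 = 1ℤ , odd-1 , ratio-exact (trans (f0≡1 m) (sym (cong (λ z → 1ℤ * + z) (nCn≡1 μ))))

  residue-step : ∀ n → (∀ {i} → i ℕ.< n → Residue i) → Residue n
  residue-step zero      rec = residue-0
  -- For n > 0 the quotient by 4 is smaller than n, whereas n = 0 would refer to itself.
  residue-step n@(suc _) rec with n divMod 4
  ... | result q c eq = subst Residue (sym n≡) (predicted v c q , predicted-odd v c q (λ i i≤q → proj₁ (v-good i i≤q)) ,
          predicted-ratio v c q (λ i i≤q → proj₂ (v-good i i≤q)))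
    where
    n≡ : n ≡ q ℕ.* 4 ℕ.+ toℕ c
    n≡ = trans eq (ℕ.+-comm (toℕ c) (q ℕ.* 4))
    q<n : ∀ q → n ≡ q ℕ.* 4 ℕ.+ toℕ c → q ℕ.< n
    q<n zero    _  = s≤s z≤n
    q<n (suc q) eq = ℕ.<-≤-trans (s≤s (s≤s (ℕ.≤-trans (ℕ.m≤m*n q 4) (ℕ.≤-trans (ℕ.m≤m+n (q ℕ.* 4) (toℕ c)) (ℕ.m≤n+m _ 2))))) (ℕ.≤-reflexive (sym eq))
    -- The value 0 outside the induction hypothesis is only a filler: the prediction for n reads v
    -- at arguments up to q, and q < n.
    value : ∀ i → Dec (i ℕ.< n) → ℤ
    value i (yes i<n) = proj₁ (rec i<n)
    value i (no _)    = 0ℤ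
    v : ℕ → ℤ
    v i = value i (i ℕ.<? n)
    value-good : ∀ i d → i ℕ.< n → Odd (value i d) × Ratio s (f i) (+ multichoose i) (value i d)
    value-good i (yes i<n) _   = proj₂ (rec i<n)
    value-good i (no i≮n)  i<n = contradiction i<n i≮n
    v-good : ∀ i → i ℕ.≤ q → Odd (v i) × Ratio s (f i) (+ multichoose i) (v i)
    v-good i i≤q = value-good i (i ℕ.<? n) (ℕ.≤-<-trans i≤q (q<n q n≡))

  residue : ∀ n → Residue n
  residue = <-rec Residue residue-step

  -- Only the class modulo `2^ s` is canonical; the chosen integer depends on `s` and on the
  -- recursion.
  û : ℕ → ℤ
  û n = proj₁ (residue n)

  û-odd : ∀ n → Odd (û n)
  û-odd n = proj₁ (proj₂ (residue n))

  û-ratio : ∀ n → Ratio s (f n) (+ multichoose n) (û n)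
  û-ratio n = proj₂ (proj₂ (residue n))

  multichoose≢0 : ∀ n → + multichoose n ≢ 0ℤ
  multichoose≢0 n eq = ℕ.≢-nonZero⁻¹ ((n ℕ.+ μ) !) {{(n ℕ.+ μ) ℕ.!≢0}}
    (trans (sym (C-factorial′ n μ)) (cong (ℕ._* (n ! ℕ.* μ !)) (ℤ.+-injective eq)))

  -- The recursion behind `û` is not unfolded: both sides represent the same quotient, so
  -- `ratio-unique` applies. This includes n = 0.
  û-recurrence : ∀ c n → û (n ℕ.* 4 ℕ.+ toℕ c) ≡ predicted û c n [mod 2^ s ]
  û-recurrence c n = ratio-unique {s} {f N} {+ multichoose N} (multichoose≢0 N) (û-ratio N) (predicted-ratio û c n (λ i _ → û-ratio i))
    where N = n ℕ.* 4 ℕ.+ toℕ c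

-- The automaton

-- For some odd d one has d a = (d w + q 2^s) b. As s ≥ 1 the bracket is odd, so a and b contain the
-- same power of 2.
odd-ratio : ∀ {s a b w} → 1 ℕ.≤ s → b ≢ 0ℤ → Odd w → Ratio s a b w → odd a ≡ odd b * w [mod 2^ s ]
odd-ratio {s} {a} {b} {w} 1≤s b≢0 odd-w (mkRatio (local {d} odd-d (divides q eq))) with decompose b≢0
... | decomposed v o odd-o split = by (2^∣odd*⇒2^∣ s odd-d (divides (o * q) (begin
  d * (odd a - odd b * w)             ≡⟨ lem₂ d (odd a) (odd b) w ⟩
  d * odd a - odd b * (d * w)         ≡⟨ cong₂ (λ y z → y - z * (d * w)) odd-a (odd-part v o split odd-o) ⟩
  o * x - o * (d * w)                 ≡⟨ lem₃ o d w q (2^ s) ⟩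
  o * q * 2^ s                        ∎)))
  where
  open ≡-Reasoning
  x = d * w + q * 2^ s
  x-odd : Odd x
  x-odd = odd-mod (by (subst (+ 2 ∣_) (sym (lem (d * w) (q * 2^ s))) (∣n⇒∣m*n q (2^-mono 1≤s)))) (odd-* odd-d odd-w)
    where
    lem : ∀ x y → (x + y) - x ≡ y
    lem = solve-∀
  da≡ : d * a ≡ o * x * 2^ v
  da≡ = begin
    d * a                                ≡⟨ lem₀ d a w b ⟩
    d * (a - w * b) + d * w * b          ≡⟨ cong₂ (λ y z → y + d * w * z) eq split ⟩
    q * (2^ s * b) + d * w * (o * 2^ v)  ≡⟨ cong (λ z → q * (2^ s * z) + d * w * (o * 2^ v)) split ⟩
    q * (2^ s * (o * 2^ v)) + d * w * (o * 2^ v) ≡⟨ lem₁ q (2^ s) o (2^ v) (d * w) ⟩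
    o * x * 2^ v                         ∎
    where
    lem₀ : ∀ d a w b → d * a ≡ d * (a - w * b) + d * w * b
    lem₀ = solve-∀
    lem₁ : ∀ q s o v y → q * (s * (o * v)) + y * (o * v) ≡ o * (y + q * s) * v
    lem₁ = solve-∀
  a≢0 : a ≢ 0ℤ
  a≢0 refl with ℤ.i*j≡0⇒i≡0∨j≡0 (o * x) (trans (sym da≡) (ℤ.*-zeroʳ d))
  ... | inj₁ ox≡0 = odd⇒¬even (odd-* {o} {x} odd-o x-odd) (subst (+ 2 ∣_) (sym ox≡0) (divides 0ℤ refl))
  ... | inj₂ 2^≡0 = 2^≢0 v 2^≡0
  d≢0 : d ≢ 0ℤ
  d≢0 refl = odd⇒¬even odd-d (divides 0ℤ refl)
  odd-a : d * odd a ≡ o * x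
  odd-a = begin
    d * odd a       ≡⟨ cong (_* odd a) (odd-of-odd odd-d) ⟨
    odd d * odd a   ≡⟨ odd-distrib-* d≢0 a≢0 ⟨
    odd (d * a)     ≡⟨ odd-part v (o * x) da≡ (odd-* {o} {x} odd-o x-odd) ⟩
    o * x           ∎
  lem₂ : ∀ d a b w → d * (a - b * w) ≡ d * a - b * (d * w)
  lem₂ = solve-∀
  lem₃ : ∀ o d w q s → o * (d * w + q * s) - o * (d * w) ≡ o * q * s
  lem₃ = solve-∀

∏ᶻ : ℕ → (ℕ → ℤ) → ℤ
∏ᶻ zero    g = 1ℤ
∏ᶻ (suc j) g = ∏ᶻ j g * g j

∏ᶻ-mod : ∀ {M} j {g g′} → (∀ i → i ℕ.< j → g i ≡ g′ i [mod M ]) → ∏ᶻ j g ≡ ∏ᶻ j g′ [mod M ]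
∏ᶻ-mod zero    p = mod-refl 1ℤ
∏ᶻ-mod (suc j) p = mod-* (∏ᶻ-mod j (λ i i<j → p i (ℕ.m≤n⇒m≤1+n i<j))) (p j ℕ.≤-refl)

ascending : ℕ → ℕ → ℕ
ascending n zero    = 1
ascending n (suc j) = ascending n j ℕ.* (n ℕ.+ suc j)

ascending-! : ∀ n j → (n ℕ.+ j) ! ≡ ascending n j ℕ.* n !
ascending-! n zero    = trans (cong _! (ℕ.+-identityʳ n)) (sym (ℕ.*-identityˡ (n !)))
ascending-! n (suc j) = begin
  (n ℕ.+ suc j) !                            ≡⟨ cong _! (ℕ.+-suc n j) ⟩
  suc (n ℕ.+ j) ℕ.* (n ℕ.+ j) !              ≡⟨ cong₂ ℕ._*_ (sym (ℕ.+-suc n j)) (ascending-! n j) ⟩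
  (n ℕ.+ suc j) ℕ.* (ascending n j ℕ.* n !)  ≡⟨ lem (n ℕ.+ suc j) (ascending n j) (n !) ⟩
  ascending n j ℕ.* (n ℕ.+ suc j) ℕ.* n !    ∎
  where
  open ≡-Reasoning
  lem : ∀ a b c → a ℕ.* (b ℕ.* c) ≡ b ℕ.* a ℕ.* c
  lem = ℕRing.solve-∀

ascending≢0 : ∀ n j → + ascending n j ≢ 0ℤ
ascending≢0 n j eq = ℕ.≢-nonZero⁻¹ ((n ℕ.+ j) !) {{(n ℕ.+ j) ℕ.!≢0}} (trans (ascending-! n j) (cong (ℕ._* n !) (ℤ.+-injective eq)))

odd-ascending : ∀ n j → odd (+ ascending n j) ≡ ∏ᶻ j (λ i → odd (+ (n ℕ.+ suc i)))
odd-ascending n zero    = odd-of-odd odd-1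
odd-ascending n (suc j) = begin
  odd (+ (ascending n j ℕ.* (n ℕ.+ suc j)))        ≡⟨ cong odd (ℤ.pos-* (ascending n j) (n ℕ.+ suc j)) ⟩
  odd (+ ascending n j * + (n ℕ.+ suc j))          ≡⟨ odd-distrib-* (ascending≢0 n j) (λ eq → ℕ.m+1+n≢0 n (ℤ.+-injective eq)) ⟩
  odd (+ ascending n j) * odd (+ (n ℕ.+ suc j))    ≡⟨ cong (_* odd (+ (n ℕ.+ suc j))) (odd-ascending n j) ⟩
  ∏ᶻ (suc j) (λ i → odd (+ (n ℕ.+ suc i)))         ∎
  where open ≡-Reasoning

-- Binary digits and vectors of residues

half : ℕ → ℕ
half zero          = 0
half (suc zero)    = 0
half (suc (suc n)) = suc (half n)

lastBit : ℕ → Bit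
lastBit zero          = zero
lastBit (suc zero)    = suc zero
lastBit (suc (suc n)) = lastBit n

half-lastBit : ∀ n → n ≡ half n ℕ.* 2 ℕ.+ toℕ (lastBit n)
half-lastBit zero          = refl
half-lastBit (suc zero)    = refl
half-lastBit (suc (suc n)) = cong (λ k → suc (suc k)) (half-lastBit n)

half-append : ∀ n (b : Bit) → half (n ℕ.* 2 ℕ.+ toℕ b) ≡ n
half-append zero    zero       = refl
half-append zero    (suc zero) = refl
half-append (suc n) b          = cong suc (half-append n b)

lastBit-append : ∀ n (b : Bit) → lastBit (n ℕ.* 2 ℕ.+ toℕ b) ≡ b
lastBit-append zero    zero       = refl
lastBit-append zero    (suc zero) = refl
lastBit-append (suc n) b          = lastBit-append n b

digit : Bit → Bit → Fin 4
digit zero       zero       = zero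
digit zero       (suc zero) = suc zero
digit (suc zero) zero       = suc (suc zero)
digit (suc zero) (suc zero) = suc (suc (suc zero))

toℕ-digit : ∀ b b′ → toℕ (digit b b′) ≡ toℕ b ℕ.* 2 ℕ.+ toℕ b′
toℕ-digit zero       zero       = refl
toℕ-digit zero       (suc zero) = refl
toℕ-digit (suc zero) zero       = refl
toℕ-digit (suc zero) (suc zero) = refl

-- Out-of-range positions read as 0.
infixl 9 _‼_
_‼_ : ∀ {k n} → Vec (Fin k) n → ℕ → ℤ
[]       ‼ i     = 0ℤ
(x ∷ xs) ‼ zero  = ⟦ x ⟧
(x ∷ xs) ‼ suc i = xs ‼ i

tabulate-‼ : ∀ {k} n (g : ℕ → Fin k) i → i ℕ.< n → tabulate {n = n} (g ∘ toℕ) ‼ i ≡ ⟦ g i ⟧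
tabulate-‼ (suc n) g zero    _         = refl
tabulate-‼ (suc n) g (suc i) (s≤s i<n) = tabulate-‼ n (λ j → g (suc j)) i i<n

residues : ∀ s n → (ℕ → ℤ) → Vec (Fin (2 ℕ.^ s)) n
residues s n g = tabulate (λ i → g (toℕ i) mod2^ s)

residues-‼ : ∀ s n g i → i ℕ.< n → residues s n g ‼ i ≡ g i [mod 2^ s ]
residues-‼ s n g i i<n = subst (_≡ g i [mod 2^ s ]) (sym (tabulate-‼ n (λ j → g j mod2^ s) i i<n)) (⟦mod2^⟧ s (g i))

residues-cong : ∀ s n {g g′} → (∀ i → i ℕ.< n → g i ≡ g′ i [mod 2^ s ]) → residues s n g ≡ residues s n g′
residues-cong s n p = tabulate-cong (λ i → mod2^-cong s (p (toℕ i) (toℕ<n i)))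

mod2^-split : ∀ L n → ∃ λ q → n ≡ toℕ ((+ n) mod2^ L) ℕ.+ q ℕ.* 2 ℕ.^ L
mod2^-split L n = n / 2 ℕ.^ L , trans (m≡m%n+[m/n]*n n (2 ℕ.^ L)) (cong (ℕ._+ n / 2 ℕ.^ L ℕ.* 2 ℕ.^ L) (sym (toℕ-fromℕ< (n%ℕd<d (+ n) (2 ℕ.^ L)))))
  where instance _ = ℕ.m^n≢0 2 L

-- The base-4 recurrence on windows of fixed length

module WindowStep
  (s L m H : ℕ) (bound : Fin 4 → ℕ) (weight : Fin 4 → ℕ → ℕ → ℤ) (û : ℕ → ℤ)
  (4H≡3m : H ℕ.* 4 ≡ 3 ℕ.* m)
  (bound≤H : ∀ c → bound c ℕ.≤ H)
  (weight-periodic : ∀ c {k} → k ℕ.≤ bound c → ∀ n j → weight c k (n ℕ.+ j ℕ.* 2 ℕ.^ L) ≡ weight c k n [mod 2^ s ])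
  (û-recurrence : ∀ c n → û (n ℕ.* 4 ℕ.+ toℕ c) ≡ sum {suc (bound c)} (λ k → weight c (toℕ k) n * delay m û (n ℕ.+ m ∸ toℕ k)) [mod 2^ s ])
  where

  Window : Set
  Window = Vec (Fin (2 ℕ.^ s)) (suc m)

  -- Position i stands for û (n - m + i), so the last position, m, is û n.
  window : ℕ → Window
  window n = residues s (suc m) (λ i → delay m û (n ℕ.+ i))

  -- ρ + a + (2^L - 1) m represents ⌊n/2⌋ + a - m modulo 2^L.
  nextU : ℕ → Window → ∀ {x : ℕ} → DivMod x 4 → ℤ
  nextU ρ z (result a c′ _) = sum {suc (bound c′)} (λ k → weight c′ (toℕ k) (ρ ℕ.+ a ℕ.+ (2 ℕ.^ L ∸ 1) ℕ.* m) * (z ‼ (a ∸ toℕ k)))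

  -- Dividing x + 3 m by 4 gives 4 h + x - m = 4 (h + a - m) + c′ without leaving ℕ. The recurrence
  -- then reads û at h + a - m - k with k ≤ H, and these places lie in the window of h because H ≤ a
  -- ≤ m; the first inequality comes from 4 H = 3 m. So the length m + 1 reproduces itself.
  nextU-correct : ∀ h x → x ℕ.≤ 3 ℕ.+ m → (d : DivMod (x ℕ.+ 3 ℕ.* m) 4) →
    delay m û (h ℕ.* 4 ℕ.+ x) ≡ nextU (toℕ ((+ h) mod2^ L)) (window h) d [mod 2^ s ]
  nextU-correct h x x≤ (result a c′ eq) = mod-trans (by-size (ℕ.<-≤-connex (h ℕ.+ a) m))
      (mod-sum (suc (bound c′)) (λ k → mod-* (mod-refl (weight c′ (toℕ k) R)) (mod-sym (residues-‼ s (suc m) (λ i → delay m û (h ℕ.+ i)) (a ∸ toℕ k) (s≤s (ℕ.≤-trans (ℕ.m∸n≤m a (toℕ k)) a≤m))))))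
    where
    ρ = toℕ ((+ h) mod2^ L)
    P = 2 ℕ.^ L
    R = ρ ℕ.+ a ℕ.+ (P ∸ 1) ℕ.* m
    a≤m : a ℕ.≤ m
    a≤m = ℕ.≮⇒≥ λ m<a → ℕ.<⇒≱ (ℕ.≤-trans (s≤s (ℕ.≤-trans (ℕ.+-monoˡ-≤ (3 ℕ.* m) x≤) (ℕ.≤-reflexive (lem m)))) (ℕ.*-monoˡ-≤ 4 m<a))
        (ℕ.≤-trans (ℕ.m≤n+m (a ℕ.* 4) (toℕ c′)) (ℕ.≤-reflexive (sym eq)))
      where
      lem : ∀ m → 3 ℕ.+ m ℕ.+ 3 ℕ.* m ≡ 3 ℕ.+ m ℕ.* 4
      lem = ℕRing.solve-∀
    H≤a : H ℕ.≤ a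
    H≤a = ℕ.≮⇒≥ λ a<H → ℕ.<⇒≱ (ℕ.≤-trans (s≤s (ℕ.+-monoˡ-≤ (a ℕ.* 4) (toℕ≤pred[n] c′))) (ℕ.*-monoˡ-≤ 4 a<H))
        (ℕ.≤-trans (ℕ.≤-reflexive 4H≡3m) (ℕ.≤-trans (ℕ.m≤n+m (3 ℕ.* m) x) (ℕ.≤-reflexive eq)))
    total : h ℕ.* 4 ℕ.+ x ℕ.+ 3 ℕ.* m ≡ (h ℕ.+ a) ℕ.* 4 ℕ.+ toℕ c′
    total = trans (ℕ.+-assoc (h ℕ.* 4) x (3 ℕ.* m)) (trans (cong (h ℕ.* 4 ℕ.+_) eq) (lem h a (toℕ c′)))
      where
      lem : ∀ h a c → h ℕ.* 4 ℕ.+ (c ℕ.+ a ℕ.* 4) ≡ (h ℕ.+ a) ℕ.* 4 ℕ.+ c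
      lem = ℕRing.solve-∀
    k≤a : ∀ {k} → k ℕ.≤ bound c′ → k ℕ.≤ a
    k≤a k≤b = ℕ.≤-trans k≤b (ℕ.≤-trans (bound≤H c′) H≤a)
    by-size : (h ℕ.+ a ℕ.< m) ⊎ (m ℕ.≤ h ℕ.+ a) → delay m û (h ℕ.* 4 ℕ.+ x) ≡
      sum {suc (bound c′)} (λ k → weight c′ (toℕ k) R * delay m û (h ℕ.+ (a ∸ toℕ k))) [mod 2^ s ]
    -- Here all arguments are negative before the shift by m, and both sides are 0.
    by-size (inj₁ M<m) = mod-reflexive (trans (delay-< û index<m)
        (sym (trans (sum-cong-≗ {suc (bound c′)} (λ k → trans (cong (weight c′ (toℕ k) R *_) (delay-< û (ℕ.≤-<-trans (ℕ.+-monoʳ-≤ h (ℕ.m∸n≤m a (toℕ k))) M<m)))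
          (ℤ.*-zeroʳ (weight c′ (toℕ k) R)))) (sum-zero (suc (bound c′))))))
      where
      sum-zero : ∀ n → sum {n} (λ _ → 0ℤ) ≡ 0ℤ
      sum-zero zero    = refl
      sum-zero (suc n) = trans (ℤ.+-identityˡ _) (sum-zero n)
      index<m : h ℕ.* 4 ℕ.+ x ℕ.< m
      index<m = ℕ.+-cancelʳ-< (3 ℕ.* m) _ _ (ℕ.≤-trans (s≤s (ℕ.≤-trans (ℕ.≤-reflexive total) (ℕ.+-monoʳ-≤ ((h ℕ.+ a) ℕ.* 4) (toℕ≤pred[n] c′))))
        (ℕ.≤-trans (ℕ.≤-reflexive (lem (h ℕ.+ a))) (ℕ.≤-trans (ℕ.*-monoˡ-≤ 4 M<m) (ℕ.≤-reflexive (lem′ m)))))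
        where
        lem : ∀ M → suc (M ℕ.* 4 ℕ.+ 3) ≡ suc M ℕ.* 4
        lem = ℕRing.solve-∀
        lem′ : ∀ m → m ℕ.* 4 ≡ m ℕ.+ 3 ℕ.* m
        lem′ = ℕRing.solve-∀
    by-size (inj₂ m≤M) = mod-trans (mod-reflexive (trans (cong (delay m û) index≡) (delay-+ m û (n₀ ℕ.* 4 ℕ.+ toℕ c′))))
        (mod-trans (û-recurrence c′ n₀) (mod-sum (suc (bound c′)) (λ k → mod-* (weight≡ (toℕ≤pred[n] k)) (mod-reflexive (cong (delay m û) (shifted (toℕ≤pred[n] k)))))))
      where
      n₀ = h ℕ.+ a ∸ m
      n₀+m : n₀ ℕ.+ m ≡ h ℕ.+ a
      n₀+m = ℕ.m∸n+n≡m m≤M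
      index≡ : h ℕ.* 4 ℕ.+ x ≡ m ℕ.+ (n₀ ℕ.* 4 ℕ.+ toℕ c′)
      index≡ = ℕ.+-cancelʳ-≡ (3 ℕ.* m) _ _ (trans total (trans (cong (λ M → M ℕ.* 4 ℕ.+ toℕ c′) (sym n₀+m)) (lem n₀ m (toℕ c′))))
        where
        lem : ∀ n m c → (n ℕ.+ m) ℕ.* 4 ℕ.+ c ≡ m ℕ.+ (n ℕ.* 4 ℕ.+ c) ℕ.+ 3 ℕ.* m
        lem = ℕRing.solve-∀
      shifted : ∀ {k} → k ℕ.≤ bound c′ → n₀ ℕ.+ m ∸ k ≡ h ℕ.+ (a ∸ k)
      shifted {k} k≤b = trans (cong (_∸ k) n₀+m) (ℕ.+-∸-assoc h (k≤a k≤b))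
      -- With h = ρ + Q P one has n₀ + m P = R + Q P, so both arguments reach the same number by
      -- multiples of the period. The additional m in `same` replaces n₀ by n₀ + m = h + a.
      weight≡ : ∀ {k} → k ℕ.≤ bound c′ → weight c′ k n₀ ≡ weight c′ k R [mod 2^ s ]
      weight≡ {k} k≤b = mod-trans (mod-sym (weight-periodic c′ k≤b n₀ m))
        (mod-trans (mod-reflexive (cong (weight c′ k) (ℕ.+-cancelʳ-≡ m _ _ same))) (weight-periodic c′ k≤b R Q))
        where
        open ≡-Reasoning
        Q = proj₁ (mod2^-split L h)
        P≡ : P ≡ suc (P ∸ 1)
        P≡ = sym (ℕ.m+[n∸m]≡n (ℕ.m^n>0 2 L))
        lem : ∀ ρ q P a m → ρ ℕ.+ q ℕ.* P ℕ.+ a ℕ.+ m ℕ.* P ≡ ρ ℕ.+ a ℕ.+ q ℕ.* P ℕ.+ m ℕ.* P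
        lem = ℕRing.solve-∀
        lem₁ : ∀ n m y → n ℕ.+ y ℕ.+ m ≡ n ℕ.+ m ℕ.+ y
        lem₁ = ℕRing.solve-∀
        lem₂ : ∀ ρ a y m P′ → ρ ℕ.+ a ℕ.+ y ℕ.+ m ℕ.* suc P′ ≡ ρ ℕ.+ a ℕ.+ P′ ℕ.* m ℕ.+ y ℕ.+ m
        lem₂ = ℕRing.solve-∀
        same : n₀ ℕ.+ m ℕ.* P ℕ.+ m ≡ R ℕ.+ Q ℕ.* P ℕ.+ m
        same = begin
          n₀ ℕ.+ m ℕ.* P ℕ.+ m                       ≡⟨ lem₁ n₀ m (m ℕ.* P) ⟩
          n₀ ℕ.+ m ℕ.+ m ℕ.* P                       ≡⟨ cong (ℕ._+ m ℕ.* P) (trans n₀+m (cong (ℕ._+ a) (proj₂ (mod2^-split L h)))) ⟩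
          ρ ℕ.+ Q ℕ.* P ℕ.+ a ℕ.+ m ℕ.* P            ≡⟨ lem ρ Q P a m ⟩
          ρ ℕ.+ a ℕ.+ Q ℕ.* P ℕ.+ m ℕ.* P            ≡⟨ cong (λ z → ρ ℕ.+ a ℕ.+ Q ℕ.* P ℕ.+ m ℕ.* z) P≡ ⟩
          ρ ℕ.+ a ℕ.+ Q ℕ.* P ℕ.+ m ℕ.* suc (P ∸ 1)  ≡⟨ lem₂ ρ a (Q ℕ.* P) m (P ∸ 1) ⟩
          R ℕ.+ Q ℕ.* P ℕ.+ m                        ∎

module Automaton (𝓔 : Exponent) (s : ℕ) (1≤s : 1 ℕ.≤ s) where
  open Exponent 𝓔
  open Weights 𝓔 s
  open Residues 𝓔 s

  -- It accounts for the denominator in g n = (n + 1) ⋯ (n + μ) / μ!.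
  κ : ℤ
  κ = inv s (odd (+ (μ !)))

  odd-f : ∀ n → odd (f n) ≡ κ * ∏ᶻ μ (λ i → odd (+ (n ℕ.+ suc i))) * û n [mod 2^ s ]
  odd-f n = mod-trans (odd-ratio 1≤s (multichoose≢0 n) (û-odd n) (û-ratio n)) (mod-* (mod-trans
      (subst (_≡ κ * (odd (+ (μ !)) * odd (+ multichoose n)) [mod 2^ s ]) (ℤ.*-identityˡ (odd (+ multichoose n)))
        (subst (1ℤ * odd (+ multichoose n) ≡_[mod 2^ s ]) (lem (odd (+ (μ !))) κ (odd (+ multichoose n)))
          (mod-* (mod-sym (inv-correct s (odd-odd μ!≢0))) (mod-refl (odd (+ multichoose n))))))
      (mod-reflexive (cong (κ *_) product))) (mod-refl (û n)))
    where
    open ≡-Reasoning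
    μ!≢0 : + (μ !) ≢ 0ℤ
    μ!≢0 eq = ℕ.≢-nonZero⁻¹ (μ !) {{μ ℕ.!≢0}} (ℤ.+-injective eq)
    lem : ∀ o k r → o * k * r ≡ k * (o * r)
    lem = solve-∀
    lem′ : ∀ r n μ → r ℕ.* (n ℕ.* μ) ≡ μ ℕ.* r ℕ.* n
    lem′ = ℕRing.solve-∀
    natural : μ ! ℕ.* multichoose n ≡ ascending n μ
    natural = ℕ.*-cancelʳ-≡ _ _ (n !) {{n ℕ.!≢0}} (trans (sym (lem′ (multichoose n) (n !) (μ !))) (trans (C-factorial′ n μ) (ascending-! n μ)))
    product : odd (+ (μ !)) * odd (+ multichoose n) ≡ ∏ᶻ μ (λ i → odd (+ (n ℕ.+ suc i)))
    product = begin
      odd (+ (μ !)) * odd (+ multichoose n)             ≡⟨ odd-distrib-* μ!≢0 (multichoose≢0 n) ⟨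
      odd (+ (μ !) * + multichoose n)                   ≡⟨ cong odd (ℤ.pos-* (μ !) (multichoose n)) ⟨
      odd (+ (μ ! ℕ.* multichoose n))                   ≡⟨ cong (λ z → odd (+ z)) natural ⟩
      odd (+ ascending n μ)                        ≡⟨ odd-ascending n μ ⟩
      ∏ᶻ μ (λ i → odd (+ (n ℕ.+ suc i)))           ∎

  L : ℕ
  L = s ℕ.* suc H

  4H≡3m : H ℕ.* 4 ≡ 3 ℕ.* m
  4H≡3m = trans (cong (ℕ._* 4) H≡3a) (trans (lem p) (cong (3 ℕ.*_) (sym (trans m≡suc-μ (cong suc μ≡)))))
    where
    lem : ∀ p → 3 ℕ.* suc p ℕ.* 4 ≡ 3 ℕ.* (4 ℕ.+ p ℕ.* 4)
    lem = ℕRing.solve-∀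

  open WindowStep s L m H bound weight û 4H≡3m bound≤H weight-periodic û-recurrence

  -- The last digit of n, the residue of ⌊n/2⌋, the odd parts of n, …, n + m,
  -- and û on the windows of length m + 1 ending at n and at ⌊n/2⌋.
  State : Set
  State = Bit × Fin (2 ℕ.^ L) × Window × Window × Window

  finite-State : Finite State
  finite-State = finite-× (finite-Fin 2) (finite-× (finite-Fin (2 ℕ.^ L)) (finite-× W (finite-× W W)))
    where W = finite-Vec (finite-Fin (2 ℕ.^ s)) (suc m)

  oddParts : ℕ → Window
  oddParts n = residues s (suc m) (λ i → odd (+ (n ℕ.+ i)))

  σ : ℕ → State
  σ n = lastBit n , (+ half n) mod2^ L , oddParts n , window n , window (half n)

  -- The odd part of 2 n + 2 j is that of n + j, which is stored in `os`. The number 2 n + 2 j + 1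
  -- is its own odd part, and its residue follows from that of n, given by `x`.
  nextOdd : Window → ℕ → ∀ {N} → Parity N → ℤ
  nextOdd os x (even j) = os ‼ j
  nextOdd os x (odd′ j) = + (x ℕ.* 2 ℕ.+ suc (j ℕ.* 2))

  step : State → Bit → State
  step (b₀ , ρ , os , y , z) b =
    b ,
    (+ (toℕ ρ ℕ.* 2 ℕ.+ toℕ b₀)) mod2^ L ,
    residues s (suc m) (λ i → nextOdd os (toℕ ρ ℕ.* 2 ℕ.+ toℕ b₀) (parity (toℕ b ℕ.+ i))) ,
    -- The recurrence reaches 2 n + b from ⌊n/2⌋, so it reads the older window `z`; the current
    -- window `y` is the older one at the next step.
    residues s (suc m) (λ i → nextU (toℕ ρ) z ((toℕ (digit b₀ b) ℕ.+ i ℕ.+ 3 ℕ.* m) divMod 4)) ,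
    y

  out : State → Fin (2 ℕ.^ s)
  out (b₀ , ρ , os , y , z) = (κ * ∏ᶻ μ (λ i → os ‼ suc i) * (y ‼ m)) mod2^ s

  s≤L : s ℕ.≤ L
  s≤L = ℕ.≤-trans (ℕ.m≤m+n s (s ℕ.* H)) (ℕ.≤-reflexive (sym (ℕ.*-suc s H)))

  step-index : ∀ n → + (toℕ ((+ half n) mod2^ L) ℕ.* 2 ℕ.+ toℕ (lastBit n)) ≡ + n [mod 2^ L ]
  step-index n = subst (+ (ρ ℕ.* 2 ℕ.+ toℕ (lastBit n)) ≡_[mod 2^ L ]) (cong +_ (sym (half-lastBit n)))
    (mod-+ (modℕ-* ρ (half n) 2 2 (⟦mod2^⟧ L (+ half n)) (mod-refl (+ 2))) (mod-refl (+ toℕ (lastBit n))))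
    where ρ = toℕ ((+ half n) mod2^ L)

  nextOdd-correct : ∀ n x → + x ≡ + n [mod 2^ s ] → ∀ {N} (P : Parity N) → N ℕ.≤ suc m →
    odd (+ (n ℕ.* 2 ℕ.+ N)) ≡ nextOdd (oddParts n) x P [mod 2^ s ]
  nextOdd-correct n x x≡n (even j) N≤ = mod-trans
    (mod-reflexive (trans (cong odd (trans (cong +_ (lem n j)) (ℤ.pos-* (n ℕ.+ j) 2))) (odd-double (+ (n ℕ.+ j)))))
    (mod-sym (residues-‼ s (suc m) (λ i → odd (+ (n ℕ.+ i))) j (bounded j N≤)))
    where
    lem : ∀ n j → n ℕ.* 2 ℕ.+ j ℕ.* 2 ≡ (n ℕ.+ j) ℕ.* 2
    lem = ℕRing.solve-∀
    bounded : ∀ j → j ℕ.* 2 ℕ.≤ suc m → j ℕ.< suc m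
    bounded zero    _         = s≤s z≤n
    bounded (suc j) (s≤s le) = s≤s (ℕ.≤-trans (s≤s (ℕ.m≤m*n j 2)) le)
  nextOdd-correct n x x≡n (odd′ j) N≤ = mod-trans
    (mod-reflexive (odd-of-odd (oddℕ (n ℕ.+ j) (lem n j))))
    (mod-+ (modℕ-* n x 2 2 (mod-sym x≡n) (mod-refl (+ 2))) (mod-refl (+ suc (j ℕ.* 2))))
    where
    lem : ∀ n j → n ℕ.* 2 ℕ.+ suc (j ℕ.* 2) ≡ 1 ℕ.+ (n ℕ.+ j) ℕ.* 2
    lem = ℕRing.solve-∀

  σ-step : ∀ b n → σ (n ℕ.* 2 ℕ.+ toℕ b) ≡ step (σ n) b
  σ-step b n = cong₂ _,_ (lastBit-append n b) (cong₂ _,_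
    (trans (cong (λ h → (+ h) mod2^ L) (half-append n b)) (mod2^-cong L (mod-sym (step-index n))))
    (cong₂ _,_ odd-step (cong₂ _,_ window-step (cong window (half-append n b)))))
    where
    ρ = toℕ ((+ half n) mod2^ L)
    b₀ = lastBit n
    bit≤1 : ∀ (b : Bit) → toℕ b ℕ.≤ 1
    bit≤1 = toℕ≤pred[n]
    odd-step : oddParts (n ℕ.* 2 ℕ.+ toℕ b) ≡ residues s (suc m) (λ i → nextOdd (oddParts n) (ρ ℕ.* 2 ℕ.+ toℕ b₀) (parity (toℕ b ℕ.+ i)))
    odd-step = residues-cong s (suc m) λ i i<1+m → mod-trans (mod-reflexive (cong (λ z → odd (+ z)) (ℕ.+-assoc (n ℕ.* 2) (toℕ b) i)))
      (nextOdd-correct n (ρ ℕ.* 2 ℕ.+ toℕ b₀) (mod-∣ (2^-mono s≤L) (step-index n)) (parity (toℕ b ℕ.+ i)) (ℕ.+-mono-≤ (bit≤1 b) (ℕ.s≤s⁻¹ i<1+m)))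
    window-step : window (n ℕ.* 2 ℕ.+ toℕ b) ≡ residues s (suc m) (λ i → nextU ρ (window (half n)) ((toℕ (digit b₀ b) ℕ.+ i ℕ.+ 3 ℕ.* m) divMod 4))
    window-step = residues-cong s (suc m) λ i i<1+m → mod-trans (mod-reflexive (cong (delay m û) (trans (cong (ℕ._+ i) (index b)) (ℕ.+-assoc (half n ℕ.* 4) (toℕ (digit b₀ b)) i))))
      (nextU-correct (half n) (toℕ (digit b₀ b) ℕ.+ i) (ℕ.+-mono-≤ (toℕ≤pred[n] (digit b₀ b)) (ℕ.s≤s⁻¹ i<1+m)) ((toℕ (digit b₀ b) ℕ.+ i ℕ.+ 3 ℕ.* m) divMod 4))
      where
      lem : ∀ h b b′ → (h ℕ.* 2 ℕ.+ b) ℕ.* 2 ℕ.+ b′ ≡ h ℕ.* 4 ℕ.+ (b ℕ.* 2 ℕ.+ b′)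
      lem = ℕRing.solve-∀
      index : ∀ b → n ℕ.* 2 ℕ.+ toℕ b ≡ half n ℕ.* 4 ℕ.+ toℕ (digit b₀ b)
      index b = trans (cong (λ n → n ℕ.* 2 ℕ.+ toℕ b) (half-lastBit n)) (trans (lem (half n) (toℕ b₀) (toℕ b)) (cong (half n ℕ.* 4 ℕ.+_) (sym (toℕ-digit b₀ b))))

  out-σ : ∀ n → out (σ n) ≡ odd (f n) mod2^ s
  out-σ n = mod2^-cong s (mod-trans (mod-* (mod-* (mod-refl κ)
      (∏ᶻ-mod μ (λ i i<μ → residues-‼ s (suc m) (λ i → odd (+ (n ℕ.+ i))) (suc i) (s≤s (ℕ.≤-trans i<μ μ≤m)))))
      (mod-trans (residues-‼ s (suc m) (λ i → delay m û (n ℕ.+ i)) m ℕ.≤-refl)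
        (mod-reflexive (trans (cong (delay m û) (ℕ.+-comm n m)) (delay-+ m û n)))))
    (mod-sym (odd-f n)))
    where
    μ≤m : μ ℕ.≤ m
    μ≤m = ℕ.≤-trans (ℕ.n≤1+n μ) (ℕ.≤-reflexive (sym m≡suc-μ))

  odd-f-automatic : 2-Automatic (λ n → odd (f n) mod2^ s)
  odd-f-automatic = proj₁ automaton , λ n → trans (proj₂ automaton n) (out-σ n)
    where
    automaton : 2-Automatic (λ n → out (σ n))
    automaton = automatic finite-State σ step σ-step out

-- The exponents 3 · 2^r

exponent : ∀ p u H G μ m o₃ o₉ o₁₂ → H ≡ 3 ℕ.* suc p → H ≡ suc G → μ ≡ 3 ℕ.+ p ℕ.* 4 → m ≡ suc μ →
  3 ℕ.* 2 ℕ.^ u ≡ 2 ℕ.* suc p → 2 ℕ.≤ 2 ℕ.^ u → Oddℕ o₃ → Oddℕ o₉ → Oddℕ o₁₂ →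
  suc p ! ℕ.* 4 ≡ 2 ℕ.^ suc p ℕ.* o₃ → H ! ℕ.* 4 ≡ 2 ℕ.^ H ℕ.* o₉ →
  (suc p ℕ.+ H) ! ℕ.* 4 ≡ 2 ℕ.^ (suc p ℕ.+ H) ℕ.* o₁₂ → Exponent
exponent p u H G μ m o₃ o₉ o₁₂ H≡3a H≡suc-G μ≡ m≡suc-μ 3q≡2a 2≤q odd₃ odd₉ odd₁₂ eq₃ eq₉ eq₁₂ = record
  { p = p ; u = u ; H = H ; G = G ; μ = μ ; m = m
  ; H≡3a = H≡3a ; H≡suc-G = H≡suc-G ; μ≡ = μ≡ ; m≡suc-μ = m≡suc-μ ; 3q≡2a = 3q≡2a ; 2≤q = 2≤q
  ; η = o₉ ; η-odd = odd₉ ; H!-twos = eq₉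
  ; C-odd₀ = oddℕ-*⁻ˡ ((p ℕ.+ H) C H) (o₃ ℕ.* o₉) (subst Oddℕ (sym key₀) odd₁₂)
  ; C-odd₁ = oddℕ-*⁻ˡ ((suc p ℕ.+ G) C G) (o₃ ℕ.* o₉) (subst Oddℕ (sym key₁) (oddℕ-* {3} (oddℕ-2* 1) odd₁₂))
  }
  where
  open ≡-Reasoning
  two-bits : ((suc p ℕ.+ H) C H) ℕ.* (o₃ ℕ.* o₉) ≡ 4 ℕ.* o₁₂
  two-bits = C-two-bits (suc p) H o₃ o₉ o₁₂ eq₃ eq₉ eq₁₂
  total : suc p ℕ.+ H ≡ 4 ℕ.* suc p
  total = cong (λ z → suc p ℕ.+ z) H≡3a
  key₀ : ((p ℕ.+ H) C H) ℕ.* (o₃ ℕ.* o₉) ≡ o₁₂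
  key₀ = ℕ.*-cancelˡ-≡ _ _ 4 (begin
    4 ℕ.* (((p ℕ.+ H) C H) ℕ.* (o₃ ℕ.* o₉))  ≡⟨ ℕ.*-assoc 4 ((p ℕ.+ H) C H) (o₃ ℕ.* o₉) ⟨
    4 ℕ.* ((p ℕ.+ H) C H) ℕ.* (o₃ ℕ.* o₉)    ≡⟨ cong (ℕ._* (o₃ ℕ.* o₉)) (C-pred-a p H total) ⟨
    ((suc p ℕ.+ H) C H) ℕ.* (o₃ ℕ.* o₉)      ≡⟨ two-bits ⟩
    4 ℕ.* o₁₂                                ∎)
  key₁ : ((suc p ℕ.+ G) C G) ℕ.* (o₃ ℕ.* o₉) ≡ 3 ℕ.* o₁₂
  key₁ = ℕ.*-cancelˡ-≡ _ _ 4 (begin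
    4 ℕ.* (((suc p ℕ.+ G) C G) ℕ.* (o₃ ℕ.* o₉))        ≡⟨ ℕ.*-assoc 4 ((suc p ℕ.+ G) C G) (o₃ ℕ.* o₉) ⟨
    4 ℕ.* ((suc p ℕ.+ G) C G) ℕ.* (o₃ ℕ.* o₉)          ≡⟨ cong (ℕ._* (o₃ ℕ.* o₉)) (C-pred-b (suc p) G (trans (sym H≡suc-G) H≡3a)) ⟨
    3 ℕ.* ((suc p ℕ.+ suc G) C suc G) ℕ.* (o₃ ℕ.* o₉)  ≡⟨ cong (λ n → 3 ℕ.* ((suc p ℕ.+ n) C n) ℕ.* (o₃ ℕ.* o₉)) H≡suc-G ⟨
    3 ℕ.* ((suc p ℕ.+ H) C H) ℕ.* (o₃ ℕ.* o₉)          ≡⟨ ℕ.*-assoc 3 ((suc p ℕ.+ H) C H) (o₃ ℕ.* o₉) ⟩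
    3 ℕ.* (((suc p ℕ.+ H) C H) ℕ.* (o₃ ℕ.* o₉))        ≡⟨ cong (3 ℕ.*_) two-bits ⟩
    3 ℕ.* (4 ℕ.* o₁₂)                                  ≡⟨ lem o₁₂ ⟩
    4 ℕ.* (3 ℕ.* o₁₂)                                  ∎)
    where
    lem : ∀ x → 3 ℕ.* (4 ℕ.* x) ≡ 4 ℕ.* (3 ℕ.* x)
    lem = ℕRing.solve-∀

-- By Legendre's formula this says that n has exactly two binary digits 1.
TwoBits : ℕ → Set
TwoBits n = ∃ λ o → Oddℕ o × n ! ℕ.* 4 ≡ 2 ℕ.^ n ℕ.* o

exponent-3*4* : ∀ p u x → suc p ≡ 3 ℕ.* x → 2 ℕ.^ u ≡ 2 ℕ.* x → 2 ℕ.≤ 2 ℕ.^ u →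
  TwoBits (3 ℕ.* x) → TwoBits (9 ℕ.* x) → TwoBits (12 ℕ.* x) → ∃ λ 𝓔 → Exponent.m 𝓔 ≡ 4 ℕ.* (3 ℕ.* x)
exponent-3*4* p u x a≡3x q≡2x 2≤q bits₃ bits₉ bits₁₂ = build (subst TwoBits (sym a≡3x) bits₃)
  (subst TwoBits (trans (lem₉ x) (cong (3 ℕ.*_) (sym a≡3x))) bits₉)
  (subst TwoBits (trans (lem₁₂ x) (cong (λ a → a ℕ.+ 3 ℕ.* a) (sym a≡3x))) bits₁₂)
  where
  lem₉ : ∀ x → 9 ℕ.* x ≡ 3 ℕ.* (3 ℕ.* x)
  lem₉ = ℕRing.solve-∀
  lem₁₂ : ∀ x → 12 ℕ.* x ≡ 3 ℕ.* x ℕ.+ 3 ℕ.* (3 ℕ.* x)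
  lem₁₂ = ℕRing.solve-∀
  lem₆ : ∀ x → 3 ℕ.* (2 ℕ.* x) ≡ 2 ℕ.* (3 ℕ.* x)
  lem₆ = ℕRing.solve-∀
  lemG : ∀ p → 3 ℕ.* suc p ≡ suc (3 ℕ.* p ℕ.+ 2)
  lemG = ℕRing.solve-∀
  lem-m : ∀ p → suc (3 ℕ.+ p ℕ.* 4) ≡ 4 ℕ.* suc p
  lem-m = ℕRing.solve-∀
  build : TwoBits (suc p) → TwoBits (3 ℕ.* suc p) → TwoBits (suc p ℕ.+ 3 ℕ.* suc p) → ∃ λ 𝓔 → Exponent.m 𝓔 ≡ 4 ℕ.* (3 ℕ.* x)
  build (o₃ , odd₃ , eq₃) (o₉ , odd₉ , eq₉) (o₁₂ , odd₁₂ , eq₁₂) =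
    exponent p u (3 ℕ.* suc p) (3 ℕ.* p ℕ.+ 2) (3 ℕ.+ p ℕ.* 4) (suc (3 ℕ.+ p ℕ.* 4)) o₃ o₉ o₁₂ refl (lemG p) refl refl
      (trans (cong (3 ℕ.*_) q≡2x) (trans (lem₆ x) (cong (2 ℕ.*_) (sym a≡3x)))) 2≤q odd₃ odd₉ odd₁₂ eq₃ eq₉ eq₁₂ ,
    trans (lem-m p) (cong (4 ℕ.*_) a≡3x)

theorem1p3 : (r s : ℕ) → 2 ℕ.≤ r → 1 ℕ.≤ s → 2-Automatic (λ n → odd (t (3 ℕ.* 2 ℕ.^ r) n) mod2^ s)
theorem1p3 (suc zero) s (s≤s ())
theorem1p3 (suc (suc r)) s _ 1≤s = from-exponent
  -- With x = 2 ^ r, where `r` is now the original exponent minus 2: p + 1 = 3 x, H = 9 x, q = 2 x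
  -- and m = 12 x. Since x ≥ 1, this gives q ≥ 2.
  (exponent-3*4* (ℕ.pred (3 ℕ.* 2 ℕ.^ r)) (suc r) (2 ℕ.^ r) (ℕ.suc-pred (3 ℕ.* 2 ℕ.^ r) {{ℕ.m*n≢0 3 (2 ℕ.^ r) {{_}} {{ℕ.m^n≢0 2 r}}}})
    refl (ℕ.*-monoʳ-≤ 2 (ℕ.m^n>0 2 r)) (factorial-3*2^ r) (factorial-9*2^ r) (factorial-12*2^ r))
  where
  lem : ∀ x → 4 ℕ.* (3 ℕ.* x) ≡ 3 ℕ.* (2 ℕ.* (2 ℕ.* x))
  lem = ℕRing.solve-∀
  from-exponent : (∃ λ 𝓔 → Exponent.m 𝓔 ≡ 4 ℕ.* (3 ℕ.* 2 ℕ.^ r)) → 2-Automatic (λ n → odd (t (3 ℕ.* 2 ℕ.^ suc (suc r)) n) mod2^ s)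
  from-exponent (𝓔 , m≡) = subst (λ m → 2-Automatic (λ n → odd (t m n) mod2^ s)) (trans m≡ (lem (2 ℕ.^ r)))
    (Automaton.odd-f-automatic 𝓔 s 1≤s)
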